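{- Let $k\leq n$ be positive integers, let $\lambda\vdash n$, $\mu\vdash k$ with $\mu\subset\lambda$, and let $F:D_\lambda\to[n]$ be a Young tableau with $F^{ -1}([k])=D_\mu$. Let $\mathcal{G}$ be the set of Young tableaux $G:D_\lambda\to[n]$ such that (1) $G^{ -1}(i)\preceq F^{ -1}(i)$ for all $i\in[k]$, with $G^{ -1}(i)\prec F^{ -1}(i)$ for at least one $i\in[k]$; and (2) $G^{ -1}([k])=D_\delta$ for some partition $\delta\subset\lambda$. Writing $F_0=F|_{D_\mu}$, we have in the generic tensor algebra \[[F]\in\mathscr{I}([F_0])+\mathscr{I}([G]:G\in\mathcal{G}).\] In particular, writing $G_0$ for the restriction of $G$ to $G^{ -1}([k])$, \[[F]\in\mathscr{I}([F_0])+\mathscr{I}([G_0]:G\in\mathcal{G}).\]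
   Context: $\mathbb{K}$ is a field of characteristic zero; $[n]=\{1,\dots,n\}$; permutations are multiplied by composition. A Young tableau of shape $\lambda\vdash n$ with entries in a set $A$ is a bijection $T:D_\lambda\to A$ where $D_\lambda=\{(i,j):1\leq j\leq\lambda_i\}$; rows $R_i(T)$, columns $C_j(T)$. For a set $X$, $\mathfrak{a}(X)=\sum_{\sigma\in\mathfrak{S}_X}\sigma$, $\mathfrak{b}(X)=\sum_{\tau\in\mathfrak{S}_X}\mathrm{sgn}(\tau)\tau$, and $\mathfrak{c}_\lambda(T)=\prod_i\mathfrak{a}(R_i(T))\cdot\prod_j\mathfrak{b}(C_j(T))\in\mathbb{K}[\mathfrak{S}_A]$. The generic tensor algebra $\mathscr{T}$ assigns to each finite set $A$ with $|A|=m$ the vector space $\mathscr{T}_A$ with basis the symbols $z_\alpha$, $\alpha:[m]\to A$ a bijection (thought of as $z_{\alpha(1)}\otimes\cdots\otimes z_{\alpha(m)}$); a bijection $\phi:A\to A'$ induces $\mathscr{T}_A\to\mathscr{T}_{A'}$, $z_\alpha\mapsto z_{\phi\circ\alpha}$ (so $\mathbb{K}[\mathfrak{S}_A]$ acts on $\mathscr{T}_A$). For disjoint $A,B$ with $|A|=r$, $|B|=s$, the product $\mathscr{T}_A\otimes\mathscr{T}_B\to\mathscr{T}_{A\sqcup B}$ is $z_\alpha\cdot z_\beta=z_\gamma$ with $\gamma(i)=\alpha(i)$ for $i\leq r$, $\gamma(i)=\beta(i-r)$ for $r<i\leq r+s$, extended bilinearly. An ideal is a family of subspaces $\mathscr{I}_A\subseteq\mathscr{T}_A$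 preserved by all maps induced by bijections and with $\mathscr{I}_A\cdot\mathscr{T}_B\subseteq\mathscr{I}_{A\sqcup B}$; the ideal generated by a set of elements is the smallest ideal containing them, and sums of ideals are taken componentwise. For a Young tableau $F:D_\lambda\to[n]$, the Young tabloid $[F]$ is the collection of elements $t_F(A,T)=\mathfrak{c}_\lambda(T)\cdot z_{T\circ F^{ -1}}\in\mathscr{T}_A$ for all sets $A$ with $|A|=n$ and all Young tableaux $T:D_\lambda\to A$, and $\mathscr{I}([F])$ (resp. $\mathscr{I}([G]:G\in\mathcal{G})$) is the ideal generated by all these elements (resp. for all $G\in\mathcal{G}$). For boxes, $(x_1,y_1)\preceq(x_2,y_2)$ means $y_1\leq y_2$ and $(x_1,y_1)\prec(x_2,y_2)$ means $y_1<y_2$ (comparison of column indices). -}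

module Defs where

open import Level using (Level; _⊔_) renaming (suc to lsuc)
open import Algebra.Bundles using (CommutativeRing)
open import Data.Nat using (ℕ; zero; suc; _<_; _≤_; _<ᵇ_; _≡ᵇ_) renaming (_+_ to _+ℕ_)
open import Data.Fin using (Fin; toℕ; _↑ˡ_; _↑ʳ_)
open import Data.Fin.Properties using () renaming (_≟_ to _≟ᶠ_)
open import Data.Vec as Vec using (Vec; lookup; tabulate)
open import Data.Vec.Properties using (≡-dec)
open import Data.List as List using (List; []; _∷_; _++_; concatMap; allFin; length; upTo; foldr)
open import Data.Nat.ListAction using (sum)
open import Data.Bool using (Bool; true; false; _∨_; not; if_then_else_; T)
open import Data.Product using (Σ; _×_; _,_; proj₁; proj₂; ∃; ∃-syntax)
open import Function.Bundles using (_↔_; Inverse)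
open import Function.Base using (id)
open import Relation.Nullary using (¬_; yes; no; does)
open import Relation.Binary.PropositionalEquality using (_≡_)

module _ {c ℓ : Level} (R : CommutativeRing c ℓ) where
  open CommutativeRing R
  natR : ℕ → Carrier
  natR zero = 0#
  natR (suc n) = 1# + natR n

record Char0Field (c ℓ : Level) : Set (lsuc (c ⊔ ℓ)) where
  field
    cring : CommutativeRing c ℓ
  open CommutativeRing cring public
  field
    0≉1 : ¬ (0# ≈ 1#)
    inverse : ∀ x → ¬ (x ≈ 0#) → ∃[ y ] (x * y ≈ 1#)
    char0 : ∀ n → natR cring n ≈ 0# → n ≡ 0

-- Partitions, Young diagrams, Young tableaux (rows/columns 0-indexed)

rowLen : List ℕ → ℕ → ℕ
rowLen [] _ = 0
rowLen (x ∷ _) zero = x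
rowLen (_ ∷ xs) (suc i) = rowLen xs i

IsPartition : List ℕ → Set
IsPartition sh =
  (∀ i → i < length sh → 0 < rowLen sh i) ×
  (∀ i → suc i < length sh → rowLen sh (suc i) ≤ rowLen sh i)

IsPartitionOf : ℕ → List ℕ → Set
IsPartitionOf n sh = IsPartition sh × sum sh ≡ n

_⊆sh_ : List ℕ → List ℕ → Set
mu ⊆sh la = ∀ i → rowLen mu i ≤ rowLen la i

InD : List ℕ → ℕ × ℕ → Set
InD sh (i , j) = j < rowLen sh i

record Box (sh : List ℕ) : Set where
  constructor box
  field
    pos : ℕ × ℕ
    inD : InD sh pos

rowOf colOf : {sh : List ℕ} → Box sh → ℕ
rowOf b = proj₁ (Box.pos b)
colOf b = proj₂ (Box.pos b)

Tableau : List ℕ → Set → Set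
Tableau sh A = Box sh ↔ A

_⇔_ : ∀ {a b} → Set a → Set b → Set (a ⊔ b)
P ⇔ Q = (P → Q) × (Q → P)

-- F⁻¹([k]) = D_sh'  (entries of [n] = Fin n, so [k] = {i | toℕ i < k})
PreimageIsDiagram : {la : List ℕ} {n : ℕ} → ℕ → Tableau la (Fin n) → List ℕ → Set
PreimageIsDiagram k F sh' = ∀ b → (toℕ (Inverse.to F b) < k) ⇔ InD sh' (Box.pos b)

IsRestriction : {mu la : List ℕ} {k n : ℕ} → Tableau mu (Fin k) → Tableau la (Fin n) → Set
IsRestriction {mu} {la} F0 F = ∀ i j (p : InD mu (i , j)) (q : InD la (i , j)) →
  toℕ (Inverse.to F0 (box (i , j) p)) ≡ toℕ (Inverse.to F (box (i , j) q))

InCalG : {la : List ℕ} {n : ℕ} → ℕ → Tableau la (Fin n) → Tableau la (Fin n) → Set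
InCalG {la} {n} k F G =
  ((i : Fin n) → toℕ i < k → colOf (Inverse.from G i) ≤ colOf (Inverse.from F i)) ×
  (∃[ i ] (toℕ i < k × colOf (Inverse.from G i) < colOf (Inverse.from F i))) ×
  (∃[ δ ] (IsPartition δ × δ ⊆sh la × PreimageIsDiagram k G δ))

-- Finite sets are modelled by the skeleton Fin m; a word / bijection
-- [m] → Fin m is a vector of length m (bijective iff injective).

Word : ℕ → Set
Word m = Vec (Fin m) m

allB : ∀ {A : Set} → (A → Bool) → List A → Bool
allB p [] = true
allB p (x ∷ xs) = if p x then allB p xs else false

_==ᶠ_ : ∀ {m} → Fin m → Fin m → Bool
a ==ᶠ b = does (a ≟ᶠ b)

isBij : ∀ {m} → Word m → Bool
isBij {m} v = allB (λ i → allB (λ j → not (lookup v i ==ᶠ lookup v j) ∨ (i ==ᶠ j)) (allFin m)) (allFin m)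

boolFilter : ∀ {A : Set} → (A → Bool) → List A → List A
boolFilter p [] = []
boolFilter p (x ∷ xs) = if p x then x ∷ boolFilter p xs else boolFilter p xs

vecsOver : ∀ {A : Set} (k : ℕ) → List A → List (Vec A k)
vecsOver zero xs = Vec.[] ∷ []
vecsOver (suc k) xs = concatMap (λ x → List.map (x Vec.∷_) (vecsOver k xs)) xs

perms : (m : ℕ) → List (Word m)
perms m = boolFilter isBij (vecsOver m (allFin m))

compose : ∀ {m} → Word m → Word m → Word m
compose σ τ = Vec.map (lookup σ) τ

identityW : ∀ {m} → Word m
identityW = tabulate id

countB : ∀ {A : Set} → (A → Bool) → List A → ℕ
countB p xs = length (boolFilter p xs)

inversions : ∀ {m} → Word m → ℕ
inversions {m} σ = countB (λ ij → (toℕ (proj₁ ij) <ᵇ toℕ (proj₂ ij)) ∧' (toℕ (lookup σ (proj₂ ij)) <ᵇ toℕ (lookup σ (proj₁ ij))))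
                          (concatMap (λ i → List.map (i ,_) (allFin m)) (allFin m))
  where
  _∧'_ : Bool → Bool → Bool
  true ∧' b = b
  false ∧' _ = false

isEven : ℕ → Bool
isEven zero = true
isEven (suc n) = not (isEven n)

module WithField {c ℓ : Level} (K : Char0Field c ℓ) where
  open Char0Field K

  -- elements of 𝒯_{Fin m} (and of 𝕂[𝔖_{Fin m}]) as formal linear combinations
  Tm : ℕ → Set c
  Tm m = List (Carrier × Word m)

  GA : ℕ → Set c
  GA = Tm

  coeff : ∀ {m} → Tm m → Word m → Carrier
  coeff [] w = 0#
  coeff ((a , v) ∷ xs) w = if does (≡-dec _≟ᶠ_ v w) then a + coeff xs w else coeff xs w

  _≈T_ : ∀ {m} → Tm m → Tm m → Set ℓ
  x ≈T y = ∀ w → coeff x w ≈ coeff y w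

  scaleT : ∀ {m} → Carrier → Tm m → Tm m
  scaleT a = List.map (λ p → (a * proj₁ p , proj₂ p))

  -- product in 𝕂[𝔖_m] (σ·τ = σ ∘ τ), which is also the action on 𝒯_{Fin m}
  -- (σ · z_α = z_{σ∘α})
  mulGA : ∀ {m} → GA m → Tm m → Tm m
  mulGA x y = concatMap (λ p → List.map (λ q → (proj₁ p * proj₁ q , compose (proj₂ p) (proj₂ q))) y) x

  oneGA : ∀ {m} → GA m
  oneGA = (1# , identityW) ∷ []

  prodGA : ∀ {m} → List (GA m) → GA m
  prodGA = foldr mulGA oneGA

  sgn : ∀ {m} → Word m → Carrier
  sgn σ = if isEven (inversions σ) then 1# else - 1#

  fixesOutside : ∀ {m} → (Fin m → Bool) → Word m → Bool
  fixesOutside {m} X σ = allB (λ a → X a ∨ (lookup σ a ==ᶠ a)) (allFin m)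

  𝔞 𝔟 : ∀ {m} → (Fin m → Bool) → GA m
  𝔞 {m} X = List.map (λ σ → (1# , σ)) (boolFilter (fixesOutside X) (perms m))
  𝔟 {m} X = List.map (λ σ → (sgn σ , σ)) (boolFilter (fixesOutside X) (perms m))

  rowSet colSet : ∀ {sh m} → Tableau sh (Fin m) → ℕ → Fin m → Bool
  rowSet T i a = rowOf (Inverse.from T a) ≡ᵇ i
  colSet T j a = colOf (Inverse.from T a) ≡ᵇ j

  youngSym : ∀ (sh : List ℕ) {m} → Tableau sh (Fin m) → GA m
  youngSym sh T = mulGA (prodGA (List.map (λ i → 𝔞 (rowSet T i)) (upTo (length sh))))
                        (prodGA (List.map (λ j → 𝔟 (colSet T j)) (upTo (rowLen sh 0))))

  tabElem : ∀ (sh : List ℕ) {n} → Tableau sh (Fin n) → Tableau sh (Fin n) → Tm n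
  tabElem sh F T = mulGA (youngSym sh T) ((1# , tabulate (λ i → Inverse.to T (Inverse.from F i))) ∷ [])

  -- product z_α · z_β for A = Fin r, B = Fin s, A ⊔ B = Fin (r + s)
  _⋆_ : ∀ {r s} → Tm r → Word s → Tm (r +ℕ s)
  _⋆_ {r} {s} x β = List.map (λ p → (proj₁ p , Vec.map (_↑ˡ s) (proj₂ p) Vec.++ Vec.map (r ↑ʳ_) β)) x

  transportT : ∀ {m} → Word m → Tm m → Tm m
  transportT φ = List.map (λ p → (proj₁ p , compose φ (proj₂ p)))

  Gens : Set (lsuc (c ⊔ ℓ))
  Gens = (m : ℕ) → Tm m → Set (c ⊔ ℓ)

  data InIdeal (Gen : Gens) : (m : ℕ) → Tm m → Set (c ⊔ ℓ) where
    gen : ∀ {m x} → Gen m x → InIdeal Gen m x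
    zeroI : ∀ {m} → InIdeal Gen m []
    addI : ∀ {m x y} → InIdeal Gen m x → InIdeal Gen m y → InIdeal Gen m (x ++ y)
    scaleI : ∀ {m x} (a : Carrier) → InIdeal Gen m x → InIdeal Gen m (scaleT a x)
    respI : ∀ {m x y} → x ≈T y → InIdeal Gen m x → InIdeal Gen m y
    transportI : ∀ {m x} (φ : Word m) → T (isBij φ) → InIdeal Gen m x → InIdeal Gen m (transportT φ x)
    mulI : ∀ {r s x} → InIdeal Gen r x → (β : Word s) → T (isBij β) → InIdeal Gen (r +ℕ s) (x ⋆ β)

  InSum : Gens → Gens → (m : ℕ) → Tm m → Set (c ⊔ ℓ)
  InSum G₁ G₂ m x = ∃[ y ] ∃[ z ] (InIdeal G₁ m y × InIdeal G₂ m z × x ≈T (y ++ z))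

  data TabGen (sh : List ℕ) {n : ℕ} (F : Tableau sh (Fin n)) : (m : ℕ) → Tm m → Set (c ⊔ ℓ) where
    tgen : (T : Tableau sh (Fin n)) → TabGen sh F n (tabElem sh F T)

  GenCalG : ∀ {n} → ℕ → (la : List ℕ) → Tableau la (Fin n) → Gens
  GenCalG {n} k la F m x = Σ (Tableau la (Fin n)) λ G → (InCalG k F G × TabGen la G m x)

  GenCalG₀ : ∀ {n} → ℕ → (la : List ℕ) → Tableau la (Fin n) → Gens
  GenCalG₀ {n} k la F m x = Σ (Tableau la (Fin n)) λ G → (InCalG k F G ×
    Σ (List ℕ) λ δ → (PreimageIsDiagram k G δ × Σ (Tableau δ (Fin k)) λ G₀ → (IsRestriction {δ} {la} {k} G₀ G × TabGen δ G₀ m x)))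

  TabloidIn : (sh : List ℕ) {n : ℕ} → Tableau sh (Fin n) → Gens → Set (c ⊔ ℓ)
  TabloidIn sh {n} F P = (T : Tableau sh (Fin n)) → P n (tabElem sh F T)

{-# OPTIONS --safe #-}
-- Fix the tableau T and write φ(w) = c_λ(T) · z_w for a word w, so that [F] is φ(w₀) with w₀ = T ∘ F⁻¹,
-- and [G] is φ(w) for the word w that puts the label i into the box G⁻¹(i).
--
-- Two relations hold among the φ(w): exchanging a label in a later column with every entry of an
-- earlier column in turn reproduces φ(w), and the Garnir relation holds for two adjacent columns.
-- By the Garnir relation, φ(w) lies in the ideal of 𝒢 as soon as all labels i ≤ k lie weakly, and one
-- of them strictly, to the left of their box in F. After antisymmetrization over the columns of μ the
-- exchange relation moves the labels to the left one column after another, so the same holds as soon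
-- as the column indices of the labels have a smaller sum than in F. Modulo the ideal of 𝒢 an exchange
-- therefore stays inside D_μ, and c_λ(T) σ b_μ ≡ m_σ c_λ(T) b_μ for every permutation σ of D_μ, where
-- m_σ depends on μ and σ only.
--
-- Consequently c_λ(T) c_μ* c_μ ≡ β c_λ(T) b_μ ≡ β |C_μ| c_λ(T), with a scalar β depending on μ only, where
-- x ↦ x* inverts the permutations and C_μ is the column group of μ; the left side lies in the ideal of
-- F₀. Taking λ = μ gives c_μ c_μ* c_μ = β c_μ b_μ. If β were 0, the identity coefficients of
-- (c_μ c_μ*)(c_μ c_μ*)* and of c_μ c_μ* would vanish; both are sums of squares of integers, so c_μ = 0,
-- which is absurd. Hence β is invertible, and φ(w₀) lies in the sum of the two ideals.
--
-- The second inclusion follows from the first by induction on the sum of the column indices of the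
-- labels, as 𝒢(G) ⊆ 𝒢(F) for G ∈ 𝒢(F).
module Submission where

open import Defs
open import Level using (Level; _⊔_) renaming (suc to lsuc)
open import Algebra.Bundles using (CommutativeMonoid; CommutativeRing)
open import Algebra.Module.Bundles using (LeftModule)
import Algebra.Properties.CommutativeMonoid.Sum as MonoidSum
open import Data.Bool using (Bool; true; false; T; not; _∧_; _∨_; _xor_; if_then_else_)
import Data.Bool.Properties as Boolₚ
open import Data.Empty using (⊥-elim)
open import Data.Unit using (tt)
open import Data.Nat using (ℕ; zero; suc; _<_; _≤_; _<ᵇ_; _≡ᵇ_; z≤n; s≤s; _∸_)
import Data.Nat as ℕ
import Data.Nat.Properties as ℕₚ
open import Data.Nat.Induction using (<-rec)
open import Data.Fin using (Fin; zero; suc; toℕ; _↑ˡ_; _↑ʳ_; _≟_; splitAt; punchOut; fromℕ<; inject≤)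
import Data.Fin.Properties as Finₚ
open import Data.Fin.Properties using (any?; all?)
open import Data.Fin.Permutation.Components using (transpose; transpose-inverse)
open import Data.Vec as Vec using (Vec; []; _∷_; lookup; tabulate)
import Data.Vec.Properties as Vecₚ
open import Data.List as List using (List; []; _∷_; _++_; concatMap; allFin; length; upTo; foldr)
import Data.List.Properties as Listₚ
open import Data.List.Membership.Propositional using (_∈_)
import Data.List.Membership.Propositional.Properties as ∈ₚ
open import Data.List.Membership.Propositional.Properties.WithK using (unique∧set⇒bag)
open import Data.List.Relation.Unary.All as All using (All; []; _∷_)
open import Data.List.Relation.Unary.Any using (here; there)
open import Data.List.Relation.Unary.AllPairs using ([]; _∷_)
open import Data.List.Relation.Unary.Unique.Propositional using (Unique)
import Data.List.Relation.Unary.Unique.Propositional.Properties as Uniqueₚ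
open import Data.List.Relation.Binary.Permutation.Propositional using (_↭_)
import Data.List.Relation.Binary.Permutation.Propositional as ↭
open import Data.List.Relation.Binary.BagAndSetEquality using (∼bag⇒↭)
open import Data.Product using (Σ; _×_; _,_; proj₁; proj₂; ∃; ∃-syntax; ∃₂)
open import Data.Sum using (_⊎_; inj₁; inj₂)
open import Function.Base using (_∘_; id; case_of_)
open import Function.Bundles using (_↔_; Inverse; mk↔ₛ′; mk⇔)
open import Relation.Nullary using (¬_; Dec; yes; no; does; contradiction)
open import Relation.Nullary.Decidable using (_×-dec_; _⊎-dec_; ¬?; decidable-stable)
open import Relation.Binary.PropositionalEquality as ≡ using (_≡_; _≢_; _≗_; cong; cong₂; subst)
open import Relation.Binary.Definitions using (tri<; tri≈; tri>)
import Algebra.Module.Construct.TensorUnit as TensorUnit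
import Relation.Binary.Reasoning.Setoid as SetoidReasoning
import Algebra.Properties.Group as GroupProperties
import Algebra.Properties.AbelianGroup as AbelianGroupProperties
import Algebra.Properties.Ring as RingProperties
import Algebra.Properties.CommutativeSemigroup as CommutativeSemigroupProperties

-- Words and permutations

-- The relations among the φ(w) hold modulo two ideals, while β must be one and the same scalar for
-- every shape that contains μ. All computations are therefore made for functions into an arbitrary
-- module: the quotient by the two ideals serves for the reduction, and the free module on the words
-- of length k serves for the case λ = μ in which β is tested. Congruences become equations, and
-- elements of the group algebra are handled through the linear extension `ev`.
--
-- The antisymmetrization over the columns of μ is there because an exchange may swap two labels
-- that belong in the same column. This would be no progress; after antisymmetrization such a swap
-- gives minus the original term, which moves to the other side and only raises its coefficient, a
-- positive integer.
--
-- The factor c_μ* brings in positivity: whether β vanishes becomes a question about sums of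
-- squares. An abstract field carries no order, so the positivity is that of the integers inside it,
-- where the coefficients of c_μ lie.

Injective : ∀ {m N} → (Fin m → Fin N) → Set
Injective f = ∀ i j → f i ≡ f j → i ≡ j

record Inj {N m} (w : Vec (Fin N) m) : Set where
  constructor mkInj
  field injective : Injective (lookup w)
open Inj public

lookup-ext : ∀ {A : Set} {m} {v w : Vec A m} → lookup v ≗ lookup w → v ≡ w
lookup-ext {v = []}    {[]}    e = ≡.refl
lookup-ext {v = _ ∷ _} {_ ∷ _} e = cong₂ _∷_ (e zero) (lookup-ext (e ∘ suc))

infixr 9 _∙_
_∙_ : ∀ {m} → Word m → Word m → Word m
_∙_ = compose

lookup-∙ : ∀ {m} (σ τ : Word m) i → lookup (σ ∙ τ) i ≡ lookup σ (lookup τ i)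
lookup-∙ σ τ i = Vecₚ.lookup-map i (lookup σ) τ

lookup-id : ∀ {m} (i : Fin m) → lookup identityW i ≡ i
lookup-id = Vecₚ.lookup∘tabulate id

∙-assoc : ∀ {m} (ρ σ τ : Word m) → (ρ ∙ σ) ∙ τ ≡ ρ ∙ (σ ∙ τ)
∙-assoc ρ σ τ = lookup-ext λ i → begin
  lookup ((ρ ∙ σ) ∙ τ) i        ≡⟨ lookup-∙ (ρ ∙ σ) τ i ⟩
  lookup (ρ ∙ σ) (lookup τ i)   ≡⟨ lookup-∙ ρ σ _ ⟩
  lookup ρ (lookup σ (lookup τ i)) ≡⟨ cong (lookup ρ) (lookup-∙ σ τ i) ⟨
  lookup ρ (lookup (σ ∙ τ) i)   ≡⟨ lookup-∙ ρ (σ ∙ τ) i ⟨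
  lookup (ρ ∙ (σ ∙ τ)) i        ∎
  where open ≡.≡-Reasoning

∙-idˡ : ∀ {m} (σ : Word m) → identityW ∙ σ ≡ σ
∙-idˡ σ = lookup-ext λ i → ≡.trans (lookup-∙ identityW σ i) (lookup-id _)

∙-idʳ : ∀ {m} (σ : Word m) → σ ∙ identityW ≡ σ
∙-idʳ σ = lookup-ext λ i → ≡.trans (lookup-∙ σ identityW i) (cong (lookup σ) (lookup-id i))

Inj-id : ∀ {m} → Inj (identityW {m})
Inj-id .injective i j e = ≡.trans (≡.sym (lookup-id i)) (≡.trans e (lookup-id j))

Inj-∙ : ∀ {m} {σ τ : Word m} → Inj σ → Inj τ → Inj (σ ∙ τ)
Inj-∙ {σ = σ} {τ} p q .injective i j e =
  q .injective i j (p .injective _ _ (≡.trans (≡.sym (lookup-∙ σ τ i)) (≡.trans e (lookup-∙ σ τ j))))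

-- Pigeonhole: a missed value y could be punched out of the codomain, which would leave an injection
-- from `suc m` points into m points.
injective⇒surjective : ∀ {m} (f : Fin m → Fin m) → Injective f →
  ∀ y → ∃[ i ] f i ≡ y
injective⇒surjective {suc m} f inj y with any? (λ i → f i ≟ y)
... | yes p = p
... | no ¬p = contradiction
  (Finₚ.injective⇒≤ {f = λ i → punchOut {i = y} (λ e → ¬p (i , ≡.sym e))}
    (λ {i} {j} e → inj i j (Finₚ.punchOut-injective {i = y} {f i} {f j} _ _ e)))
  ℕₚ.1+n≰n

-- The value is junk unless y is attained.
preimage : ∀ {m} → Word m → Fin m → Fin m
preimage w y with any? (λ i → lookup w i ≟ y)
... | yes (i , _) = i
... | no _        = y

inv : ∀ {m} → Word m → Word m
inv w = tabulate (preimage w)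

module _ {m} {w : Word m} (w-inj : Inj w) where

  lookup-preimage : ∀ y → lookup w (preimage w y) ≡ y
  lookup-preimage y with any? (λ i → lookup w i ≟ y)
  ... | yes (_ , e) = e
  ... | no ¬p       = contradiction (injective⇒surjective (lookup w) (w-inj .injective) y) ¬p

  lookup-inv : ∀ y → lookup w (lookup (inv w) y) ≡ y
  lookup-inv y = ≡.trans (cong (lookup w) (Vecₚ.lookup∘tabulate (preimage w) y)) (lookup-preimage y)

  inv-lookup : ∀ i → lookup (inv w) (lookup w i) ≡ i
  inv-lookup i = w-inj .injective _ _ (lookup-inv (lookup w i))

  ∙-invʳ : w ∙ inv w ≡ identityW
  ∙-invʳ = lookup-ext λ i →
    ≡.trans (lookup-∙ w (inv w) i) (≡.trans (lookup-inv i) (≡.sym (lookup-id i)))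

  ∙-invˡ : inv w ∙ w ≡ identityW
  ∙-invˡ = lookup-ext λ i →
    ≡.trans (lookup-∙ (inv w) w i) (≡.trans (inv-lookup i) (≡.sym (lookup-id i)))

  Inj-inv : Inj (inv w)
  Inj-inv .injective i j e = ≡.trans (≡.sym (lookup-inv i)) (≡.trans (cong (lookup w) e) (lookup-inv j))

  word-permutation : Fin m ↔ Fin m
  word-permutation = mk↔ₛ′ (lookup w) (lookup (inv w)) lookup-inv inv-lookup

-- Transpositions

tr : ∀ {m} → Fin m → Fin m → Word m
tr i j = tabulate (transpose i j)

-- Indexed by the image of a under the transposition, so that matching on the view also rewrites
-- that image.
data TrView {m} (i j : Fin m) (a : Fin m) : Fin m → Set where
  fst   : a ≡ i → TrView i j a j
  snd   : a ≢ i → a ≡ j → TrView i j a i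
  other : a ≢ i → a ≢ j → TrView i j a a

transpose-view : ∀ {m} (i j a : Fin m) → TrView i j a (transpose i j a)
transpose-view i j a with a ≟ i
... | yes p = fst p
... | no ¬p with a ≟ j
...   | yes q = snd ¬p q
...   | no ¬q = other ¬p ¬q

lookup-tr : ∀ {m} (i j a : Fin m) → lookup (tr i j) a ≡ transpose i j a
lookup-tr i j = Vecₚ.lookup∘tabulate (transpose i j)

tr-view : ∀ {m} (i j a : Fin m) → TrView i j a (lookup (tr i j) a)
tr-view i j a = subst (TrView i j a) (≡.sym (lookup-tr i j a)) (transpose-view i j a)

tr-fst : ∀ {m} (i j : Fin m) → lookup (tr i j) i ≡ j
tr-fst i j with lookup (tr i j) i | tr-view i j i
... | _ | fst _      = ≡.refl
... | _ | snd p _    = contradiction ≡.refl p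
... | _ | other p _  = contradiction ≡.refl p

tr-snd : ∀ {m} (i j : Fin m) → lookup (tr i j) j ≡ i
tr-snd i j with lookup (tr i j) j | tr-view i j j
... | _ | fst p      = p
... | _ | snd _ _    = ≡.refl
... | _ | other _ p  = contradiction ≡.refl p

tr-other : ∀ {m} (i j : Fin m) {a} → a ≢ i → a ≢ j → lookup (tr i j) a ≡ a
tr-other i j {a} p q with lookup (tr i j) a | tr-view i j a
... | _ | fst r      = contradiction r p
... | _ | snd _ r    = contradiction r q
... | _ | other _ _  = ≡.refl

∙-tr-fst : ∀ {m} (w : Word m) i j → lookup (w ∙ tr i j) i ≡ lookup w j
∙-tr-fst w i j = ≡.trans (lookup-∙ w (tr i j) i) (cong (lookup w) (tr-fst i j))

∙-tr-snd : ∀ {m} (w : Word m) i j → lookup (w ∙ tr i j) j ≡ lookup w i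
∙-tr-snd w i j = ≡.trans (lookup-∙ w (tr i j) j) (cong (lookup w) (tr-snd i j))

∙-tr-other : ∀ {m} (w : Word m) i j {a} → a ≢ i → a ≢ j → lookup (w ∙ tr i j) a ≡ lookup w a
∙-tr-other w i j p q = ≡.trans (lookup-∙ w (tr i j) _) (cong (lookup w) (tr-other i j p q))

-- Translates between the two ways of moving a label: exchanging positions acts on w from the right,
-- exchanging letters from the left.
tr-conj : ∀ {m} {w : Word m} → Inj w → ∀ i j → w ∙ tr i j ≡ tr (lookup w i) (lookup w j) ∙ w
tr-conj {w = w} w-inj i j = lookup-ext λ a →
  ≡.trans (lookup-∙ w (tr i j) a) (≡.trans (pointwise a) (≡.sym (lookup-∙ (tr _ _) w a)))
  where
  pointwise : ∀ a → lookup w (lookup (tr i j) a) ≡ lookup (tr (lookup w i) (lookup w j)) (lookup w a)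
  pointwise a with lookup (tr i j) a | tr-view i j a
  ... | _ | fst ≡.refl   = ≡.sym (tr-fst _ _)
  ... | _ | snd _ ≡.refl = ≡.sym (tr-snd _ _)
  ... | _ | other p q    = ≡.sym (tr-other _ _ (p ∘ w-inj .injective _ _) (q ∘ w-inj .injective _ _))

tr-invol : ∀ {m} (i j : Fin m) → tr i j ∙ tr i j ≡ identityW
tr-invol i j = lookup-ext λ a →
  ≡.trans (lookup-∙ (tr i j) (tr i j) a) (≡.trans (pointwise a) (≡.sym (lookup-id a)))
  where
  pointwise : ∀ a → lookup (tr i j) (lookup (tr i j) a) ≡ a
  pointwise a with lookup (tr i j) a | tr-view i j a
  ... | _ | fst p      = ≡.trans (tr-snd i j) (≡.sym p)
  ... | _ | snd _ p    = ≡.trans (tr-fst i j) (≡.sym p)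
  ... | _ | other p q  = tr-other i j p q

Inj-tr : ∀ {m} (i j : Fin m) → Inj (tr i j)
Inj-tr i j .injective a b e = begin
  a                                   ≡⟨ involutive a ⟨
  lookup (tr i j) (lookup (tr i j) a) ≡⟨ cong (lookup (tr i j)) e ⟩
  lookup (tr i j) (lookup (tr i j) b) ≡⟨ involutive b ⟩
  b                                   ∎
  where
  open ≡.≡-Reasoning
  involutive : ∀ a → lookup (tr i j) (lookup (tr i j) a) ≡ a
  involutive a = ≡.trans (≡.sym (lookup-∙ (tr i j) (tr i j) a))
                         (≡.trans (cong (λ w → lookup w a) (tr-invol i j)) (lookup-id a))

∙-tr-tr : ∀ {m} (w : Word m) i j → (w ∙ tr i j) ∙ tr i j ≡ w
∙-tr-tr w i j = ≡.trans (∙-assoc w (tr i j) (tr i j)) (≡.trans (cong (w ∙_) (tr-invol i j)) (∙-idʳ w))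

tr-tr-∙ : ∀ {m} (w : Word m) i j → tr i j ∙ (tr i j ∙ w) ≡ w
tr-tr-∙ w i j = ≡.trans (≡.sym (∙-assoc (tr i j) (tr i j) w)) (≡.trans (cong (_∙ w) (tr-invol i j)) (∙-idˡ w))

-- Boolean reflection

does-sound : ∀ {P : Set} (d : Dec P) → T (does d) → P
does-sound (yes p) _ = p

does-complete : ∀ {P : Set} (d : Dec P) → P → T (does d)
does-complete (yes _) _ = tt
does-complete (no ¬p) p = ¬p p

allB-sound : ∀ {A : Set} (p : A → Bool) {xs} → T (allB p xs) → ∀ {x} → x ∈ xs → T (p x)
allB-sound p {x ∷ xs} t q with p x in eq
allB-sound p {x ∷ xs} t (here ≡.refl) | true = subst T (≡.sym eq) tt
allB-sound p {x ∷ xs} t (there q)     | true = allB-sound p t q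

allB-complete : ∀ {A : Set} (p : A → Bool) xs → (∀ {x} → x ∈ xs → T (p x)) → T (allB p xs)
allB-complete p []       h = tt
allB-complete p (x ∷ xs) h with p x | h (here ≡.refl)
... | true | _ = allB-complete p xs (h ∘ there)

isBij-sound : ∀ {m} {w : Word m} → T (isBij w) → Inj w
isBij-sound {m} {w} t .injective i j e
  with lookup w i ≟ lookup w j | i ≟ j
     | allB-sound _ (allB-sound _ t (∈ₚ.∈-allFin i)) (∈ₚ.∈-allFin j)
... | _     | yes p | _ = p
... | no ¬q | no _  | _ = contradiction e ¬q

isBij-complete : ∀ {m} {w : Word m} → Inj w → T (isBij w)
isBij-complete {m} {w} w-inj = allB-complete _ (allFin m) λ {i} _ → allB-complete _ (allFin m) λ {j} _ → check i j
  where
  check : ∀ i j → T (not (lookup w i ==ᶠ lookup w j) ∨ (i ==ᶠ j))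
  check i j with lookup w i ≟ lookup w j | i ≟ j
  ... | no _  | _     = tt
  ... | yes _ | yes _ = tt
  ... | yes p | no ¬q = ¬q (w-inj .injective i j p)

Inj? : ∀ {m} (w : Word m) → Dec (Inj w)
Inj? w with isBij w in eq
... | true  = yes (isBij-sound {w = w} (subst T (≡.sym eq) tt))
... | false = no λ w-inj → subst T eq (isBij-complete {w = w} w-inj)

-- Lists of permutations

module _ {A : Set} (p : A → Bool) where

  ∈-boolFilter⁺ : ∀ {x xs} → x ∈ xs → T (p x) → x ∈ boolFilter p xs
  ∈-boolFilter⁺ {xs = y ∷ ys} q t with p y in eq
  ∈-boolFilter⁺ (here e)  t | true  = here e
  ∈-boolFilter⁺ (there q) t | true  = there (∈-boolFilter⁺ q t)
  ∈-boolFilter⁺ (here ≡.refl) t | false = ⊥-elim (subst T eq t)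
  ∈-boolFilter⁺ (there q) t | false = ∈-boolFilter⁺ q t

  ∈-boolFilter⁻ : ∀ {x} xs → x ∈ boolFilter p xs → x ∈ xs × T (p x)
  ∈-boolFilter⁻ (y ∷ ys) q with p y in eq
  ∈-boolFilter⁻ (y ∷ ys) (here ≡.refl) | true = here ≡.refl , subst T (≡.sym eq) tt
  ∈-boolFilter⁻ (y ∷ ys) (there q) | true with ∈-boolFilter⁻ ys q
  ... | r , t = there r , t
  ∈-boolFilter⁻ (y ∷ ys) q | false with ∈-boolFilter⁻ ys q
  ... | r , t = there r , t

  boolFilter-unique : ∀ {xs} → Unique xs → Unique (boolFilter p xs)
  boolFilter-unique [] = []
  boolFilter-unique {x ∷ xs} (px ∷ u) with p x
  ... | true  = All.tabulate (λ q → All.lookup px (proj₁ (∈-boolFilter⁻ xs q))) ∷ boolFilter-unique u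
  ... | false = boolFilter-unique u

vecsOver-product : ∀ {A : Set} k (xs : List A) →
  vecsOver (suc k) xs ≡ List.cartesianProductWith _∷_ xs (vecsOver k xs)
vecsOver-product {A} k xs = go xs
  where
  go : ∀ ys → concatMap (λ y → List.map (y Vec.∷_) (vecsOver k xs)) ys
            ≡ List.cartesianProductWith _∷_ ys (vecsOver k xs)
  go []       = ≡.refl
  go (y ∷ ys) = cong (List.map (y Vec.∷_) (vecsOver k xs) ++_) (go ys)

vecsOver-unique : ∀ {A : Set} k {xs : List A} → Unique xs → Unique (vecsOver k xs)
vecsOver-unique zero    u = [] ∷ []
vecsOver-unique (suc k) {xs} u rewrite vecsOver-product k xs =
  Uniqueₚ.cartesianProductWith⁺ _∷_ (λ { ≡.refl → ≡.refl , ≡.refl }) u (vecsOver-unique k u)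

∈-vecsOver : ∀ {m} k (v : Vec (Fin m) k) → v ∈ vecsOver k (allFin m)
∈-vecsOver zero    [] = here ≡.refl
∈-vecsOver {m} (suc k) (x ∷ v) rewrite vecsOver-product k (allFin m) =
  ∈ₚ.∈-cartesianProductWith⁺ _∷_ (∈ₚ.∈-allFin x) (∈-vecsOver k v)

words : ∀ m → List (Word m)
words m = vecsOver m (allFin m)

words-unique : ∀ m → Unique (words m)
words-unique m = vecsOver-unique m (Uniqueₚ.allFin⁺ m)

-- Both lists are free of repetitions and have the same members, hence are equal as bags. This
-- reindexes sums over a symmetric group by multiplication with a transposition.
involution-↭ : ∀ {A : Set} {xs : List A} (h : A → A) → (∀ x → h (h x) ≡ x) →
  Unique xs → (∀ {x} → x ∈ xs → h x ∈ xs) → List.map h xs ↭ xs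
involution-↭ {xs = xs} h h-invol u closed = ∼bag⇒↭ (unique∧set⇒bag
  (Uniqueₚ.map⁺ (λ {x} {y} e → ≡.trans (≡.sym (h-invol x)) (≡.trans (cong h e) (h-invol y))) u) u
  (mk⇔ to from))
  where
  to : ∀ {x} → x ∈ List.map h xs → x ∈ xs
  to q with ∈ₚ.∈-map⁻ h q
  ... | _ , r , ≡.refl = closed r
  from : ∀ {x} → x ∈ xs → x ∈ List.map h xs
  from {x} q = subst (_∈ List.map h xs) (h-invol x) (∈ₚ.∈-map⁺ h (closed q))

-- The sign of a permutation

module Xor = MonoidSum (CommutativeRing.+-commutativeMonoid Boolₚ.xor-∧-commutativeRing)

-- The number of inversions modulo 2, split by the smaller index of the pair. As a sum in the
-- Booleans under xor it can be reindexed like any finite sum.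
parity : ∀ {N} m → (Fin m → Fin N) → Bool
parity zero    f = false
parity (suc m) f = Xor.sum (λ j → toℕ (f (suc j)) <ᵇ toℕ (f zero)) xor parity m (f ∘ suc)

parity-cong : ∀ {N} m {f g : Fin m → Fin N} → f ≗ g → parity m f ≡ parity m g
parity-cong zero    e = ≡.refl
parity-cong (suc m) e =
  cong₂ _xor_ (Xor.sum-cong-≋ λ j → cong₂ (λ a b → toℕ a <ᵇ toℕ b) (e (suc j)) (e zero))
              (parity-cong m (e ∘ suc))

xorList : ∀ {A : Set} → List A → (A → Bool) → Bool
xorList xs p = foldr (λ x b → p x xor b) false xs

isEven-countB : ∀ {A : Set} (p : A → Bool) xs → isEven (countB p xs) ≡ not (xorList xs p)
isEven-countB p []       = ≡.refl
isEven-countB p (x ∷ xs) with p x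
... | true  = cong not (isEven-countB p xs)
... | false = isEven-countB p xs

xorList-cong : ∀ {A : Set} {p q : A → Bool} xs → p ≗ q → xorList xs p ≡ xorList xs q
xorList-cong []       e = ≡.refl
xorList-cong (x ∷ xs) e = cong₂ _xor_ (e x) (xorList-cong xs e)

xorList-++ : ∀ {A : Set} (p : A → Bool) xs ys → xorList (xs ++ ys) p ≡ xorList xs p xor xorList ys p
xorList-++ p []       ys = ≡.refl
xorList-++ p (x ∷ xs) ys =
  ≡.trans (cong (p x xor_) (xorList-++ p xs ys)) (≡.sym (Boolₚ.xor-assoc (p x) _ _))

xorList-concatMap : ∀ {A B : Set} (p : B → Bool) (f : A → List B) xs →
  xorList (concatMap f xs) p ≡ xorList xs (λ x → xorList (f x) p)
xorList-concatMap p f []       = ≡.refl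
xorList-concatMap p f (x ∷ xs) =
  ≡.trans (xorList-++ p (f x) _) (cong (xorList (f x) p xor_) (xorList-concatMap p f xs))

xorList-map : ∀ {A B : Set} (p : B → Bool) (f : A → B) xs →
  xorList (List.map f xs) p ≡ xorList xs (p ∘ f)
xorList-map p f []       = ≡.refl
xorList-map p f (x ∷ xs) = cong (p (f x) xor_) (xorList-map p f xs)

xorList-allFin : ∀ m (p : Fin m → Bool) → xorList (allFin m) p ≡ Xor.sum p
xorList-allFin zero    p = ≡.refl
xorList-allFin (suc m) p = cong (p zero xor_) (begin
  xorList (List.tabulate suc) p            ≡⟨ cong (λ xs → xorList xs p) (Listₚ.map-tabulate id suc) ⟨
  xorList (List.map suc (allFin m)) p      ≡⟨ xorList-map p suc (allFin m) ⟩
  xorList (allFin m) (p ∘ suc)             ≡⟨ xorList-allFin m (p ∘ suc) ⟩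
  Xor.sum (p ∘ suc)                        ∎)
  where open ≡.≡-Reasoning

xorPairs≡parity : ∀ {N} m (f : Fin m → Fin N) →
  Xor.sum (λ i → Xor.sum (λ j → (toℕ i <ᵇ toℕ j) ∧ (toℕ (f j) <ᵇ toℕ (f i)))) ≡ parity m f
xorPairs≡parity zero    f = ≡.refl
xorPairs≡parity (suc m) f =
  cong (Xor.sum (λ j → toℕ (f (suc j)) <ᵇ toℕ (f zero)) xor_) (xorPairs≡parity m (f ∘ suc))

inverted : ∀ {N m} → (Fin m → Fin N) → Fin m × Fin m → Bool
inverted f (i , j) = (toℕ i <ᵇ toℕ j) ∧ (toℕ (f j) <ᵇ toℕ (f i))

orderedPairs : ∀ m → List (Fin m × Fin m)
orderedPairs m = concatMap (λ i → List.map (i ,_) (allFin m)) (allFin m)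

-- The conjunction inside `inversions` is local to it, so the predicate is left to unification.
inversions-count : ∀ {m} (σ : Word m) →
  ∃ λ (p : Fin m × Fin m → Bool) → inversions σ ≡ countB p (orderedPairs m)
inversions-count σ = _ , ≡.refl

inversions-inverted : ∀ {m} (σ : Word m) i j →
  proj₁ (inversions-count σ) (i , j) ≡ inverted (lookup σ) (i , j)
inversions-inverted σ i j with toℕ i <ᵇ toℕ j
... | true  = ≡.refl
... | false = ≡.refl

isEven-inversions : ∀ {m} (σ : Word m) → isEven (inversions σ) ≡ not (parity m (lookup σ))
isEven-inversions {m} σ = begin
  isEven (inversions σ)
    ≡⟨ isEven-countB (proj₁ (inversions-count σ)) pairs ⟩
  not (xorList pairs (proj₁ (inversions-count σ)))
    ≡⟨ cong not (xorList-cong pairs λ (i , j) → inversions-inverted σ i j) ⟩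
  not (xorList pairs (inverted (lookup σ)))
    ≡⟨ cong not (xorList-concatMap (inverted (lookup σ)) (λ i → List.map (i ,_) (allFin m)) (allFin m)) ⟩
  not (xorList (allFin m) (λ i → xorList (List.map (i ,_) (allFin m)) (inverted (lookup σ))))
    ≡⟨ cong not (xorList-cong (allFin m) λ i →
         ≡.trans (xorList-map (inverted (lookup σ)) (i ,_) (allFin m)) (xorList-allFin m (λ j → inverted (lookup σ) (i , j)))) ⟩
  not (xorList (allFin m) (λ i → Xor.sum (λ j → inverted (lookup σ) (i , j))))
    ≡⟨ cong not (xorList-allFin m _) ⟩
  not (Xor.sum (λ i → Xor.sum (λ j → inverted (lookup σ) (i , j))))
    ≡⟨ cong not (xorPairs≡parity m (lookup σ)) ⟩
  not (parity m (lookup σ)) ∎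
  where
  open ≡.≡-Reasoning
  pairs = orderedPairs m

<ᵇ-asym : ∀ {N} {a b : Fin N} → a ≢ b → (toℕ a <ᵇ toℕ b) ≡ not (toℕ b <ᵇ toℕ a)
<ᵇ-asym {a = zero}  {zero}  p = contradiction ≡.refl p
<ᵇ-asym {a = zero}  {suc b} p = ≡.refl
<ᵇ-asym {a = suc a} {zero}  p = ≡.refl
<ᵇ-asym {a = suc a} {suc b} p = <ᵇ-asym (p ∘ cong suc)

-- Here a compares the first two values, b and c are the parities of the inversions of either of
-- them with the later positions, and d belongs to the later positions alone. Swapping the first two
-- positions negates a and interchanges b and c.
xor-exchange : ∀ a b c d → (not a xor b) xor (c xor d) ≡ not ((a xor c) xor (b xor d))
xor-exchange true  true  true  true = ≡.refl
xor-exchange true  true  true  false = ≡.refl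
xor-exchange true  true  false true = ≡.refl
xor-exchange true  true  false false = ≡.refl
xor-exchange true  false true  true = ≡.refl
xor-exchange true  false true  false = ≡.refl
xor-exchange true  false false true = ≡.refl
xor-exchange true  false false false = ≡.refl
xor-exchange false true  true  true = ≡.refl
xor-exchange false true  true  false = ≡.refl
xor-exchange false true  false true = ≡.refl
xor-exchange false true  false false = ≡.refl
xor-exchange false false true  true = ≡.refl
xor-exchange false false true  false = ≡.refl
xor-exchange false false false true = ≡.refl
xor-exchange false false false false = ≡.refl

swapFirst : ∀ {m} → Fin (suc (suc m)) → Fin (suc (suc m))
swapFirst zero          = suc zero
swapFirst (suc zero)    = zero
swapFirst (suc (suc i)) = suc (suc i)

swapFirst-invol : ∀ {m} (i : Fin (suc (suc m))) → swapFirst (swapFirst i) ≡ i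
swapFirst-invol zero          = ≡.refl
swapFirst-invol (suc zero)    = ≡.refl
swapFirst-invol (suc (suc i)) = ≡.refl

swapFirst-injective : ∀ {m} → Injective (swapFirst {m})
swapFirst-injective i j e =
  ≡.trans (≡.sym (swapFirst-invol i)) (≡.trans (cong swapFirst e) (swapFirst-invol j))

parity-swapFirst : ∀ {N} m (f : Fin (suc (suc m)) → Fin N) → Injective f →
  parity (suc (suc m)) (f ∘ swapFirst) ≡ not (parity (suc (suc m)) f)
parity-swapFirst m f f-inj
  rewrite <ᵇ-asym {a = f zero} {b = f (suc zero)} (λ e → case f-inj _ _ e of λ ())
  = xor-exchange (toℕ (f (suc zero)) <ᵇ toℕ (f zero)) _ _ _

transpose-suc : ∀ {m} (i j a : Fin m) → transpose (suc i) (suc j) (suc a) ≡ suc (transpose i j a)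
transpose-suc i j a with a ≟ i
... | yes _ = ≡.refl
... | no _ with a ≟ j
...   | yes _ = ≡.refl
...   | no _  = ≡.refl

transpose-permutation : ∀ {m} (i j : Fin m) → Fin m ↔ Fin m
transpose-permutation i j = mk↔ₛ′ (transpose i j) (transpose j i)
  (λ _ → transpose-inverse i j) (λ _ → transpose-inverse j i)

-- Position zero is fixed, and its inversions form a sum over all other positions, which a
-- permutation of those positions does not change.
parity-transpose-suc : ∀ {N} m (f : Fin (suc m) → Fin N) (i j : Fin m) →
  parity m (f ∘ suc ∘ transpose i j) ≡ not (parity m (f ∘ suc)) →
  parity (suc m) (f ∘ transpose (suc i) (suc j)) ≡ not (parity (suc m) f)
parity-transpose-suc m f i j ih = begin
  Xor.sum (λ a → below (transpose (suc i) (suc j) (suc a))) xor parity m (f ∘ transpose (suc i) (suc j) ∘ suc)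
    ≡⟨ cong₂ _xor_ (Xor.sum-cong-≋ λ a → cong below (transpose-suc i j a))
                   (parity-cong m (λ a → cong f (transpose-suc i j a))) ⟩
  Xor.sum (λ a → below (suc (transpose i j a))) xor parity m (f ∘ suc ∘ transpose i j)
    ≡⟨ cong₂ _xor_ (≡.sym (Xor.sum-permute (below ∘ suc) (transpose-permutation i j))) ih ⟩
  Xor.sum (below ∘ suc) xor not (parity m (f ∘ suc))
    ≡⟨ Boolₚ.not-distribʳ-xor (Xor.sum (below ∘ suc)) _ ⟨
  not (parity (suc m) f) ∎
  where
  open ≡.≡-Reasoning
  below : Fin (suc m) → Bool
  below b = toℕ (f b) <ᵇ toℕ (f zero)

transpose-injective : ∀ {m} (i j : Fin m) → Injective (transpose i j)
transpose-injective i j a b e =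
  ≡.trans (≡.sym (transpose-inverse j i)) (≡.trans (cong (transpose j i) e) (transpose-inverse j i))

-- The transposition (0 1) is direct. For j > 1, (0 j) is (0 1)(1 j)(0 1), which makes three sign
-- changes. All others reduce to the tail.
parity-transpose : ∀ {N} m (f : Fin m → Fin N) → Injective f →
  ∀ i j → toℕ i < toℕ j → parity m (f ∘ transpose i j) ≡ not (parity m f)
parity-transpose (suc m) f f-inj (suc i) (suc j) (s≤s i<j) = parity-transpose-suc m f i j
  (parity-transpose m (f ∘ suc) (λ a b e → Finₚ.suc-injective (f-inj _ _ e)) i j i<j)
parity-transpose (suc (suc m)) f f-inj zero (suc zero) _ =
  ≡.trans (parity-cong (suc (suc m)) (λ a → cong f (agree a))) (parity-swapFirst m f f-inj)
  where
  agree : transpose zero (suc zero) ≗ swapFirst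
  agree zero          = ≡.refl
  agree (suc zero)    = ≡.refl
  agree (suc (suc a)) = ≡.refl
parity-transpose (suc (suc m)) f f-inj zero (suc (suc j)) _ = begin
  parity (suc (suc m)) (f ∘ transpose zero (suc (suc j)))
    ≡⟨ parity-cong (suc (suc m)) (λ a → cong f (conjugate a)) ⟩
  parity (suc (suc m)) (f ∘ swapFirst ∘ transpose (suc zero) (suc (suc j)) ∘ swapFirst)
    ≡⟨ parity-swapFirst m (f ∘ swapFirst ∘ transpose (suc zero) (suc (suc j)))
         (λ a b e → transpose-injective (suc zero) (suc (suc j)) a b (f∘swap-inj _ _ e)) ⟩
  not (parity (suc (suc m)) (f ∘ swapFirst ∘ transpose (suc zero) (suc (suc j))))
    ≡⟨ cong not (parity-transpose-suc (suc m) (f ∘ swapFirst) zero (suc j)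
         (parity-transpose (suc m) (f ∘ swapFirst ∘ suc)
           (λ a b e → Finₚ.suc-injective (f∘swap-inj _ _ e)) zero (suc j) (s≤s z≤n))) ⟩
  not (not (parity (suc (suc m)) (f ∘ swapFirst)))
    ≡⟨ Boolₚ.not-involutive _ ⟩
  parity (suc (suc m)) (f ∘ swapFirst)
    ≡⟨ parity-swapFirst m f f-inj ⟩
  not (parity (suc (suc m)) f) ∎
  where
  open ≡.≡-Reasoning
  f∘swap-inj : Injective (f ∘ swapFirst)
  f∘swap-inj a b e = swapFirst-injective a b (f-inj _ _ e)
  conjugate : ∀ a → transpose zero (suc (suc j)) a ≡ swapFirst (transpose (suc zero) (suc (suc j)) (swapFirst a))
  conjugate zero          = ≡.refl
  conjugate (suc zero)    = ≡.refl
  conjugate (suc (suc a)) with a ≟ j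
  ... | yes _ = ≡.refl
  ... | no _  = ≡.refl

parity-tr : ∀ {m} (w : Word m) → Inj w → ∀ {i j} → i ≢ j →
  parity m (lookup (w ∙ tr i j)) ≡ not (parity m (lookup w))
parity-tr {m} w w-inj {i} {j} i≢j with ℕₚ.<-cmp (toℕ i) (toℕ j)
... | tri< i<j _ _ = ≡.trans
  (parity-cong m λ a → ≡.trans (lookup-∙ w (tr i j) a) (cong (lookup w) (lookup-tr i j a)))
  (parity-transpose m (lookup w) (w-inj .injective) i j i<j)
... | tri≈ _ e _   = contradiction (Finₚ.toℕ-injective e) i≢j
... | tri> _ _ j<i = ≡.trans
  (parity-cong m λ a → ≡.trans (lookup-∙ w (tr i j) a) (cong (lookup w) (≡.trans (lookup-tr i j a) (symmetric a))))
  (parity-transpose m (lookup w) (w-inj .injective) j i j<i)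
  where
  symmetric : ∀ a → transpose i j a ≡ transpose j i a
  symmetric a with transpose i j a | transpose-view i j a | transpose j i a | transpose-view j i a
  ... | _ | fst p      | _ | fst q     = ≡.trans (≡.sym q) p
  ... | _ | fst p      | _ | snd _ _   = ≡.refl
  ... | _ | fst p      | _ | other _ q = contradiction p q
  ... | _ | snd _ p    | _ | fst _     = ≡.refl
  ... | _ | snd _ p    | _ | snd q _   = contradiction p q
  ... | _ | snd _ p    | _ | other q _ = contradiction p q
  ... | _ | other _ p  | _ | fst q     = contradiction q p
  ... | _ | other p _  | _ | snd _ q   = contradiction q p
  ... | _ | other _ _  | _ | other _ _ = ≡.refl

-- Linear algebra over the field: finite sums, formal combinations and their evaluation

module Linear {c ℓ : Level} (K : Char0Field c ℓ) where
  module F = Char0Field K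
  open F using (Carrier; _≈_; _+_; _*_; -_; 0#; 1#)
  open WithField K public

  nat : ℕ → Carrier
  nat = natR F.cring

  scalars : LeftModule F.ring c ℓ
  scalars = TensorUnit.leftModule

  -1*x≈-x : ∀ x → - 1# * x ≈ - x
  -1*x≈-x = RingProperties.-1*x≈-x F.ring

  +-interchange : ∀ w x y z → (w + x) + (y + z) ≈ (w + y) + (x + z)
  +-interchange = CommutativeSemigroupProperties.interchange (CommutativeMonoid.commutativeSemigroup F.+-commutativeMonoid)

  nat-+ : ∀ m n → nat (m ℕ.+ n) ≈ nat m + nat n
  nat-+ zero    n = F.sym (F.+-identityˡ _)
  nat-+ (suc m) n = F.trans (F.+-congˡ (nat-+ m n)) (F.sym (F.+-assoc _ _ _))

  nat-* : ∀ m n → nat (m ℕ.* n) ≈ nat m * nat n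
  nat-* zero    n = F.sym (F.zeroˡ _)
  nat-* (suc m) n = begin
    nat (n ℕ.+ m ℕ.* n)       ≈⟨ nat-+ n (m ℕ.* n) ⟩
    nat n + nat (m ℕ.* n)     ≈⟨ F.+-cong (F.sym (F.*-identityˡ _)) (nat-* m n) ⟩
    1# * nat n + nat m * nat n ≈⟨ F.distribʳ _ _ _ ⟨
    (1# + nat m) * nat n      ∎
    where open SetoidReasoning F.setoid

  -- Stated for an arbitrary module because it is applied to the field itself, to the free module on
  -- words and to the quotient by the two ideals.
  module Module {v ℓv : Level} (V : LeftModule F.ring v ℓv) where
    open LeftModule V public
    open MonoidSum +ᴹ-commutativeMonoid public
      using (sum; sum-cong-≋; ∑-distrib-+; ∑-comm; sum-permute; sum-replicate-zero)
    open GroupProperties +ᴹ-group public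
      using () renaming (ε⁻¹≈ε to -ᴹ0≈0; ⁻¹-involutive to -ᴹ-involutive; inverseˡ-unique to -ᴹ-uniqueˡ)
    open AbelianGroupProperties +ᴹ-abelianGroup public
      using () renaming (⁻¹-∙-comm to -ᴹ-+-comm)
    open CommutativeSemigroupProperties (CommutativeMonoid.commutativeSemigroup +ᴹ-commutativeMonoid) public
      using () renaming (interchange to +ᴹ-interchange)
    open SetoidReasoning ≈ᴹ-setoid

    -ᴹ-*ₗ : ∀ a v → (- a) *ₗ v ≈ᴹ -ᴹ (a *ₗ v)
    -ᴹ-*ₗ a v = -ᴹ-uniqueˡ _ _ (begin
      (- a) *ₗ v +ᴹ a *ₗ v ≈⟨ *ₗ-distribʳ v (- a) a ⟨
      (- a + a) *ₗ v       ≈⟨ *ₗ-congʳ (F.-‿inverseˡ a) ⟩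
      0# *ₗ v              ≈⟨ *ₗ-zeroˡ v ⟩
      0ᴹ                   ∎)

    *ₗ-ᴹ : ∀ a v → a *ₗ (-ᴹ v) ≈ᴹ -ᴹ (a *ₗ v)
    *ₗ-ᴹ a v = -ᴹ-uniqueˡ _ _ (begin
      a *ₗ (-ᴹ v) +ᴹ a *ₗ v ≈⟨ *ₗ-distribˡ a (-ᴹ v) v ⟨
      a *ₗ (-ᴹ v +ᴹ v)      ≈⟨ *ₗ-congˡ (-ᴹ‿inverseˡ v) ⟩
      a *ₗ 0ᴹ               ≈⟨ *ₗ-zeroʳ a ⟩
      0ᴹ                    ∎)

    *ₗ-comm : ∀ a b v → a *ₗ (b *ₗ v) ≈ᴹ b *ₗ (a *ₗ v)
    *ₗ-comm a b v = begin
      a *ₗ (b *ₗ v) ≈⟨ *ₗ-assoc a b v ⟨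
      (a * b) *ₗ v  ≈⟨ *ₗ-congʳ (F.*-comm a b) ⟩
      (b * a) *ₗ v  ≈⟨ *ₗ-assoc b a v ⟩
      b *ₗ (a *ₗ v) ∎

    cancel-scalar : ∀ {a v} → ¬ (a ≈ 0#) → a *ₗ v ≈ᴹ 0ᴹ → v ≈ᴹ 0ᴹ
    cancel-scalar {a} {v} a≉0 e with F.inverse a a≉0
    ... | b , ab≈1 = begin
      v              ≈⟨ *ₗ-identityˡ v ⟨
      1# *ₗ v        ≈⟨ *ₗ-congʳ ab≈1 ⟨
      (a * b) *ₗ v   ≈⟨ *ₗ-congʳ (F.*-comm a b) ⟩
      (b * a) *ₗ v   ≈⟨ *ₗ-assoc b a v ⟩
      b *ₗ (a *ₗ v)  ≈⟨ *ₗ-congˡ e ⟩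
      b *ₗ 0ᴹ        ≈⟨ *ₗ-zeroʳ b ⟩
      0ᴹ             ∎

    nat≉0 : ∀ n → ¬ (nat (suc n) ≈ 0#)
    nat≉0 n e = case F.char0 (suc n) e of λ ()

    -- Twice v vanishes and 2 is invertible. The cancellations by antisymmetry in the Garnir and
    -- exchange relations end here.
    self-negative⇒0 : ∀ {v} → v ≈ᴹ -ᴹ v → v ≈ᴹ 0ᴹ
    self-negative⇒0 {v} e = cancel-scalar (nat≉0 1) (begin
      (1# + (1# + 0#)) *ₗ v      ≈⟨ *ₗ-distribʳ v 1# (1# + 0#) ⟩
      1# *ₗ v +ᴹ (1# + 0#) *ₗ v  ≈⟨ +ᴹ-cong (*ₗ-identityˡ v) (≈ᴹ-trans (*ₗ-congʳ (F.+-identityʳ 1#)) (*ₗ-identityˡ v)) ⟩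
      v +ᴹ v                     ≈⟨ +ᴹ-congʳ e ⟩
      -ᴹ v +ᴹ v                  ≈⟨ -ᴹ‿inverseˡ v ⟩
      0ᴹ                         ∎)

    infix 7 _when_
    _when_ : Carrierᴹ → Bool → Carrierᴹ
    v when b = if b then v else 0ᴹ

    when-cong : ∀ {v w} b → (T b → v ≈ᴹ w) → v when b ≈ᴹ w when b
    when-cong true  e = e tt
    when-cong false e = ≈ᴹ-refl

    when-true : ∀ {v b} → T b → v when b ≈ᴹ v
    when-true {b = true} _ = ≈ᴹ-refl

    when-false : ∀ {v b} → ¬ T b → v when b ≈ᴹ 0ᴹ
    when-false {b = true}  p = ⊥-elim (p tt)
    when-false {b = false} p = ≈ᴹ-refl

    sum-0 : ∀ {n} {f : Fin n → Carrierᴹ} → (∀ i → f i ≈ᴹ 0ᴹ) → sum f ≈ᴹ 0ᴹ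
    sum-0 {n} e = ≈ᴹ-trans (sum-cong-≋ e) (sum-replicate-zero n)

    sum-neg : ∀ {n} (f : Fin n → Carrierᴹ) → sum (λ i → -ᴹ f i) ≈ᴹ -ᴹ sum f
    sum-neg {zero}  f = ≈ᴹ-sym -ᴹ0≈0
    sum-neg {suc n} f = ≈ᴹ-trans (+ᴹ-congˡ (sum-neg (f ∘ suc))) (-ᴹ-+-comm _ _)

    sum-single : ∀ {n} (e : Fin n) (f : Fin n → Carrierᴹ) → (∀ i → i ≢ e → f i ≈ᴹ 0ᴹ) → sum f ≈ᴹ f e
    sum-single {suc n} zero    f h =
      ≈ᴹ-trans (+ᴹ-congˡ (sum-0 λ i → h (suc i) (λ ()))) (+ᴹ-identityʳ _)
    sum-single {suc n} (suc e) f h =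
      ≈ᴹ-trans (+ᴹ-cong (h zero (λ ())) (sum-single e (f ∘ suc) (λ i p → h (suc i) (p ∘ Finₚ.suc-injective))))
               (+ᴹ-identityˡ _)

    ∑ : ∀ {A : Set} → List A → (A → Carrierᴹ) → Carrierᴹ
    ∑ []       f = 0ᴹ
    ∑ (x ∷ xs) f = f x +ᴹ ∑ xs f

    ∑-cong : ∀ {A : Set} xs {f g : A → Carrierᴹ} → (∀ {x} → x ∈ xs → f x ≈ᴹ g x) → ∑ xs f ≈ᴹ ∑ xs g
    ∑-cong []       h = ≈ᴹ-refl
    ∑-cong (x ∷ xs) h = +ᴹ-cong (h (here ≡.refl)) (∑-cong xs (h ∘ there))

    ∑-map : ∀ {A B : Set} (h : A → B) xs (f : B → Carrierᴹ) → ∑ (List.map h xs) f ≈ᴹ ∑ xs (f ∘ h)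
    ∑-map h []       f = ≈ᴹ-refl
    ∑-map h (x ∷ xs) f = +ᴹ-congˡ (∑-map h xs f)

    ∑-↭ : ∀ {A : Set} {xs ys : List A} (f : A → Carrierᴹ) → xs ↭ ys → ∑ xs f ≈ᴹ ∑ ys f
    ∑-↭ f ↭.refl         = ≈ᴹ-refl
    ∑-↭ f (↭.prep x p)   = +ᴹ-congˡ (∑-↭ f p)
    ∑-↭ f (↭.swap {xs} {ys} x y p) = begin
      f x +ᴹ (f y +ᴹ ∑ xs f)   ≈⟨ +ᴹ-assoc _ _ _ ⟨
      f x +ᴹ f y +ᴹ ∑ xs f     ≈⟨ +ᴹ-cong (+ᴹ-comm _ _) (∑-↭ f p) ⟩
      f y +ᴹ f x +ᴹ ∑ ys f     ≈⟨ +ᴹ-assoc _ _ _ ⟩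
      f y +ᴹ (f x +ᴹ ∑ ys f)   ∎
    ∑-↭ f (↭.trans p q)  = ≈ᴹ-trans (∑-↭ f p) (∑-↭ f q)

    ∑-involution : ∀ {A : Set} {xs : List A} (h : A → A) → (∀ x → h (h x) ≡ x) →
      Unique xs → (∀ {x} → x ∈ xs → h x ∈ xs) → ∀ f → ∑ xs (f ∘ h) ≈ᴹ ∑ xs f
    ∑-involution {xs = xs} h h-invol u closed f =
      ≈ᴹ-trans (≈ᴹ-sym (∑-map h xs f)) (∑-↭ f (involution-↭ h h-invol u closed))

    ∑-neg : ∀ {A : Set} (xs : List A) f → ∑ xs (λ x → -ᴹ f x) ≈ᴹ -ᴹ ∑ xs f
    ∑-neg []       f = ≈ᴹ-sym -ᴹ0≈0
    ∑-neg (x ∷ xs) f = ≈ᴹ-trans (+ᴹ-congˡ (∑-neg xs f)) (-ᴹ-+-comm _ _)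

    -- The linear extension of f, evaluated at a formal sum. Repeated words are harmless, and a
    -- product in the group algebra turns into an iterated evaluation.
    ev : ∀ {A : Set} → List (Carrier × A) → (A → Carrierᴹ) → Carrierᴹ
    ev []            f = 0ᴹ
    ev ((a , v) ∷ x) f = a *ₗ f v +ᴹ ev x f

    module _ {A : Set} where

      ev-cong∈ : ∀ (x : List (Carrier × A)) {f g} → (∀ {a v} → (a , v) ∈ x → f v ≈ᴹ g v) → ev x f ≈ᴹ ev x g
      ev-cong∈ []      h = ≈ᴹ-refl
      ev-cong∈ (_ ∷ x) h = +ᴹ-cong (*ₗ-congˡ (h (here ≡.refl))) (ev-cong∈ x (h ∘ there))

      ev-cong : ∀ (x : List (Carrier × A)) {f g} → (∀ v → f v ≈ᴹ g v) → ev x f ≈ᴹ ev x g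
      ev-cong x h = ev-cong∈ x (λ {_} {v} _ → h v)

      ev-++ : ∀ (x y : List (Carrier × A)) f → ev (x ++ y) f ≈ᴹ ev x f +ᴹ ev y f
      ev-++ []            y f = ≈ᴹ-sym (+ᴹ-identityˡ _)
      ev-++ ((a , v) ∷ x) y f = ≈ᴹ-trans (+ᴹ-congˡ (ev-++ x y f)) (≈ᴹ-sym (+ᴹ-assoc _ _ _))

      ev-scaled : ∀ {B : Set} a (h : B → A) (y : List (Carrier × B)) f →
        ev (List.map (λ q → a * proj₁ q , h (proj₂ q)) y) f ≈ᴹ a *ₗ ev y (f ∘ h)
      ev-scaled a h []            f = ≈ᴹ-sym (*ₗ-zeroʳ a)
      ev-scaled a h ((b , v) ∷ y) f = begin
        (a * b) *ₗ f (h v) +ᴹ ev (List.map (λ q → a * proj₁ q , h (proj₂ q)) y) f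
          ≈⟨ +ᴹ-cong (*ₗ-assoc a b _) (ev-scaled a h y f) ⟩
        a *ₗ (b *ₗ f (h v)) +ᴹ a *ₗ ev y (f ∘ h)
          ≈⟨ *ₗ-distribˡ a _ _ ⟨
        a *ₗ (b *ₗ f (h v) +ᴹ ev y (f ∘ h)) ∎

      ev-mapped : ∀ {B : Set} (h : B → A) (y : List (Carrier × B)) f →
        ev (List.map (λ q → proj₁ q , h (proj₂ q)) y) f ≈ᴹ ev y (f ∘ h)
      ev-mapped h []            f = ≈ᴹ-refl
      ev-mapped h ((b , v) ∷ y) f = +ᴹ-congˡ (ev-mapped h y f)

      ev-weighted : ∀ (s : A → Carrier) xs f → ev (List.map (λ σ → s σ , σ) xs) f ≈ᴹ ∑ xs (λ σ → s σ *ₗ f σ)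
      ev-weighted s []       f = ≈ᴹ-refl
      ev-weighted s (x ∷ xs) f = +ᴹ-congˡ (ev-weighted s xs f)

      ev-0 : ∀ (x : List (Carrier × A)) {f} → (∀ {a v} → (a , v) ∈ x → f v ≈ᴹ 0ᴹ) → ev x f ≈ᴹ 0ᴹ
      ev-0 []            h = ≈ᴹ-refl
      ev-0 ((a , v) ∷ x) h = ≈ᴹ-trans
        (+ᴹ-cong (≈ᴹ-trans (*ₗ-congˡ (h (here ≡.refl))) (*ₗ-zeroʳ a)) (ev-0 x (h ∘ there)))
        (+ᴹ-identityˡ _)

      ev-+ : ∀ (x : List (Carrier × A)) f g → ev x (λ v → f v +ᴹ g v) ≈ᴹ ev x f +ᴹ ev x g
      ev-+ []            f g = ≈ᴹ-sym (+ᴹ-identityˡ _)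
      ev-+ ((a , v) ∷ x) f g = begin
        a *ₗ (f v +ᴹ g v) +ᴹ ev x (λ v → f v +ᴹ g v)
          ≈⟨ +ᴹ-cong (*ₗ-distribˡ a _ _) (ev-+ x f g) ⟩
        (a *ₗ f v +ᴹ a *ₗ g v) +ᴹ (ev x f +ᴹ ev x g)
          ≈⟨ +ᴹ-interchange _ _ _ _ ⟩
        (a *ₗ f v +ᴹ ev x f) +ᴹ (a *ₗ g v +ᴹ ev x g) ∎

      ev-* : ∀ k (x : List (Carrier × A)) f → ev x (λ v → k *ₗ f v) ≈ᴹ k *ₗ ev x f
      ev-* k []            f = ≈ᴹ-sym (*ₗ-zeroʳ k)
      ev-* k ((a , v) ∷ x) f =
        ≈ᴹ-trans (+ᴹ-cong (*ₗ-comm a k _) (ev-* k x f)) (≈ᴹ-sym (*ₗ-distribˡ k _ _))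

      ev-sum : ∀ {n} (x : List (Carrier × A)) (f : Fin n → A → Carrierᴹ) →
        ev x (λ v → sum (λ i → f i v)) ≈ᴹ sum (λ i → ev x (f i))
      ev-sum {zero}  x f = ev-0 x (λ _ → ≈ᴹ-refl)
      ev-sum {suc n} x f = ≈ᴹ-trans (ev-+ x (f zero) _) (+ᴹ-congˡ (ev-sum x (f ∘ suc)))

      ev-when : ∀ b (x : List (Carrier × A)) f → ev x (λ v → f v when b) ≈ᴹ ev x f when b
      ev-when true  x f = ≈ᴹ-refl
      ev-when false x f = ev-0 x (λ _ → ≈ᴹ-refl)

    ev-swap : ∀ {A B : Set} (x : List (Carrier × A)) (y : List (Carrier × B)) (f : A → B → Carrierᴹ) →
      ev x (λ u → ev y (f u)) ≈ᴹ ev y (λ v → ev x (λ u → f u v))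
    ev-swap []            y f = ≈ᴹ-sym (ev-0 y (λ _ → ≈ᴹ-refl))
    ev-swap ((a , u) ∷ x) y f = begin
      a *ₗ ev y (f u) +ᴹ ev x (λ u → ev y (f u))
        ≈⟨ +ᴹ-cong (≈ᴹ-sym (ev-* a y (f u))) (ev-swap x y f) ⟩
      ev y (λ v → a *ₗ f u v) +ᴹ ev y (λ v → ev x (λ u → f u v))
        ≈⟨ ev-+ y _ _ ⟨
      ev y (λ v → a *ₗ f u v +ᴹ ev x (λ u → f u v)) ∎

    ev-mulGA : ∀ {m} (x y : Tm m) f → ev (mulGA x y) f ≈ᴹ ev x (λ u → ev y (λ v → f (u ∙ v)))
    ev-mulGA []            y f = ≈ᴹ-refl
    ev-mulGA ((a , u) ∷ x) y f =
      ≈ᴹ-trans (ev-++ (List.map (λ q → a * proj₁ q , u ∙ proj₂ q) y) _ f)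
               (+ᴹ-cong (ev-scaled a (u ∙_) y f) (ev-mulGA x y f))

  ev-scalar-* : ∀ {v ℓv} (V : LeftModule F.ring v ℓv) → let open Module V in
    ∀ {A : Set} (x : List (Carrier × A)) (s : A → Carrier) v →
    ev x (λ u → s u *ₗ v) ≈ᴹ Module.ev scalars x s *ₗ v
  ev-scalar-* V []            s v = let open Module V in ≈ᴹ-sym (*ₗ-zeroˡ v)
  ev-scalar-* V ((a , u) ∷ x) s v = let open Module V in ≈ᴹ-trans
    (+ᴹ-cong (≈ᴹ-sym (*ₗ-assoc a (s u) v)) (ev-scalar-* V x s v))
    (≈ᴹ-sym (*ₗ-distribʳ v (a * s u) _))


-- Permutations that preserve columns

record Preserves {m} (col : Fin m → ℕ) (g : Word m) : Set where
  constructor mkPreserves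
  field preserves : ∀ a → col (lookup g a) ≡ col a
open Preserves public

Preserves-∙ : ∀ {m} {col : Fin m → ℕ} {σ τ : Word m} → Preserves col σ → Preserves col τ → Preserves col (σ ∙ τ)
Preserves-∙ {col = col} {σ} {τ} p q .preserves a =
  ≡.trans (cong col (lookup-∙ σ τ a)) (≡.trans (p .preserves _) (q .preserves a))

Preserves-id : ∀ {m} {col : Fin m → ℕ} → Preserves col identityW
Preserves-id {col = col} .preserves a = cong col (lookup-id a)

Preserves-tr : ∀ {m} {col : Fin m → ℕ} {i j} → col i ≡ col j → Preserves col (tr i j)
Preserves-tr {i = i} {j} e .preserves a with lookup (tr i j) a | tr-view i j a
... | _ | fst ≡.refl    = ≡.sym e
... | _ | snd _ ≡.refl  = e
... | _ | other _ _     = ≡.refl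

parity-monotone : ∀ {N} m (f : Fin m → Fin N) → (∀ i j → toℕ i < toℕ j → (toℕ (f j) <ᵇ toℕ (f i)) ≡ false) →
  parity m f ≡ false
parity-monotone zero    f h = ≡.refl
parity-monotone (suc m) f h = cong₂ _xor_
  (≡.trans (Xor.sum-cong-≋ λ j → h zero (suc j) (s≤s z≤n)) (Xor.sum-replicate-zero m))
  (parity-monotone m (f ∘ suc) (λ i j p → h (suc i) (suc j) (s≤s p)))

parity-identity : ∀ m → parity m (lookup (identityW {m})) ≡ false
parity-identity m = ≡.trans (parity-cong m lookup-id) (parity-monotone m id λ i j p → not-<ᵇ p)
  where
  not-<ᵇ : ∀ {a b} → a < b → (b <ᵇ a) ≡ false
  not-<ᵇ {a} {b} p with b <ᵇ a in eq
  ... | false = ≡.refl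
  ... | true  = contradiction (ℕₚ.<ᵇ⇒< b a (subst T (≡.sym eq) tt)) (ℕₚ.<⇒≯ p)

-- The sign character, alternating functions and symmetric groups

module Signs {c ℓ : Level} (K : Char0Field c ℓ) where
  open Linear K public
  open F using (Carrier; _≈_; _+_; _*_; -_; 0#; 1#)

  -‿involutive : ∀ x → - (- x) ≈ x
  -‿involutive = RingProperties.-‿involutive F.ring

  sgn-tr : ∀ {m} {σ : Word m} → Inj σ → ∀ {i j} → i ≢ j → sgn (σ ∙ tr i j) ≈ - sgn σ
  sgn-tr {m} {σ} σ-inj {i} {j} i≢j
    rewrite isEven-inversions (σ ∙ tr i j) | isEven-inversions σ | parity-tr σ σ-inj i≢j
    with parity m (lookup σ)
  ... | true  = F.sym (-‿involutive 1#)
  ... | false = F.refl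

  sgn-tr-left : ∀ {m} {σ : Word m} → Inj σ → ∀ {i j} → i ≢ j → sgn (tr i j ∙ σ) ≈ - sgn σ
  sgn-tr-left {m} {σ} σ-inj {i} {j} i≢j = subst (λ w → sgn w ≈ - sgn σ) conjugated (sgn-tr σ-inj i′≢j′)
    where
    i′≢j′ : lookup (inv σ) i ≢ lookup (inv σ) j
    i′≢j′ e = i≢j (Inj-inv σ-inj .injective i j e)
    conjugated : σ ∙ tr (lookup (inv σ) i) (lookup (inv σ) j) ≡ tr i j ∙ σ
    conjugated = ≡.trans (tr-conj σ-inj _ _)
      (cong₂ (λ a b → tr a b ∙ σ) (lookup-inv σ-inj i) (lookup-inv σ-inj j))

  sgn-id : ∀ {m} → sgn (identityW {m}) ≈ 1#
  sgn-id {m} rewrite isEven-inversions (identityW {m}) | parity-identity m = F.refl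

  Unit± : Carrier → Set ℓ
  Unit± s = s ≈ 1# ⊎ s ≈ - 1#

  sgn-unit : ∀ {m} (σ : Word m) → Unit± (sgn σ)
  sgn-unit σ with isEven (inversions σ)
  ... | true  = inj₁ F.refl
  ... | false = inj₂ F.refl

  Unit±-* : ∀ {s t} → Unit± s → Unit± t → Unit± (s * t)
  Unit±-* (inj₁ p) (inj₁ q) = inj₁ (F.trans (F.*-cong p q) (F.*-identityˡ _))
  Unit±-* (inj₁ p) (inj₂ q) = inj₂ (F.trans (F.*-cong p q) (F.*-identityˡ _))
  Unit±-* (inj₂ p) (inj₁ q) = inj₂ (F.trans (F.*-cong p q) (F.*-identityʳ _))
  Unit±-* (inj₂ p) (inj₂ q) = inj₁ (F.trans (F.*-cong p q) (F.trans (-1*x≈-x _) (-‿involutive _)))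

  Unit±-square : ∀ {s} → Unit± s → s * s ≈ 1#
  Unit±-square (inj₁ p) = F.trans (F.*-cong p p) (F.*-identityˡ _)
  Unit±-square (inj₂ p) = F.trans (F.*-cong p p) (F.trans (-1*x≈-x _) (-‿involutive _))

  module _ {v ℓv : Level} (V : LeftModule F.ring v ℓv) where
    open Module V

    -- Selection sort: the values below k are already in place, and one transposition within a
    -- column brings the value k to its position. So g reaches the identity through
    -- column-preserving permutations, with one sign change per transposition.
    sign-extension : ∀ {m} (col : Fin m → ℕ) (ψ : Word m → Carrierᴹ) →
      (∀ g → Inj g → Preserves col g → ∀ i j → i ≢ j → col i ≡ col j → ψ (g ∙ tr i j) ≈ᴹ -ᴹ ψ g) →
      ∀ g → Inj g → Preserves col g → ψ g ≈ᴹ sgn g *ₗ ψ identityW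
    sign-extension {m} col ψ alternating = λ g g-inj g-pres → go m 0 (ℕₚ.+-identityʳ m) g g-inj g-pres (λ _ ())
      where
      open SetoidReasoning ≈ᴹ-setoid
      go : ∀ d k → d ℕ.+ k ≡ m → ∀ g → Inj g → Preserves col g →
        (∀ b → toℕ b < k → lookup g b ≡ b) → ψ g ≈ᴹ sgn g *ₗ ψ identityW
      go zero k ≡.refl g _ _ fixed = ≈ᴹ-trans (≈ᴹ-sym (*ₗ-identityˡ _)) (≈ᴹ-sym (begin
        sgn g *ₗ ψ identityW         ≡⟨ cong (λ w → sgn w *ₗ ψ identityW) {x = g} {y = identityW} g≡id ⟩
        sgn (identityW {k}) *ₗ ψ identityW ≈⟨ *ₗ-congʳ (sgn-id {m = k}) ⟩
        1# *ₗ ψ identityW            ≡⟨ cong (λ w → 1# *ₗ ψ w) g≡id ⟨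
        1# *ₗ ψ g                    ∎))
        where
        g≡id : g ≡ identityW
        g≡id = lookup-ext λ b → ≡.trans (fixed b (Finₚ.toℕ<n b)) (≡.sym (lookup-id b))
      go (suc d) k e g g-inj g-pres fixed with lookup g (fromℕ< k<m) ≟ fromℕ< k<m
        where
        k<m : k < m
        k<m = ℕₚ.≤-trans (ℕₚ.m≤n+m (suc k) d) (ℕₚ.≤-reflexive (≡.trans (ℕₚ.+-suc d k) e))
      ... | yes ga≡a = go d (suc k) (≡.trans (ℕₚ.+-suc d k) e) g g-inj g-pres fixed′
        where
        fixed′ : ∀ b → toℕ b < suc k → lookup g b ≡ b
        fixed′ b p with ℕₚ.m≤n⇒m<n∨m≡n (ℕₚ.≤-pred p)
        ... | inj₁ q = fixed b q
        ... | inj₂ q = subst (λ z → lookup g z ≡ z)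
          (Finₚ.toℕ-injective (≡.trans (Finₚ.toℕ-fromℕ< _) (≡.sym q))) ga≡a
      ... | no ga≢a = begin
        ψ g                              ≡⟨ cong ψ (∙-tr-tr g i a) ⟨
        ψ (g′ ∙ tr i a)                  ≈⟨ alternating g′ g′-inj g′-pres i a i≢a ci≡ca ⟩
        -ᴹ ψ g′                          ≈⟨ -ᴹ‿cong (go d (suc k) (≡.trans (ℕₚ.+-suc d k) e) g′ g′-inj g′-pres fixed′) ⟩
        -ᴹ (sgn g′ *ₗ ψ identityW)       ≈⟨ -ᴹ-*ₗ _ _ ⟨
        (- sgn g′) *ₗ ψ identityW        ≈⟨ *ₗ-congʳ (F.-‿cong (sgn-tr {σ = g} g-inj i≢a)) ⟩
        (- (- sgn g)) *ₗ ψ identityW     ≈⟨ *ₗ-congʳ (-‿involutive _) ⟩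
        sgn g *ₗ ψ identityW             ∎
        where
        a = fromℕ< _
        i = preimage g a
        gi≡a : lookup g i ≡ a
        gi≡a = lookup-preimage g-inj a
        i≢a : i ≢ a
        i≢a q = ga≢a (≡.trans (cong (lookup g) (≡.sym q)) gi≡a)
        -- Since g preserves columns, the position i of the value a lies in the column of a, so the
        -- transposition is an admissible one.
        ci≡ca : col i ≡ col a
        ci≡ca = ≡.trans (≡.sym (g-pres .preserves i)) (cong col gi≡a)
        g′ = g ∙ tr i a
        g′-inj : Inj g′
        g′-inj = Inj-∙ g-inj (Inj-tr i a)
        g′-pres : Preserves col g′
        g′-pres = Preserves-∙ g-pres (Preserves-tr ci≡ca)
        fixed′ : ∀ b → toℕ b < suc k → lookup g′ b ≡ b
        fixed′ b p with ℕₚ.m≤n⇒m<n∨m≡n (ℕₚ.≤-pred p)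
        ... | inj₂ q = subst (λ z → lookup g′ z ≡ z)
          (Finₚ.toℕ-injective (≡.trans (Finₚ.toℕ-fromℕ< _) (≡.sym q)))
          (≡.trans (∙-tr-snd g i a) gi≡a)
        ... | inj₁ q = ≡.trans (∙-tr-other g i a b≢i b≢a) (fixed b q)
          where
          b≢a : b ≢ a
          b≢a r = ℕₚ.<⇒≢ q (≡.trans (cong toℕ r) (Finₚ.toℕ-fromℕ< _))
          b≢i : b ≢ i
          b≢i r = b≢a (≡.trans (≡.sym (fixed b q)) (≡.trans (cong (lookup g) r) gi≡a))

  -- The function g ↦ sgn (σ ∙ g) is alternating, so it is sgn g times its value at the identity. A
  -- constant `col` puts all points into one column and thereby admits all permutations.
  sgn-∙ : ∀ {m} {σ τ : Word m} → Inj σ → Inj τ → sgn (σ ∙ τ) ≈ sgn σ * sgn τ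
  sgn-∙ {m} {σ} {τ} σ-inj τ-inj = F.trans
    (sign-extension scalars (λ _ → 0) (λ g → sgn (σ ∙ g)) alternating τ τ-inj (mkPreserves λ _ → ≡.refl))
    (F.trans (F.*-congˡ (F.reflexive (cong sgn (∙-idʳ σ)))) (F.*-comm _ _))
    where
    alternating : ∀ g → Inj g → Preserves (λ _ → 0) g → ∀ i j → i ≢ j → 0 ≡ 0 → sgn (σ ∙ (g ∙ tr i j)) ≈ - sgn (σ ∙ g)
    alternating g g-inj _ i j i≢j _ = subst (λ w → sgn w ≈ - sgn (σ ∙ g)) (∙-assoc σ g (tr i j))
      (sgn-tr {σ = σ ∙ g} (Inj-∙ σ-inj g-inj) i≢j)

  -- The symmetric group on X, extended by the identity; `𝔞 X` and `𝔟 X` are its plain and its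
  -- signed sum.
  grp : ∀ {m} → (Fin m → Bool) → List (Word m)
  grp {m} X = boolFilter (fixesOutside X) (perms m)

  module _ {m} (X : Fin m → Bool) where

    grp-unique : Unique (grp X)
    grp-unique = boolFilter-unique (fixesOutside X) (boolFilter-unique isBij (words-unique m))

    ∈-grp⁺ : ∀ {σ} → Inj σ → (∀ a → ¬ T (X a) → lookup σ a ≡ a) → σ ∈ grp X
    ∈-grp⁺ {σ} σ-inj fixes = ∈-boolFilter⁺ (fixesOutside X)
      (∈-boolFilter⁺ isBij (∈-vecsOver m σ) (isBij-complete {w = σ} σ-inj))
      (allB-complete _ (allFin m) λ {a} _ → check a)
      where
      check : ∀ a → T (X a ∨ (lookup σ a ==ᶠ a))
      check a with X a | fixes a
      ... | true  | _ = tt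
      ... | false | h = does-complete (lookup σ a ≟ a) (h id)

    ∈-grp⁻ : ∀ {σ} → σ ∈ grp X → Inj σ × (∀ a → ¬ T (X a) → lookup σ a ≡ a)
    ∈-grp⁻ {σ} q with ∈-boolFilter⁻ (fixesOutside X) (perms m) q
    ... | r , t with ∈-boolFilter⁻ isBij (vecsOver m (allFin m)) r
    ... | _ , u = isBij-sound {w = σ} u , λ a → check a (allB-sound _ t (∈ₚ.∈-allFin a))
      where
      check : ∀ a → T (X a ∨ (lookup σ a ==ᶠ a)) → ¬ T (X a) → lookup σ a ≡ a
      check a s p with X a
      ... | true  = ⊥-elim (p tt)
      ... | false = does-sound (lookup σ a ≟ a) s

    -- If σ a were outside X, it would be fixed by σ, and injectivity would give σ a = a, which is
    -- in X.
    grp-stable : ∀ {σ} → σ ∈ grp X → ∀ a → T (X a) → T (X (lookup σ a))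
    grp-stable {σ} q a t with ∈-grp⁻ q
    ... | σ-inj , fixes with X (lookup σ a) in eq
    ...   | true  = tt
    ...   | false = subst T (≡.trans (cong X (≡.sym σa≡a)) eq) t
      where
      σa≡a : lookup σ a ≡ a
      σa≡a = σ-inj .injective _ _ (fixes (lookup σ a) (λ s → subst T eq s))

    tr∈grp : ∀ {u v} → T (X u) → T (X v) → tr u v ∈ grp X
    tr∈grp {u} {v} p q = ∈-grp⁺ (Inj-tr u v) λ a ¬t →
      tr-other u v (λ e → ¬t (subst (T ∘ X) (≡.sym e) p)) (λ e → ¬t (subst (T ∘ X) (≡.sym e) q))

    id∈grp : identityW ∈ grp X
    id∈grp = ∈-grp⁺ Inj-id λ a _ → lookup-id a

    grp-∙ : ∀ {σ τ} → σ ∈ grp X → τ ∈ grp X → (σ ∙ τ) ∈ grp X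
    grp-∙ {σ} {τ} p q with ∈-grp⁻ p | ∈-grp⁻ q
    ... | σ-inj , f | τ-inj , g = ∈-grp⁺ (Inj-∙ σ-inj τ-inj) λ a ¬t →
      ≡.trans (lookup-∙ σ τ a) (≡.trans (cong (lookup σ) (g a ¬t)) (f a ¬t))

    module _ {v ℓv : Level} (V : LeftModule F.ring v ℓv) {u w : Fin m} (Xu : T (X u)) (Xw : T (X w)) where
      open Module V
      open SetoidReasoning ≈ᴹ-setoid

      𝔞-right : ∀ f → ev (𝔞 X) (λ σ → f (σ ∙ tr u w)) ≈ᴹ ev (𝔞 X) f
      𝔞-right f = begin
        ev (𝔞 X) (λ σ → f (σ ∙ tr u w))          ≈⟨ ev-weighted _ (grp X) _ ⟩
        ∑ (grp X) (λ σ → 1# *ₗ f (σ ∙ tr u w))   ≈⟨ ∑-involution (_∙ tr u w) (λ σ → ∙-tr-tr σ u w) grp-unique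
                                                      (λ q → grp-∙ q (tr∈grp Xu Xw)) (λ σ → 1# *ₗ f σ) ⟩
        ∑ (grp X) (λ σ → 1# *ₗ f σ)              ≈⟨ ev-weighted _ (grp X) _ ⟨
        ev (𝔞 X) f                               ∎

      module _ (u≢w : u ≢ w) where

        private
          antisymmetric : (h : Word m → Word m) → (∀ σ → h (h σ) ≡ σ) →
            (∀ {σ} → σ ∈ grp X → h σ ∈ grp X) → (∀ {σ} → Inj σ → sgn (h σ) ≈ - sgn σ) →
            ∀ f → ev (𝔟 X) (f ∘ h) ≈ᴹ -ᴹ ev (𝔟 X) f
          antisymmetric h h-invol closed sgn-h f = begin
            ev (𝔟 X) (f ∘ h)
              ≈⟨ ev-weighted sgn (grp X) _ ⟩
            ∑ (grp X) (λ σ → sgn σ *ₗ f (h σ))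
              ≈⟨ ∑-cong (grp X) (λ {σ} q → ≈ᴹ-trans
                   (*ₗ-congʳ (F.trans (F.sym (-‿involutive _)) (F.-‿cong (F.sym (sgn-h (proj₁ (∈-grp⁻ q)))))))
                   (-ᴹ-*ₗ _ _)) ⟩
            ∑ (grp X) (λ σ → -ᴹ (sgn (h σ) *ₗ f (h σ)))
              ≈⟨ ∑-involution h h-invol grp-unique closed (λ σ → -ᴹ (sgn σ *ₗ f σ)) ⟩
            ∑ (grp X) (λ σ → -ᴹ (sgn σ *ₗ f σ))
              ≈⟨ ∑-neg (grp X) _ ⟩
            -ᴹ ∑ (grp X) (λ σ → sgn σ *ₗ f σ)
              ≈⟨ -ᴹ‿cong (ev-weighted sgn (grp X) f) ⟨
            -ᴹ ev (𝔟 X) f ∎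

        𝔟-right : ∀ f → ev (𝔟 X) (λ σ → f (σ ∙ tr u w)) ≈ᴹ -ᴹ ev (𝔟 X) f
        𝔟-right = antisymmetric (_∙ tr u w) (λ σ → ∙-tr-tr σ u w)
          (λ q → grp-∙ q (tr∈grp Xu Xw)) (λ σ-inj → sgn-tr σ-inj u≢w)

        𝔟-left : ∀ f → ev (𝔟 X) (λ σ → f (tr u w ∙ σ)) ≈ᴹ -ᴹ ev (𝔟 X) f
        𝔟-left = antisymmetric (tr u w ∙_) (λ σ → tr-tr-∙ σ u w)
          (λ q → grp-∙ (tr∈grp Xu Xw) q) (λ σ-inj → sgn-tr-left σ-inj u≢w)

  -- Products of commuting factors

  ∈-mulGA⁻ : ∀ {m} (x y : GA m) {q} → q ∈ mulGA x y →
    ∃₂ λ p r → p ∈ x × r ∈ y × q ≡ (proj₁ p * proj₁ r , proj₂ p ∙ proj₂ r)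
  ∈-mulGA⁻ (p ∷ x) y q with ∈ₚ.∈-++⁻ (List.map (λ r → proj₁ p * proj₁ r , proj₂ p ∙ proj₂ r) y) q
  ... | inj₁ q₁ with ∈ₚ.∈-map⁻ _ q₁
  ...   | r , r∈y , e = p , r , here ≡.refl , r∈y , e
  ∈-mulGA⁻ (p ∷ x) y q | inj₂ q₂ with ∈-mulGA⁻ x y q₂
  ...   | p′ , r , p∈x , r∈y , e = p′ , r , there p∈x , r∈y , e

  ∈-mulGA⁺ : ∀ {m} {x y : GA m} {a b σ τ} → (a , σ) ∈ x → (b , τ) ∈ y → (a * b , σ ∙ τ) ∈ mulGA x y
  ∈-mulGA⁺ {y = y} (here ≡.refl) r = ∈ₚ.∈-++⁺ˡ (∈ₚ.∈-map⁺ _ r)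
  ∈-mulGA⁺ {x = p ∷ x} {y = y} (there q) r =
    ∈ₚ.∈-++⁺ʳ (List.map (λ r → proj₁ p * proj₁ r , proj₂ p ∙ proj₂ r) y) (∈-mulGA⁺ q r)

  module _ {m} (g : ℕ → GA m) where

    prod-items : ∀ {p} (P : Carrier → Word m → Set p) → P 1# identityW →
      (∀ {a b σ τ} → P a σ → P b τ → P (a * b) (σ ∙ τ)) →
      (∀ j {a σ} → (a , σ) ∈ g j → P a σ) →
      ∀ js {a σ} → (a , σ) ∈ prodGA (List.map g js) → P a σ
    prod-items P P-1 P-* P-g []       (here ≡.refl) = P-1
    prod-items P P-1 P-* P-g (j ∷ js) q with ∈-mulGA⁻ (g j) (prodGA (List.map g js)) q
    ... | _ , _ , p , r , ≡.refl = P-* (P-g j p) (prod-items P P-1 P-* P-g js r)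

    prod-id : (∀ j → ∃[ a ] (a , identityW) ∈ g j) → ∀ js → ∃[ a ] (a , identityW) ∈ prodGA (List.map g js)
    prod-id h []       = 1# , here ≡.refl
    prod-id h (j ∷ js) with h j | prod-id h js
    ... | a , p | b , q = a * b , subst (λ w → (a * b , w) ∈ mulGA (g j) (prodGA (List.map g js))) (∙-idˡ identityW) (∈-mulGA⁺ p q)

    -- A transposition t of two elements of one row or column commutes with every factor but the one
    -- of that row or column, which absorbs t up to the scalar ε: 1 for row sums, minus 1 for column
    -- sums.
    module Absorb {v ℓv : Level} (V : LeftModule F.ring v ℓv) (t : Word m) (j₀ : ℕ) (ε : Carrier)
      (commute : ∀ j → j ≢ j₀ → ∀ {a σ} → (a , σ) ∈ g j → σ ∙ t ≡ t ∙ σ) where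
      open Module V
      open SetoidReasoning ≈ᴹ-setoid

      prod-commute : ∀ js → All (j₀ ≢_) js → ∀ f →
        ev (prodGA (List.map g js)) (λ σ → f (σ ∙ t)) ≈ᴹ ev (prodGA (List.map g js)) (λ σ → f (t ∙ σ))
      prod-commute []       _        f = +ᴹ-congʳ (*ₗ-congˡ (≈ᴹ-reflexive (cong f (≡.trans (∙-idˡ t) (≡.sym (∙-idʳ t))))))
      prod-commute (j ∷ js) (p ∷ ps) f = begin
        ev (mulGA (g j) rest) (λ σ → f (σ ∙ t))
          ≈⟨ ev-mulGA (g j) rest _ ⟩
        ev (g j) (λ σ → ev rest (λ τ → f ((σ ∙ τ) ∙ t)))
          ≈⟨ ev-cong (g j) (λ σ → ev-cong rest (λ τ → ≈ᴹ-reflexive (cong f (∙-assoc σ τ t)))) ⟩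
        ev (g j) (λ σ → ev rest (λ τ → f (σ ∙ (τ ∙ t))))
          ≈⟨ ev-cong (g j) (λ σ → prod-commute js ps (λ τ → f (σ ∙ τ))) ⟩
        ev (g j) (λ σ → ev rest (λ τ → f (σ ∙ (t ∙ τ))))
          ≈⟨ ev-cong∈ (g j) (λ {_} {σ} q → ev-cong rest (λ τ → ≈ᴹ-reflexive (cong f
               (≡.trans (≡.sym (∙-assoc σ t τ)) (≡.trans (cong (_∙ τ) (commute j (p ∘ ≡.sym) q)) (∙-assoc t σ τ)))))) ⟩
        ev (g j) (λ σ → ev rest (λ τ → f (t ∙ (σ ∙ τ))))
          ≈⟨ ev-mulGA (g j) rest _ ⟨
        ev (mulGA (g j) rest) (λ σ → f (t ∙ σ)) ∎
        where rest = prodGA (List.map g js)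

      prod-left : (∀ f → ev (g j₀) (λ σ → f (t ∙ σ)) ≈ᴹ ε *ₗ ev (g j₀) f) →
        ∀ js → j₀ ∈ js → ∀ f →
        ev (prodGA (List.map g js)) (λ σ → f (t ∙ σ)) ≈ᴹ ε *ₗ ev (prodGA (List.map g js)) f
      prod-left absorb (j ∷ js) q f with j ℕ.≟ j₀
      ... | yes ≡.refl = begin
        ev (mulGA (g j) rest) (λ σ → f (t ∙ σ))
          ≈⟨ ev-mulGA (g j) rest _ ⟩
        ev (g j) (λ σ → ev rest (λ τ → f (t ∙ (σ ∙ τ))))
          ≈⟨ ev-cong (g j) (λ σ → ev-cong rest (λ τ → ≈ᴹ-reflexive (cong f (∙-assoc t σ τ)))) ⟨
        ev (g j) (λ σ → ev rest (λ τ → f ((t ∙ σ) ∙ τ)))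
          ≈⟨ absorb (λ σ → ev rest (λ τ → f (σ ∙ τ))) ⟩
        ε *ₗ ev (g j) (λ σ → ev rest (λ τ → f (σ ∙ τ)))
          ≈⟨ *ₗ-congˡ (ev-mulGA (g j) rest f) ⟨
        ε *ₗ ev (mulGA (g j) rest) f ∎
        where rest = prodGA (List.map g js)
      ... | no j≢j₀ = begin
        ev (mulGA (g j) rest) (λ σ → f (t ∙ σ))
          ≈⟨ ev-mulGA (g j) rest _ ⟩
        ev (g j) (λ σ → ev rest (λ τ → f (t ∙ (σ ∙ τ))))
          ≈⟨ ev-cong∈ (g j) (λ {_} {σ} p → ev-cong rest (λ τ → ≈ᴹ-reflexive (cong f
               (≡.trans (≡.sym (∙-assoc t σ τ)) (≡.trans (cong (_∙ τ) (≡.sym (commute j j≢j₀ p))) (∙-assoc σ t τ)))))) ⟩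
        ev (g j) (λ σ → ev rest (λ τ → f (σ ∙ (t ∙ τ))))
          ≈⟨ ev-cong (g j) (λ σ → prod-left absorb js (tail q) (λ τ → f (σ ∙ τ))) ⟩
        ev (g j) (λ σ → ε *ₗ ev rest (λ τ → f (σ ∙ τ)))
          ≈⟨ ev-* ε (g j) _ ⟩
        ε *ₗ ev (g j) (λ σ → ev rest (λ τ → f (σ ∙ τ)))
          ≈⟨ *ₗ-congˡ (ev-mulGA (g j) rest f) ⟨
        ε *ₗ ev (mulGA (g j) rest) f ∎
        where
        rest = prodGA (List.map g js)
        tail : j₀ ∈ j ∷ js → j₀ ∈ js
        tail (here e)  = contradiction (≡.sym e) j≢j₀
        tail (there r) = r

      -- Coming from the right, t has to pass all factors behind the one that absorbs it, so the
      -- index of that factor must not recur among them.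
      prod-right : (∀ f → ev (g j₀) (λ σ → f (σ ∙ t)) ≈ᴹ ε *ₗ ev (g j₀) f) →
        ∀ js → Unique js → j₀ ∈ js → ∀ f →
        ev (prodGA (List.map g js)) (λ σ → f (σ ∙ t)) ≈ᴹ ε *ₗ ev (prodGA (List.map g js)) f
      prod-right absorb (j ∷ js) (u ∷ us) q f = begin
        ev (mulGA (g j) rest) (λ σ → f (σ ∙ t))
          ≈⟨ ev-mulGA (g j) rest _ ⟩
        ev (g j) (λ σ → ev rest (λ τ → f ((σ ∙ τ) ∙ t)))
          ≈⟨ ev-cong (g j) (λ σ → ev-cong rest (λ τ → ≈ᴹ-reflexive (cong f (∙-assoc σ τ t)))) ⟩
        ev (g j) (λ σ → ev rest (λ τ → f (σ ∙ (τ ∙ t))))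
          ≈⟨ absorbed q ⟩
        ε *ₗ ev (g j) (λ σ → ev rest (λ τ → f (σ ∙ τ)))
          ≈⟨ *ₗ-congˡ (ev-mulGA (g j) rest f) ⟨
        ε *ₗ ev (mulGA (g j) rest) f ∎
        where
        rest = prodGA (List.map g js)
        absorbed : j₀ ∈ j ∷ js → ev (g j) (λ σ → ev rest (λ τ → f (σ ∙ (τ ∙ t))))
          ≈ᴹ ε *ₗ ev (g j) (λ σ → ev rest (λ τ → f (σ ∙ τ)))
        absorbed (here ≡.refl) = begin
          ev (g j) (λ σ → ev rest (λ τ → f (σ ∙ (τ ∙ t))))
            ≈⟨ ev-cong (g j) (λ σ → prod-commute js u (λ τ → f (σ ∙ τ))) ⟩
          ev (g j) (λ σ → ev rest (λ τ → f (σ ∙ (t ∙ τ))))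
            ≈⟨ ev-cong (g j) (λ σ → ev-cong rest (λ τ → ≈ᴹ-reflexive (cong f (∙-assoc σ t τ)))) ⟨
          ev (g j) (λ σ → ev rest (λ τ → f ((σ ∙ t) ∙ τ)))
            ≈⟨ absorb (λ σ → ev rest (λ τ → f (σ ∙ τ))) ⟩
          ε *ₗ ev (g j) (λ σ → ev rest (λ τ → f (σ ∙ τ))) ∎
        absorbed (there r) = ≈ᴹ-trans
          (ev-cong (g j) (λ σ → prod-right absorb js us r (λ τ → f (σ ∙ τ)))) (ev-* ε (g j) _)


-- Young symmetrizers

-- The diagram transported along a tableau, so that letters carry the row and column of their box.
-- The last three fields say that coordinates determine the letter and that the boxes to the left of
-- a box and above it exist.
record Diagram (m : ℕ) : Set where
  field
    row col    : Fin m → ℕ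
    rows cols  : ℕ
    row<rows   : ∀ a → row a < rows
    col<cols   : ∀ a → col a < cols
    determined : ∀ {a b} → row a ≡ row b → col a ≡ col b → a ≡ b
    left       : ∀ a {j} → j < col a → ∃[ b ] (row b ≡ row a × col b ≡ j)
    up         : ∀ a {i} → i < row a → ∃[ b ] (row b ≡ i × col b ≡ col a)

module Young {c ℓ : Level} (K : Char0Field c ℓ) {m : ℕ} (D : Diagram m) where
  open Signs K
  open F using (Carrier; _≈_; _+_; _*_; -_; 0#; 1#)
  open Diagram D

  rowSum colSum young : GA m
  rowSum = prodGA (List.map (λ i → 𝔞 (λ a → row a ≡ᵇ i)) (upTo rows))
  colSum = prodGA (List.map (λ j → 𝔟 (λ a → col a ≡ᵇ j)) (upTo cols))
  young  = mulGA rowSum colSum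

  ≡ᵇ-refl : ∀ n → T (n ≡ᵇ n)
  ≡ᵇ-refl n = ℕₚ.≡⇒≡ᵇ n n ≡.refl

  level-preserving : ∀ (h : Fin m → ℕ) j {σ} → σ ∈ grp (λ a → h a ≡ᵇ j) → Preserves h σ
  level-preserving h j {σ} q .preserves a with h a ℕ.≟ j
  ... | yes ≡.refl = ℕₚ.≡ᵇ⇒≡ _ _ (grp-stable (λ a → h a ≡ᵇ j) q a (≡ᵇ-refl j))
  ... | no ha≢j = cong h (proj₂ (∈-grp⁻ (λ a → h a ≡ᵇ j) q) a (ha≢j ∘ ℕₚ.≡ᵇ⇒≡ _ _))

  level-commute : ∀ (h : Fin m → ℕ) {u w} → h u ≡ h w → ∀ j → j ≢ h u → ∀ {σ} →
    σ ∈ grp (λ a → h a ≡ᵇ j) → σ ∙ tr u w ≡ tr u w ∙ σ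
  level-commute h {u} {w} e j j≢ {σ} q with ∈-grp⁻ (λ a → h a ≡ᵇ j) q
  ... | σ-inj , fixes = ≡.trans (tr-conj σ-inj u w) (cong₂ (λ a b → tr a b ∙ σ)
    (fixes u λ t → j≢ (≡.sym (ℕₚ.≡ᵇ⇒≡ _ _ t)))
    (fixes w λ t → j≢ (≡.trans (≡.sym (ℕₚ.≡ᵇ⇒≡ _ _ t)) (≡.sym e))))

  rowSum-items : ∀ {s σ} → (s , σ) ∈ rowSum → s ≈ 1# × Inj σ × Preserves row σ
  rowSum-items = prod-items _ (λ s σ → s ≈ 1# × Inj σ × Preserves row σ)
    (F.refl , Inj-id , Preserves-id)
    (λ (p , q , r) (p′ , q′ , r′) → F.trans (F.*-cong p p′) (F.*-identityˡ _) , Inj-∙ q q′ , Preserves-∙ r r′)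
    factor (upTo rows)
    where
    factor : ∀ i {s σ} → (s , σ) ∈ 𝔞 (λ a → row a ≡ᵇ i) → s ≈ 1# × Inj σ × Preserves row σ
    factor i q with ∈ₚ.∈-map⁻ _ q
    ... | σ , r , ≡.refl = F.refl , proj₁ (∈-grp⁻ (λ a → row a ≡ᵇ i) r) , level-preserving row i r

  colSum-items : ∀ {s σ} → (s , σ) ∈ colSum → s ≈ sgn σ × Inj σ × Preserves col σ
  colSum-items = prod-items _ (λ s σ → s ≈ sgn σ × Inj σ × Preserves col σ)
    (F.sym (sgn-id {m = m}) , Inj-id , Preserves-id)
    (λ {_} {_} {σ} {τ} (p , q , r) (p′ , q′ , r′) →
      F.trans (F.*-cong p p′) (F.sym (sgn-∙ {σ = σ} {τ} q q′)) , Inj-∙ q q′ , Preserves-∙ r r′)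
    factor (upTo cols)
    where
    factor : ∀ i {s σ} → (s , σ) ∈ 𝔟 (λ a → col a ≡ᵇ i) → s ≈ sgn σ × Inj σ × Preserves col σ
    factor i q with ∈ₚ.∈-map⁻ _ q
    ... | σ , r , ≡.refl = F.refl , proj₁ (∈-grp⁻ (λ a → col a ≡ᵇ i) r) , level-preserving col i r

  id∈rowSum : ∃[ s ] (s , identityW) ∈ rowSum
  id∈rowSum = prod-id _ (λ i → 1# , ∈ₚ.∈-map⁺ _ (id∈grp (λ a → row a ≡ᵇ i))) (upTo rows)

  id∈colSum : ∃[ s ] (s , identityW) ∈ colSum
  id∈colSum = prod-id _ (λ i → sgn (identityW {m}) , ∈ₚ.∈-map⁺ _ (id∈grp (λ a → col a ≡ᵇ i))) (upTo cols)

  young-items : ∀ {s σ} → (s , σ) ∈ young → Unit± s × Inj σ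
  young-items q with ∈-mulGA⁻ rowSum colSum q
  ... | _ , (_ , τ) , p , r , ≡.refl with rowSum-items p | colSum-items r
  ...   | s≈1 , ρ-inj , _ | t≈sgn , τ-inj , _ = Unit±-* (inj₁ s≈1) (resp (sgn-unit τ)) , Inj-∙ ρ-inj τ-inj
    where
    resp : Unit± (sgn τ) → Unit± _
    resp (inj₁ e) = inj₁ (F.trans t≈sgn e)
    resp (inj₂ e) = inj₂ (F.trans t≈sgn e)

  module _ {v ℓv : Level} (V : LeftModule F.ring v ℓv) where
    open Module V
    open SetoidReasoning ≈ᴹ-setoid

    1*ₗ : ∀ {v} → 1# *ₗ v ≈ᴹ v
    1*ₗ = *ₗ-identityˡ _

    -1*ₗ : ∀ {v} → (- 1#) *ₗ v ≈ᴹ -ᴹ v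
    -1*ₗ = ≈ᴹ-trans (-ᴹ-*ₗ _ _) (-ᴹ‿cong 1*ₗ)

    rowSum-right : ∀ {u w} → row u ≡ row w → ∀ f → ev rowSum (λ σ → f (σ ∙ tr u w)) ≈ᴹ ev rowSum f
    rowSum-right {u} {w} e f = ≈ᴹ-trans
      (Absorb.prod-right (λ i → 𝔞 (λ a → row a ≡ᵇ i)) V (tr u w) (row u) 1# commute
        (λ f → ≈ᴹ-trans (𝔞-right (λ a → row a ≡ᵇ row u) V (≡ᵇ-refl (row u)) (ℕₚ.≡⇒≡ᵇ _ _ (≡.sym e)) f) (≈ᴹ-sym 1*ₗ))
        (upTo rows) (Uniqueₚ.upTo⁺ rows) (∈ₚ.∈-upTo⁺ (row<rows u)) f)
      1*ₗ
      where
      commute : ∀ i → i ≢ row u → ∀ {s σ} → (s , σ) ∈ 𝔞 (λ a → row a ≡ᵇ i) → σ ∙ tr u w ≡ tr u w ∙ σ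
      commute i i≢ q with ∈ₚ.∈-map⁻ _ q
      ... | σ , r , ≡.refl = level-commute row e i i≢ r

    module _ {u w : Fin m} (e : col u ≡ col w) (u≢w : u ≢ w) where

      col-commute : ∀ i → i ≢ col u → ∀ {s σ} → (s , σ) ∈ 𝔟 (λ a → col a ≡ᵇ i) → σ ∙ tr u w ≡ tr u w ∙ σ
      col-commute i i≢ q with ∈ₚ.∈-map⁻ _ q
      ... | σ , r , ≡.refl = level-commute col e i i≢ r

      colSum-right : ∀ f → ev colSum (λ σ → f (σ ∙ tr u w)) ≈ᴹ -ᴹ ev colSum f
      colSum-right f = ≈ᴹ-trans
        (Absorb.prod-right (λ i → 𝔟 (λ a → col a ≡ᵇ i)) V (tr u w) (col u) (- 1#) col-commute
          (λ f → ≈ᴹ-trans (𝔟-right (λ a → col a ≡ᵇ col u) V (≡ᵇ-refl (col u)) (ℕₚ.≡⇒≡ᵇ _ _ (≡.sym e)) u≢w f) (≈ᴹ-sym -1*ₗ))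
          (upTo cols) (Uniqueₚ.upTo⁺ cols) (∈ₚ.∈-upTo⁺ (col<cols u)) f)
        -1*ₗ

      colSum-left : ∀ f → ev colSum (λ σ → f (tr u w ∙ σ)) ≈ᴹ -ᴹ ev colSum f
      colSum-left f = ≈ᴹ-trans
        (Absorb.prod-left (λ i → 𝔟 (λ a → col a ≡ᵇ i)) V (tr u w) (col u) (- 1#) col-commute
          (λ f → ≈ᴹ-trans (𝔟-left (λ a → col a ≡ᵇ col u) V (≡ᵇ-refl (col u)) (ℕₚ.≡⇒≡ᵇ _ _ (≡.sym e)) u≢w f) (≈ᴹ-sym -1*ₗ))
          (upTo cols) (∈ₚ.∈-upTo⁺ (col<cols u)) f)
        -1*ₗ

    module Relations (f : Word m → Carrierᴹ) where

      -- `A` carries the row symmetrization alone, so `φ` is its signed sum over the column group.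
      -- Relations among the `φ` arise from letters that a column permutation puts into one row,
      -- since `A` does not see their exchange.
      φ A : Word m → Carrierᴹ
      φ w = ev young (λ p → f (p ∙ w))
      A u = ev rowSum (λ ρ → f (ρ ∙ u))

      φ-A : ∀ w → φ w ≈ᴹ ev colSum (λ τ → A (τ ∙ w))
      φ-A w = begin
        ev young (λ p → f (p ∙ w))
          ≈⟨ ev-mulGA rowSum colSum _ ⟩
        ev rowSum (λ ρ → ev colSum (λ τ → f ((ρ ∙ τ) ∙ w)))
          ≈⟨ ev-swap rowSum colSum _ ⟩
        ev colSum (λ τ → ev rowSum (λ ρ → f ((ρ ∙ τ) ∙ w)))
          ≈⟨ ev-cong colSum (λ τ → ev-cong rowSum (λ ρ → ≈ᴹ-reflexive (cong f (∙-assoc ρ τ w)))) ⟩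
        ev colSum (λ τ → A (τ ∙ w)) ∎

      A-row : ∀ {x y} u → row x ≡ row y → A (tr x y ∙ u) ≈ᴹ A u
      A-row {x} {y} u e = begin
        ev rowSum (λ ρ → f (ρ ∙ (tr x y ∙ u))) ≈⟨ ev-cong rowSum (λ ρ → ≈ᴹ-reflexive (cong f (∙-assoc ρ (tr x y) u))) ⟨
        ev rowSum (λ ρ → f ((ρ ∙ tr x y) ∙ u)) ≈⟨ rowSum-right e (λ σ → f (σ ∙ u)) ⟩
        A u                                    ∎

      A-row′ : ∀ {τ x y} w → Inj τ → row (lookup τ x) ≡ row (lookup τ y) → A (τ ∙ (tr x y ∙ w)) ≈ᴹ A (τ ∙ w)
      A-row′ {τ} {x} {y} w τ-inj e = begin
        A (τ ∙ (tr x y ∙ w))                         ≡⟨ cong A (∙-assoc τ (tr x y) w) ⟨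
        A ((τ ∙ tr x y) ∙ w)                         ≡⟨ cong (λ z → A (z ∙ w)) (tr-conj τ-inj x y) ⟩
        A ((tr (lookup τ x) (lookup τ y) ∙ τ) ∙ w)   ≡⟨ cong A (∙-assoc (tr (lookup τ x) (lookup τ y)) τ w) ⟩
        A (tr (lookup τ x) (lookup τ y) ∙ (τ ∙ w))   ≈⟨ A-row (τ ∙ w) e ⟩
        A (τ ∙ w)                                    ∎

      φ-col : ∀ {x y} w → col x ≡ col y → x ≢ y → φ (tr x y ∙ w) ≈ᴹ -ᴹ φ w
      φ-col {x} {y} w e x≢y = begin
        φ (tr x y ∙ w)                            ≈⟨ φ-A _ ⟩
        ev colSum (λ τ → A (τ ∙ (tr x y ∙ w)))    ≈⟨ ev-cong colSum (λ τ → ≈ᴹ-reflexive (cong A (∙-assoc τ (tr x y) w))) ⟨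
        ev colSum (λ τ → A ((τ ∙ tr x y) ∙ w))    ≈⟨ colSum-right e x≢y (λ σ → A (σ ∙ w)) ⟩
        -ᴹ ev colSum (λ τ → A (τ ∙ w))            ≈⟨ -ᴹ‿cong (φ-A w) ⟨
        -ᴹ φ w                                    ∎

      φ-sign : ∀ g w → Inj g → Preserves col g → φ (g ∙ w) ≈ᴹ sgn g *ₗ φ w
      φ-sign g w g-inj g-pres = ≈ᴹ-trans
        (sign-extension V col (λ h → φ (h ∙ w)) alternating g g-inj g-pres)
        (*ₗ-congˡ (≈ᴹ-reflexive (cong φ (∙-idˡ w))))
        where
        alternating : ∀ h → Inj h → Preserves col h → ∀ i j → i ≢ j → col i ≡ col j →
          φ ((h ∙ tr i j) ∙ w) ≈ᴹ -ᴹ φ (h ∙ w)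
        alternating h h-inj h-pres i j i≢j e = begin
          φ ((h ∙ tr i j) ∙ w)                         ≡⟨ cong (λ z → φ (z ∙ w)) (tr-conj h-inj i j) ⟩
          φ ((tr (lookup h i) (lookup h j) ∙ h) ∙ w)   ≡⟨ cong φ (∙-assoc (tr (lookup h i) (lookup h j)) h w) ⟩
          φ (tr (lookup h i) (lookup h j) ∙ (h ∙ w))
            ≈⟨ φ-col (h ∙ w) (≡.trans (h-pres .preserves i) (≡.trans e (≡.sym (h-pres .preserves j))))
                     (i≢j ∘ h-inj .injective i j) ⟩
          -ᴹ φ (h ∙ w) ∎

      -- Every column permutation sends two elements of E to the same row, so the row sum kills
      -- the antisymmetrization over E.
      garnir : ∀ (E : Fin m → Bool) →
        (∀ τ → Inj τ → Preserves col τ →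
          ∃₂ λ x y → T (E x) × T (E y) × x ≢ y × row (lookup τ x) ≡ row (lookup τ y)) →
        ∀ w → ∑ (grp E) (λ g → sgn g *ₗ φ (g ∙ w)) ≈ᴹ 0ᴹ
      garnir E collide w = begin
        ∑ (grp E) (λ g → sgn g *ₗ φ (g ∙ w))
          ≈⟨ ev-weighted sgn (grp E) _ ⟨
        ev (𝔟 E) (λ g → φ (g ∙ w))
          ≈⟨ ev-cong (𝔟 E) (λ g → φ-A (g ∙ w)) ⟩
        ev (𝔟 E) (λ g → ev colSum (λ τ → A (τ ∙ (g ∙ w))))
          ≈⟨ ev-swap (𝔟 E) colSum _ ⟩
        ev colSum (λ τ → ev (𝔟 E) (λ g → A (τ ∙ (g ∙ w))))
          ≈⟨ ev-0 colSum (λ {_} {τ} q → vanish τ (colSum-items q)) ⟩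
        0ᴹ ∎
        where
        vanish : ∀ {s} τ → s ≈ sgn τ × Inj τ × Preserves col τ → ev (𝔟 E) (λ g → A (τ ∙ (g ∙ w))) ≈ᴹ 0ᴹ
        vanish τ (_ , τ-inj , τ-pres) with collide τ τ-inj τ-pres
        ... | x , y , Ex , Ey , x≢y , e = self-negative⇒0 (begin
          ev (𝔟 E) (λ g → A (τ ∙ (g ∙ w)))
            ≈⟨ ev-cong (𝔟 E) (λ g → A-row′ (g ∙ w) τ-inj e) ⟨
          ev (𝔟 E) (λ g → A (τ ∙ (tr x y ∙ (g ∙ w))))
            ≈⟨ ev-cong (𝔟 E) (λ g → ≈ᴹ-reflexive (cong (λ z → A (τ ∙ z)) (∙-assoc (tr x y) g w))) ⟨
          ev (𝔟 E) (λ g → A (τ ∙ ((tr x y ∙ g) ∙ w)))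
            ≈⟨ 𝔟-left E V Ex Ey x≢y (λ g → A (τ ∙ (g ∙ w))) ⟩
          -ᴹ ev (𝔟 E) (λ g → A (τ ∙ (g ∙ w))) ∎)

      module _ (w : Word m) (y : Fin m) {j : ℕ} (j<y : j < col y) where

        inCol : Fin m → Bool
        inCol x = col x ≡ᵇ j

        sameRow : Word m → Fin m → Bool
        sameRow τ x = row (lookup τ x) ≡ᵇ row (lookup τ y)

        term : Fin m → Fin m → Word m → Carrierᴹ
        term x x′ τ = A (τ ∙ (tr x y ∙ w)) when sameRow τ x′

        y-outside : ∀ {x} → T (inCol x) → y ≢ x
        y-outside {x} t e = ℕₚ.<⇒≢ j<y (≡.trans (≡.sym (ℕₚ.≡ᵇ⇒≡ _ _ t)) (cong col (≡.sym e)))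

        -- The element of column j that τ moves to the row of τ y.
        partner : ∀ {τ} → Inj τ → Preserves col τ →
          ∃[ e ] (T (inCol e) × T (sameRow τ e) × (∀ x → T (inCol x) → T (sameRow τ x) → x ≡ e))
        partner {τ} τ-inj τ-pres with left (lookup τ y) (subst (j <_) (≡.sym (τ-pres .preserves y)) j<y)
        ... | z , rz , cz = e , ℕₚ.≡⇒≡ᵇ _ _ e-col , ℕₚ.≡⇒≡ᵇ _ _ (≡.trans (cong row τe≡z) rz) , unique
          where
          e = preimage τ z
          τe≡z : lookup τ e ≡ z
          τe≡z = lookup-preimage τ-inj z
          e-col : col e ≡ j
          e-col = ≡.trans (≡.sym (τ-pres .preserves e)) (≡.trans (cong col τe≡z) cz)
          unique : ∀ x → T (inCol x) → T (sameRow τ x) → x ≡ e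
          unique x p q = τ-inj .injective x e (≡.trans
            (determined (≡.trans (ℕₚ.≡ᵇ⇒≡ _ _ q) (≡.sym rz))
                        (≡.trans (τ-pres .preserves x) (≡.trans (ℕₚ.≡ᵇ⇒≡ _ _ p) (≡.sym cz))))
            (≡.sym τe≡z))

        -- A partition of unity: for fixed τ exactly one x in column j has τ x in the row of τ y, so
        -- this condition leaves a single term of a sum over the column.
        partner-sum : ∀ {τ} → Inj τ → Preserves col τ → ∀ (g : Fin m → Carrierᴹ) v →
          (∀ x → T (inCol x) → T (sameRow τ x) → g x ≈ᴹ v) →
          sum (λ x → (g x when sameRow τ x) when inCol x) ≈ᴹ v
        partner-sum {τ} τ-inj τ-pres g v g≈v with partner τ-inj τ-pres
        ... | e , p , q , unique = begin
          sum (λ x → (g x when sameRow τ x) when inCol x) ≈⟨ sum-single e _ elsewhere ⟩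
          (g e when sameRow τ e) when inCol e             ≈⟨ when-true p ⟩
          g e when sameRow τ e                            ≈⟨ when-true q ⟩
          g e                                             ≈⟨ g≈v e p q ⟩
          v                                               ∎
          where
          elsewhere : ∀ x → x ≢ e → (g x when sameRow τ x) when inCol x ≈ᴹ 0ᴹ
          elsewhere x x≢e with inCol x in eq₁ | sameRow τ x in eq₂
          ... | false | _     = ≈ᴹ-refl
          ... | true  | false = ≈ᴹ-refl
          ... | true  | true  = contradiction
            (unique x (subst T (≡.sym eq₁) tt) (subst T (≡.sym eq₂) tt)) x≢e

        G G′ : Fin m → Fin m → Carrierᴹ
        G x x′ = (ev colSum (term x x′) when inCol x′) when inCol x
        G′ x x′ = G x x′ when not (does (x ≟ x′))

        G-row : ∀ x → φ (tr x y ∙ w) when inCol x ≈ᴹ sum (G x)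
        G-row x with inCol x
        ... | false = ≈ᴹ-sym (sum-0 {n = m} λ _ → ≈ᴹ-refl)
        ... | true  = begin
          φ (tr x y ∙ w)
            ≈⟨ φ-A _ ⟩
          ev colSum (λ τ → A (τ ∙ (tr x y ∙ w)))
            ≈⟨ ev-cong∈ colSum (λ {_} {τ} q → let _ , τ-inj , τ-pres = colSum-items q in
                 partner-sum τ-inj τ-pres (λ _ → A (τ ∙ (tr x y ∙ w))) _ (λ _ _ _ → ≈ᴹ-refl)) ⟨
          ev colSum (λ τ → sum (λ x′ → term x x′ τ when inCol x′))
            ≈⟨ ev-sum {n = m} colSum _ ⟩
          sum (λ x′ → ev colSum (λ τ → term x x′ τ when inCol x′))
            ≈⟨ sum-cong-≋ (λ x′ → ev-when (inCol x′) colSum (term x x′)) ⟩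
          sum (λ x′ → ev colSum (term x x′) when inCol x′) ∎

        -- On the diagonal τ x and τ y share a row, where `A` absorbs the exchange of x and y. What
        -- is left depends on x only through the condition, which holds for one x.
        G-diagonal : φ w ≈ᴹ sum (λ x → G x x)
        G-diagonal = begin
          φ w
            ≈⟨ φ-A w ⟩
          ev colSum (λ τ → A (τ ∙ w))
            ≈⟨ ev-cong∈ colSum (λ {_} {τ} q → let _ , τ-inj , τ-pres = colSum-items q in
                 partner-sum τ-inj τ-pres (λ x → A (τ ∙ (tr x y ∙ w))) _
                   (λ x _ r → A-row′ w τ-inj (ℕₚ.≡ᵇ⇒≡ _ _ r))) ⟨
          ev colSum (λ τ → sum (λ x → term x x τ when inCol x))
            ≈⟨ ev-sum {n = m} colSum _ ⟩
          sum (λ x → ev colSum (λ τ → term x x τ when inCol x))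
            ≈⟨ sum-cong-≋ (λ x → ev-when (inCol x) colSum (term x x)) ⟩
          sum (λ x → ev colSum (term x x) when inCol x)
            ≈⟨ sum-cong-≋ (λ x → when-idem (inCol x)) ⟨
          sum (λ x → G x x) ∎
          where
          when-idem : ∀ {v} b → (v when b) when b ≈ᴹ v when b
          when-idem true  = ≈ᴹ-refl
          when-idem false = ≈ᴹ-refl

        -- The products (x′ x)(x y) and (x y)(x′ y) are the same three-cycle, and the leading (x y)
        -- is absorbed because the condition now says that τ x and τ y share a row.
        term-swap : ∀ x x′ → T (inCol x) → T (inCol x′) → x ≢ x′ → ∀ {s τ} → (s , τ) ∈ colSum →
          term x x′ (τ ∙ tr x′ x) ≈ᴹ term x′ x τ
        term-swap x x′ p p′ x≢x′ {_} {τ} q with colSum-items q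
        ... | _ , τ-inj , _
          rewrite ∙-tr-fst τ x′ x | ∙-tr-other τ x′ x {y} (y-outside p′) (y-outside p)
          = when-cong (sameRow τ x) λ r → begin
          A ((τ ∙ tr x′ x) ∙ (tr x y ∙ w))     ≡⟨ cong A (∙-assoc τ (tr x′ x) _) ⟩
          A (τ ∙ (tr x′ x ∙ (tr x y ∙ w)))     ≡⟨ cong (λ z → A (τ ∙ z)) (∙-assoc (tr x′ x) (tr x y) w) ⟨
          A (τ ∙ ((tr x′ x ∙ tr x y) ∙ w))     ≡⟨ cong (λ z → A (τ ∙ (z ∙ w))) three-cycle ⟩
          A (τ ∙ ((tr x y ∙ tr x′ y) ∙ w))     ≡⟨ cong (λ z → A (τ ∙ z)) (∙-assoc (tr x y) (tr x′ y) w) ⟩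
          A (τ ∙ (tr x y ∙ (tr x′ y ∙ w)))     ≈⟨ A-row′ (tr x′ y ∙ w) τ-inj (ℕₚ.≡ᵇ⇒≡ _ _ r) ⟩
          A (τ ∙ (tr x′ y ∙ w))                ∎
          where
          three-cycle : tr x′ x ∙ tr x y ≡ tr x y ∙ tr x′ y
          three-cycle = ≡.sym (≡.trans (tr-conj (Inj-tr x y) x′ y) (cong₂ (λ a b → tr a b ∙ tr x y)
            (tr-other x y (x≢x′ ∘ ≡.sym) (y-outside p′ ∘ ≡.sym)) (tr-snd x y)))

        G′-antisymmetric : ∀ x x′ → G′ x′ x ≈ᴹ -ᴹ G′ x x′
        G′-antisymmetric x x′ with x ≟ x′ | x′ ≟ x
        ... | yes _  | yes _ = ≈ᴹ-sym -ᴹ0≈0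
        ... | yes e  | no p  = contradiction (≡.sym e) p
        ... | no p   | yes e = contradiction (≡.sym e) p
        ... | no x≢x′ | no _ with inCol x in eq | inCol x′ in eq′
        ...   | false | false = ≈ᴹ-sym -ᴹ0≈0
        ...   | false | true  = ≈ᴹ-sym -ᴹ0≈0
        ...   | true  | false = ≈ᴹ-sym -ᴹ0≈0
        ...   | true  | true  = begin
          ev colSum (term x′ x)
            ≈⟨ ev-cong∈ colSum (term-swap x x′ p p′ x≢x′) ⟨
          ev colSum (λ τ → term x x′ (τ ∙ tr x′ x))
            ≈⟨ colSum-right (≡.trans (ℕₚ.≡ᵇ⇒≡ _ _ p′) (≡.sym (ℕₚ.≡ᵇ⇒≡ _ _ p))) (x≢x′ ∘ ≡.sym) (term x x′) ⟩
          -ᴹ ev colSum (term x x′) ∎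
          where
          p : T (inCol x)
          p = subst T (≡.sym eq) tt
          p′ : T (inCol x′)
          p′ = subst T (≡.sym eq′) tt

        G′-total : sum (λ x → sum (G′ x)) ≈ᴹ 0ᴹ
        G′-total = self-negative⇒0 (begin
          sum (λ x → sum (λ x′ → G′ x x′))      ≈⟨ ∑-comm G′ ⟩
          sum (λ x′ → sum (λ x → G′ x x′))      ≈⟨ sum-cong-≋ (λ x′ → sum-cong-≋ (λ x → G′-antisymmetric x′ x)) ⟩
          sum (λ x′ → sum (λ x → -ᴹ G′ x′ x))   ≈⟨ sum-cong-≋ (λ x′ → sum-neg (G′ x′)) ⟩
          sum (λ x′ → -ᴹ sum (G′ x′))           ≈⟨ sum-neg (λ x′ → sum (G′ x′)) ⟩
          -ᴹ sum (λ x′ → sum (G′ x′))           ∎)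

        G-split : ∀ x → sum (G x) ≈ᴹ sum (G′ x) +ᴹ G x x
        G-split x = begin
          sum (G x)
            ≈⟨ sum-cong-≋ (λ x′ → split (does (x ≟ x′))) ⟩
          sum (λ x′ → G′ x x′ +ᴹ (G x x′ when does (x ≟ x′)))
            ≈⟨ ∑-distrib-+ (G′ x) _ ⟩
          sum (G′ x) +ᴹ sum (λ x′ → G x x′ when does (x ≟ x′))
            ≈⟨ +ᴹ-congˡ (sum-single x _ λ x′ p → when-false (p ∘ ≡.sym ∘ does-sound (x ≟ x′))) ⟩
          sum (G′ x) +ᴹ (G x x when does (x ≟ x))
            ≈⟨ +ᴹ-congˡ (when-true (does-complete (x ≟ x) ≡.refl)) ⟩
          sum (G′ x) +ᴹ G x x ∎
          where
          split : ∀ {v} b → v ≈ᴹ (v when not b) +ᴹ (v when b)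
          split true  = ≈ᴹ-sym (+ᴹ-identityˡ _)
          split false = ≈ᴹ-sym (+ᴹ-identityʳ _)

        -- The sum runs over pairs (x , x′) of elements of column j, restricted to the column
        -- permutations τ for which τ x′ and τ y share a row. The pairs x ≢ x′ cancel against
        -- (x′ , x), and the diagonal contributes φ w.
        exchange-letters : φ w ≈ᴹ sum (λ x → φ (tr x y ∙ w) when (col x ≡ᵇ j))
        exchange-letters = begin
          φ w                                    ≈⟨ G-diagonal ⟩
          sum (λ x → G x x)                      ≈⟨ +ᴹ-identityˡ _ ⟨
          0ᴹ +ᴹ sum (λ x → G x x)                ≈⟨ +ᴹ-congʳ G′-total ⟨
          sum (λ x → sum (G′ x)) +ᴹ sum (λ x → G x x) ≈⟨ ∑-distrib-+ (λ x → sum (G′ x)) _ ⟨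
          sum (λ x → sum (G′ x) +ᴹ G x x)        ≈⟨ sum-cong-≋ (λ x → ≈ᴹ-trans (G-row x) (G-split x)) ⟨
          sum (λ x → φ (tr x y ∙ w) when inCol x) ∎

      exchange : ∀ w → Inj w → ∀ i {j} → j < col (lookup w i) →
        φ w ≈ᴹ sum (λ i′ → φ (w ∙ tr i′ i) when (col (lookup w i′) ≡ᵇ j))
      exchange w w-inj i {j} j< = begin
        φ w
          ≈⟨ exchange-letters w (lookup w i) j< ⟩
        sum (λ x → φ (tr x (lookup w i) ∙ w) when (col x ≡ᵇ j))
          ≈⟨ sum-permute _ (word-permutation w-inj) ⟩
        sum (λ i′ → φ (tr (lookup w i′) (lookup w i) ∙ w) when (col (lookup w i′) ≡ᵇ j))
          ≈⟨ sum-cong-≋ (λ i′ → ≈ᴹ-reflexive (cong (λ z → φ z when (col (lookup w i′) ≡ᵇ j)) (tr-conj w-inj i′ i))) ⟨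
        sum (λ i′ → φ (w ∙ tr i′ i) when (col (lookup w i′) ≡ᵇ j)) ∎


-- Sums of natural numbers over a finite set

module ΣN = MonoidSum ℕₚ.+-0-commutativeMonoid

sum-mono-≤ : ∀ {n} {f g : Fin n → ℕ} → (∀ i → f i ≤ g i) → ΣN.sum f ≤ ΣN.sum g
sum-mono-≤ {zero}  h = z≤n
sum-mono-≤ {suc n} h = ℕₚ.+-mono-≤ (h zero) (sum-mono-≤ (h ∘ suc))

sum-mono-< : ∀ {n} {f g : Fin n → ℕ} → (∀ i → f i ≤ g i) → ∀ i → f i < g i → ΣN.sum f < ΣN.sum g
sum-mono-< {suc n} h zero    p = ℕₚ.+-mono-<-≤ p (sum-mono-≤ (h ∘ suc))
sum-mono-< {suc n} h (suc i) p = ℕₚ.+-mono-≤-< (h zero) (sum-mono-< (h ∘ suc) i p)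

sum-≡⇒≗ : ∀ {n} {f g : Fin n → ℕ} → (∀ i → f i ≤ g i) → ΣN.sum f ≡ ΣN.sum g → f ≗ g
sum-≡⇒≗ h e i with ℕₚ.m≤n⇒m<n∨m≡n (h i)
... | inj₁ p = contradiction e (ℕₚ.<⇒≢ (sum-mono-< h i p))
... | inj₂ q = q

sum-indicator : ∀ {n} (e : Fin n) x → ΣN.sum (λ i → if does (i ≟ e) then x else 0) ≡ x
sum-indicator {suc n} zero    x = ≡.trans (cong (x ℕ.+_) (ΣN.sum-replicate-zero n)) (ℕₚ.+-identityʳ x)
sum-indicator {suc n} (suc e) x = sum-indicator e x

-- A permutation leaves the sum of all columns unchanged, so none of the inequalities can be strict.
Preserves-≤ : ∀ {n} {w : Word n} (col : Fin n → ℕ) → Inj w → (∀ i → col (lookup w i) ≤ col i) → Preserves col w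
Preserves-≤ col w-inj h .preserves =
  sum-≡⇒≗ h (≡.sym (ΣN.sum-permute col (word-permutation w-inj)))

Preserves-≥ : ∀ {n} {w : Word n} (col : Fin n → ℕ) → Inj w → (∀ i → col i ≤ col (lookup w i)) → Preserves col w
Preserves-≥ col w-inj h .preserves i =
  ≡.sym (sum-≡⇒≗ h (ΣN.sum-permute col (word-permutation w-inj)) i)

Preserves? : ∀ {n} (col : Fin n → ℕ) (w : Word n) → Dec (Preserves col w)
Preserves? col w with all? (λ a → col (lookup w a) ℕ.≟ col a)
... | yes p = yes (mkPreserves p)
... | no ¬p = no (λ q → ¬p (q .preserves))

module _ {n} (wt : Fin n → ℕ) (g : Fin n → ℕ) where

  weight : Word n → ℕ
  weight w = ΣN.sum (λ a → wt a ℕ.* g (lookup w a))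

  module _ (w : Word n) {i i′ : Fin n} (g< : g (lookup w i′) < g (lookup w i)) where

    private
      d = g (lookup w i) ∸ g (lookup w i′)
      w′ = w ∙ tr i′ i

    transfer : ∀ a →
      wt a ℕ.* g (lookup w′ a) ℕ.+ (if does (a ≟ i) then wt i ℕ.* d else 0) ≡
      wt a ℕ.* g (lookup w a) ℕ.+ (if does (a ≟ i′) then wt i′ ℕ.* d else 0)
    transfer a with a ≟ i | a ≟ i′
    ... | yes ≡.refl | yes ≡.refl = contradiction g< (ℕₚ.<-irrefl ≡.refl)
    ... | yes ≡.refl | no _ rewrite ∙-tr-snd w i′ i = begin
      wt i ℕ.* g (lookup w i′) ℕ.+ wt i ℕ.* d  ≡⟨ ℕₚ.*-distribˡ-+ (wt i) _ d ⟨
      wt i ℕ.* (g (lookup w i′) ℕ.+ d)         ≡⟨ cong (wt i ℕ.*_) (ℕₚ.m+[n∸m]≡n (ℕₚ.<⇒≤ g<)) ⟩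
      wt i ℕ.* g (lookup w i)                  ≡⟨ ℕₚ.+-identityʳ _ ⟨
      wt i ℕ.* g (lookup w i) ℕ.+ 0            ∎
      where open ≡.≡-Reasoning
    ... | no _ | yes ≡.refl rewrite ∙-tr-fst w i′ i = begin
      wt i′ ℕ.* g (lookup w i) ℕ.+ 0              ≡⟨ ℕₚ.+-identityʳ _ ⟩
      wt i′ ℕ.* g (lookup w i)                    ≡⟨ cong (wt i′ ℕ.*_) (ℕₚ.m+[n∸m]≡n (ℕₚ.<⇒≤ g<)) ⟨
      wt i′ ℕ.* (g (lookup w i′) ℕ.+ d)           ≡⟨ ℕₚ.*-distribˡ-+ (wt i′) _ d ⟩
      wt i′ ℕ.* g (lookup w i′) ℕ.+ wt i′ ℕ.* d   ∎
      where open ≡.≡-Reasoning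
    ... | no p | no q rewrite ∙-tr-other w i′ i q p = ≡.refl

    -- The exchange moves d units of g from position i to position i′ and so changes the weight by
    -- (wt i′ - wt i) · d, written without subtraction. This is the elementary step of the
    -- rearrangement inequality.
    weight-transfer : weight w′ ℕ.+ wt i ℕ.* d ≡ weight w ℕ.+ wt i′ ℕ.* d
    weight-transfer = begin
      weight w′ ℕ.+ wt i ℕ.* d
        ≡⟨ cong (weight w′ ℕ.+_) (sum-indicator i _) ⟨
      weight w′ ℕ.+ ΣN.sum (λ a → if does (a ≟ i) then wt i ℕ.* d else 0)
        ≡⟨ ΣN.∑-distrib-+ (λ a → wt a ℕ.* g (lookup w′ a)) _ ⟨
      ΣN.sum (λ a → wt a ℕ.* g (lookup w′ a) ℕ.+ (if does (a ≟ i) then wt i ℕ.* d else 0))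
        ≡⟨ ΣN.sum-cong-≋ transfer ⟩
      ΣN.sum (λ a → wt a ℕ.* g (lookup w a) ℕ.+ (if does (a ≟ i′) then wt i′ ℕ.* d else 0))
        ≡⟨ ΣN.∑-distrib-+ (λ a → wt a ℕ.* g (lookup w a)) _ ⟩
      weight w ℕ.+ ΣN.sum (λ a → if does (a ≟ i′) then wt i′ ℕ.* d else 0)
        ≡⟨ cong (weight w ℕ.+_) (sum-indicator i′ _) ⟩
      weight w ℕ.+ wt i′ ℕ.* d ∎
      where open ≡.≡-Reasoning

    weight-swap-≤ : wt i′ ≤ wt i → weight w′ ≤ weight w
    weight-swap-≤ p = ℕₚ.+-cancelʳ-≤ (wt i ℕ.* d) _ _ (begin
      weight w′ ℕ.+ wt i ℕ.* d  ≡⟨ weight-transfer ⟩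
      weight w ℕ.+ wt i′ ℕ.* d  ≤⟨ ℕₚ.+-monoʳ-≤ (weight w) (ℕₚ.*-monoˡ-≤ d p) ⟩
      weight w ℕ.+ wt i ℕ.* d   ∎)
      where open ℕₚ.≤-Reasoning

    weight-swap-< : wt i′ < wt i → weight w′ < weight w
    weight-swap-< p = ℕₚ.+-cancelʳ-< (wt i ℕ.* d) _ _ (begin-strict
      weight w′ ℕ.+ wt i ℕ.* d  ≡⟨ weight-transfer ⟩
      weight w ℕ.+ wt i′ ℕ.* d  <⟨ ℕₚ.+-monoʳ-< (weight w) (ℕₚ.*-monoˡ-< d {{ℕ.>-nonZero (ℕₚ.m<n⇒0<n∸m g<)}} p) ⟩
      weight w ℕ.+ wt i ℕ.* d   ∎)
      where open ℕₚ.≤-Reasoning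

minimize : ∀ {n} {P : Fin n → Set} → (∀ i → Dec (P i)) → (h : Fin n → ℕ) → ∃ P →
  ∃[ i ] (P i × (∀ i′ → P i′ → h i ≤ h i′))
minimize {n} {P} P? h (i , p) = <-rec (λ x → ∀ i → h i ≡ x → P i → ∃[ i ] (P i × (∀ i′ → P i′ → h i ≤ h i′)))
  step (h i) i ≡.refl p
  where
  step : ∀ x → (∀ {y} → y < x → ∀ i → h i ≡ y → P i → ∃[ i ] (P i × (∀ i′ → P i′ → h i ≤ h i′))) →
    ∀ i → h i ≡ x → P i → ∃[ i ] (P i × (∀ i′ → P i′ → h i ≤ h i′))
  step x rec i ≡.refl p with any? (λ i′ → P? i′ ×-dec (h i′ ℕ.<? h i))
  ... | yes (i′ , p′ , lt) = rec lt i′ ≡.refl p′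
  ... | no none            = i , p , λ i′ p′ → ℕₚ.≮⇒≥ (λ lt → none (i′ , p′ , lt))

-- Labels: the positions i < k of a word

module Labels {n : ℕ} (k : ℕ) where

  lab : Fin n → Bool
  lab i = toℕ i <ᵇ k

  -- The indicator of the labels as a weight, so that the estimates for `weight` apply to sums over
  -- the labels alone.
  labelWeight : Fin n → ℕ
  labelWeight i = if lab i then 1 else 0

  labelWeight-lab : ∀ {i} → T (lab i) → labelWeight i ≡ 1
  labelWeight-lab {i} t with lab i
  ... | true = ≡.refl

  labelWeight-unlab : ∀ {i} → ¬ T (lab i) → labelWeight i ≡ 0
  labelWeight-unlab {i} t with lab i
  ... | true  = ⊥-elim (t tt)
  ... | false = ≡.refl

  labelWeight-≤1 : ∀ i → labelWeight i ≤ 1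
  labelWeight-≤1 i with lab i
  ... | true  = ℕₚ.≤-refl
  ... | false = z≤n

  labelSum : (Fin n → ℕ) → Word n → ℕ
  labelSum = weight labelWeight

  T? : ∀ b → Dec (T b)
  T? true  = yes tt
  T? false = no id

  *-labelled-≤ : ∀ {f g : Fin n → ℕ} → (∀ i → T (lab i) → f i ≤ g i) → ∀ i → labelWeight i ℕ.* f i ≤ labelWeight i ℕ.* g i
  *-labelled-≤ h i with lab i | h i
  ... | true  | p = ℕₚ.*-monoʳ-≤ 1 (p tt)
  ... | false | _ = z≤n

  labelSum-≤ : ∀ (f g : Fin n → ℕ) → (∀ i → T (lab i) → f i ≤ g i) →
    ΣN.sum (λ i → labelWeight i ℕ.* f i) ≤ ΣN.sum (λ i → labelWeight i ℕ.* g i)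
  labelSum-≤ f g h = sum-mono-≤ (*-labelled-≤ h)

  labelSum-< : ∀ (f g : Fin n → ℕ) → (∀ i → T (lab i) → f i ≤ g i) → ∀ i → T (lab i) → f i < g i →
    ΣN.sum (λ i → labelWeight i ℕ.* f i) < ΣN.sum (λ i → labelWeight i ℕ.* g i)
  labelSum-< f g h i t p = sum-mono-< (*-labelled-≤ h) i
    (subst (λ x → x ℕ.* f i < x ℕ.* g i) (≡.sym (labelWeight-lab t)) (ℕₚ.*-monoʳ-< 1 p))

  labelSum-≡ : ∀ (f g : Fin n → ℕ) → (∀ i → T (lab i) → f i ≡ g i) →
    ΣN.sum (λ i → labelWeight i ℕ.* f i) ≡ ΣN.sum (λ i → labelWeight i ℕ.* g i)
  labelSum-≡ f g h = ℕₚ.≤-antisym (labelSum-≤ f g (λ i t → ℕₚ.≤-reflexive (h i t)))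
                                  (labelSum-≤ g f (λ i t → ℕₚ.≤-reflexive (≡.sym (h i t))))

-- Repeated terms as natural multiples

module Counting {c ℓ : Level} (K : Char0Field c ℓ) where
  open Signs K
  open F using (Carrier; _≈_; _+_; _*_; -_; 0#; 1#)

  countFin : ∀ {n} → (Fin n → Bool) → ℕ
  countFin p = ΣN.sum (λ i → if p i then 1 else 0)

  module _ {v ℓv : Level} (V : LeftModule F.ring v ℓv) where
    open Module V
    open SetoidReasoning ≈ᴹ-setoid

    nat-suc : ∀ q v → nat (suc q) *ₗ v ≈ᴹ v +ᴹ nat q *ₗ v
    nat-suc q v = ≈ᴹ-trans (*ₗ-distribʳ v 1# (nat q)) (+ᴹ-congʳ (*ₗ-identityˡ v))

    sum-when : ∀ {n} (p : Fin n → Bool) v → sum (λ i → v when p i) ≈ᴹ nat (countFin p) *ₗ v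
    sum-when {zero}  p v = ≈ᴹ-sym (*ₗ-zeroˡ v)
    sum-when {suc n} p v with p zero
    ... | true  = ≈ᴹ-trans (+ᴹ-congˡ (sum-when (p ∘ suc) v)) (≈ᴹ-sym (nat-suc (countFin (p ∘ suc)) v))
    ... | false = ≈ᴹ-trans (+ᴹ-identityˡ _) (sum-when (p ∘ suc) v)

    ∑-when : ∀ {A : Set} (p : A → Bool) xs v → ∑ xs (λ x → v when p x) ≈ᴹ nat (countB p xs) *ₗ v
    ∑-when p []       v = ≈ᴹ-sym (*ₗ-zeroˡ v)
    ∑-when p (x ∷ xs) v with p x
    ... | true  = ≈ᴹ-trans (+ᴹ-congˡ (∑-when p xs v)) (≈ᴹ-sym (nat-suc (countB p xs) v))
    ... | false = ≈ᴹ-trans (+ᴹ-identityˡ _) (∑-when p xs v)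

    sum-*ₗ : ∀ {n} (s : Fin n → Carrier) v → sum (λ i → s i *ₗ v) ≈ᴹ Module.sum scalars s *ₗ v
    sum-*ₗ {zero}  s v = ≈ᴹ-sym (*ₗ-zeroˡ v)
    sum-*ₗ {suc n} s v = ≈ᴹ-trans (+ᴹ-congˡ (sum-*ₗ (s ∘ suc) v)) (≈ᴹ-sym (*ₗ-distribʳ v (s zero) _))

  countB-positive : ∀ {A : Set} (p : A → Bool) {x xs} → x ∈ xs → T (p x) → ∃[ q ] countB p xs ≡ suc q
  countB-positive p {x} {xs} x∈xs t with boolFilter p xs | ∈-boolFilter⁺ p x∈xs t
  ... | _ ∷ ys | _ = length ys , ≡.refl

-- Moving labels to the left

module Exchange {c ℓ : Level} (K : Char0Field c ℓ) {n : ℕ} (k : ℕ) (col target : Fin n → ℕ) where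
  open Signs K
  open Counting K
  open Labels {n} k
  open F using (Carrier; _≈_; _+_; _*_; -_; 0#; 1#)

  total : Word n → ℕ
  total = labelSum col

  -- What the descent uses of the antisymmetrized φ, where `target i` is the column in which label i
  -- belongs. It is kept abstract to cover both words of length n modulo the two ideals and
  -- permutations of D_μ.
  record Exchangeable {v ℓv : Level} (V : LeftModule F.ring v ℓv) (Φ : Word n → LeftModule.Carrierᴹ V) : Set (c ⊔ ℓ ⊔ v ⊔ ℓv) where
    open Module V
    field
      alternating : ∀ w → Inj w → ∀ i i′ → T (lab i) → T (lab i′) → i ≢ i′ → target i ≡ target i′ →
        Φ (w ∙ tr i i′) ≈ᴹ -ᴹ Φ w
      exchanges : ∀ w → Inj w → ∀ i → T (lab i) → ∀ {j} → j < col (lookup w i) →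
        Φ w ≈ᴹ sum (λ i′ → Φ (w ∙ tr i′ i) when (col (lookup w i′) ≡ᵇ j))

  Bad : Word n → Fin n → Set
  Bad w i = T (lab i) × target i < col (lookup w i)

  Bad? : ∀ w i → Dec (Bad w i)
  Bad? w i = T? (lab i) ×-dec (target i ℕ.<? col (lookup w i))

  bound : ℕ
  bound = ΣN.sum target

  target≤bound : ∀ i → target i ≤ bound
  target≤bound = go target
    where
    go : ∀ {n} (f : Fin n → ℕ) i → f i ≤ ΣN.sum f
    go f zero    = ℕₚ.m≤m+n _ _
    go f (suc i) = ℕₚ.≤-trans (go (f ∘ suc) i) (ℕₚ.m≤n+m _ (f zero))

  -- Labels that belong further to the left weigh more, so each exchange decreases the potential.
  leftness : Fin n → ℕ
  leftness i = if lab i then suc bound ∸ target i else 0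

  potential : Word n → ℕ
  potential = weight leftness col

  -- The bad label i with the leftmost target is exchanged with the entries of column `target i`. A
  -- twin in that column belongs there as well, and its exchange returns minus Φ w by antisymmetry.
  -- All other exchanges make progress.
  module Step (w : Word n) (w-inj : Inj w) (i : Fin n) (bad : Bad w i)
    (minimal : ∀ i′ → Bad w i′ → target i ≤ target i′) where

    inCol twin keep : Fin n → Bool
    inCol i′ = col (lookup w i′) ≡ᵇ target i
    twin i′  = inCol i′ ∧ (lab i′ ∧ (target i′ ≡ᵇ target i))
    keep i′  = inCol i′ ∧ not (lab i′ ∧ (target i′ ≡ᵇ target i))

    T-∧ : ∀ {a b} → T (a ∧ b) → T a × T b
    T-∧ {true} t = tt , t

    keep-col : ∀ {i′} → T (keep i′) → col (lookup w i′) < col (lookup w i)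
    keep-col {i′} t = subst (_< col (lookup w i))
      (≡.sym (ℕₚ.≡ᵇ⇒≡ _ _ (proj₁ (T-∧ {inCol i′} t)))) (proj₂ bad)

    leftness-lab : ∀ {i′} → T (lab i′) → leftness i′ ≡ suc bound ∸ target i′
    leftness-lab {i′} t with lab i′
    ... | true = ≡.refl

    keep-leftness : ∀ {i′} → T (keep i′) → leftness i′ < leftness i
    keep-leftness {i′} t rewrite leftness-lab (proj₁ bad)
      with lab i′ in eq | T-∧ {inCol i′} t
    -- The `suc bound` in `leftness` makes every label heavier than an unlabelled position, whose
    -- weight is 0.
    ... | false | _ = ℕₚ.m<n⇒0<n∸m (s≤s (target≤bound i))
    ... | true  | in-col , different = ℕₚ.∸-monoʳ-< i<i′ (ℕₚ.m≤n⇒m≤1+n (target≤bound i′))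
      where
      i<i′ : target i < target i′
      i<i′ with ℕₚ.<-cmp (target i) (target i′)
      ... | tri< p _ _ = p
      ... | tri≈ _ e _ with target i′ ≡ᵇ target i | ℕₚ.≡⇒≡ᵇ _ _ (≡.sym e)
      ...   | true | _ = ⊥-elim different
      -- A label in column `target i` that belongs further to the left is bad itself, against the
      -- choice of i.
      i<i′ | tri> _ _ p = contradiction p (ℕₚ.≤⇒≯ (minimal i′
        (subst T (≡.sym eq) tt , subst (target i′ <_) (≡.sym (ℕₚ.≡ᵇ⇒≡ _ _ in-col)) p)))

    keep-potential : ∀ {i′} → T (keep i′) → potential (w ∙ tr i′ i) < potential w
    keep-potential {i′} t = weight-swap-< leftness col w {i} {i′} (keep-col {i′} t) (keep-leftness {i′} t)

    keep-total : ∀ {i′} → T (keep i′) → total (w ∙ tr i′ i) ≤ total w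
    keep-total {i′} t = weight-swap-≤ labelWeight col w {i} {i′} (keep-col {i′} t)
      (subst (labelWeight i′ ≤_) (≡.sym (labelWeight-lab (proj₁ bad))) (labelWeight-≤1 i′))

    -- The terms of the twins, moved to the left side, only raise the coefficient of Φ w, which
    -- stays a positive integer and hence invertible.
    step : ∀ {v ℓv} (V : LeftModule F.ring v ℓv) → let open Module V in ∀ Φ → Exchangeable V Φ →
      nat (suc (countFin twin)) *ₗ Φ w ≈ᴹ sum (λ i′ → Φ (w ∙ tr i′ i) when keep i′)
    step V Φ ex = begin
      nat (suc (countFin twin)) *ₗ Φ w
        ≈⟨ nat-suc V (countFin twin) (Φ w) ⟩
      Φ w +ᴹ nat (countFin twin) *ₗ Φ w
        ≈⟨ +ᴹ-congˡ (sum-when V twin (Φ w)) ⟨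
      Φ w +ᴹ sum (λ i′ → Φ w when twin i′)
        ≈⟨ +ᴹ-congʳ (exchanges w w-inj i (proj₁ bad) (proj₂ bad)) ⟩
      sum (λ i′ → Φ (w ∙ tr i′ i) when inCol i′) +ᴹ sum (λ i′ → Φ w when twin i′)
        ≈⟨ ∑-distrib-+ (λ i′ → Φ (w ∙ tr i′ i) when inCol i′) _ ⟨
      sum (λ i′ → (Φ (w ∙ tr i′ i) when inCol i′) +ᴹ (Φ w when twin i′))
        ≈⟨ sum-cong-≋ cancel ⟩
      sum (λ i′ → Φ (w ∙ tr i′ i) when keep i′) ∎
      where
      open Module V
      open SetoidReasoning ≈ᴹ-setoid
      open Exchangeable ex
      cancel : ∀ i′ → (Φ (w ∙ tr i′ i) when inCol i′) +ᴹ (Φ w when twin i′) ≈ᴹ Φ (w ∙ tr i′ i) when keep i′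
      cancel i′ with inCol i′ in eq₁ | lab i′ in eq₂ | target i′ ≡ᵇ target i in eq₃
      ... | false | _     | _     = +ᴹ-identityʳ _
      ... | true  | false | _     = +ᴹ-identityʳ _
      ... | true  | true  | false = +ᴹ-identityʳ _
      ... | true  | true  | true  = ≈ᴹ-trans
        (+ᴹ-congʳ (alternating w w-inj i′ i (subst T (≡.sym eq₂) tt) (proj₁ bad) i′≢i
          (ℕₚ.≡ᵇ⇒≡ _ _ (subst T (≡.sym eq₃) tt))))
        (-ᴹ‿inverseˡ _)
        where
        i′≢i : i′ ≢ i
        i′≢i e = ℕₚ.<⇒≢ (proj₂ bad) (≡.trans
          (≡.sym (ℕₚ.≡ᵇ⇒≡ _ _ (subst T (≡.sym eq₁) tt))) (cong (col ∘ lookup w) e))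

  module _ {v ℓv : Level} (V : LeftModule F.ring v ℓv) where
    open Module V

    -- Induction on the potential: every remaining exchange lowers it and does not raise the column
    -- total, so the bound N persists down to the words without bad labels.
    vanish-left : ∀ (Φ : Word n → Carrierᴹ) → Exchangeable V Φ → ∀ N →
      (∀ w → Inj w → (∀ i → T (lab i) → col (lookup w i) ≤ target i) → total w < N → Φ w ≈ᴹ 0ᴹ) →
      ∀ w → Inj w → total w < N → Φ w ≈ᴹ 0ᴹ
    vanish-left Φ ex N base w = <-rec Goal induct (potential w) w ≡.refl
      where
      Goal : ℕ → Set ℓv
      Goal p = ∀ w → potential w ≡ p → Inj w → total w < N → Φ w ≈ᴹ 0ᴹ
      induct : ∀ p → (∀ {q} → q < p → Goal q) → Goal p
      induct p rec w ≡.refl w-inj t with any? (Bad? w)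
      ... | no none = base w w-inj (λ i l → ℕₚ.≮⇒≥ λ lt → none (i , l , lt)) t
      ... | yes found with minimize (Bad? w) target found
      ...   | i , bad , minimal = cancel-scalar (nat≉0 (countFin twin)) (≈ᴹ-trans (step V Φ ex) (sum-0 vanish))
        where
        open Step w w-inj i bad minimal
        vanish : ∀ i′ → Φ (w ∙ tr i′ i) when keep i′ ≈ᴹ 0ᴹ
        vanish i′ with keep i′ in eq
        ... | false = ≈ᴹ-refl
        ... | true  = rec (keep-potential {i′} kept) _ ≡.refl (Inj-∙ w-inj (Inj-tr i′ i))
                          (ℕₚ.≤-<-trans (keep-total {i′} kept) t)
          where
          kept : T (keep i′)
          kept = subst T (≡.sym eq) tt

-- The multiple does not depend on the module, which lets a multiple computed for the shape mu
-- alone be used for any larger shape.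
module Multiples {c ℓ : Level} (K : Char0Field c ℓ) (v ℓv : Level) {k : ℕ} (col : Fin k → ℕ) where
  open Signs K
  open Counting K
  open Labels {k} k
  open F using (Carrier; _≈_; _+_; _*_; -_; 0#; 1#)
  open Exchange K k col col

  all-labelled : ∀ i → T (lab i)
  all-labelled i = ℕₚ.<⇒<ᵇ (Finₚ.toℕ<n i)

  IsMultiple : (∀ (V : LeftModule F.ring v ℓv) (Φ : Word k → LeftModule.Carrierᴹ V) → LeftModule.Carrierᴹ V) → Set _
  IsMultiple x = Σ Carrier λ s → ∀ (V : LeftModule F.ring v ℓv) Φ → Exchangeable V Φ →
    LeftModule._≈ᴹ_ V (x V Φ) (LeftModule._*ₗ_ V s (Φ identityW))

  -- The descent of `vanish-left`, now keeping track of the scalars. All k positions are labels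
  -- here, so a word without bad labels preserves columns and contributes its sign.
  multiple : ∀ w → Inj w → IsMultiple (λ V Φ → Φ w)
  multiple w = <-rec Goal induct (potential w) w ≡.refl
    where
    Goal : ℕ → Set _
    Goal p = ∀ w → potential w ≡ p → Inj w → IsMultiple (λ V Φ → Φ w)
    induct : ∀ p → (∀ {q} → q < p → Goal q) → Goal p
    induct p rec w ≡.refl w-inj with any? (Bad? w)
    ... | no none = sgn w , λ V Φ ex → sign-extension V col Φ
      (λ g g-inj _ i j i≢j e → Exchangeable.alternating ex g g-inj i j (all-labelled i) (all-labelled j) i≢j e)
      w w-inj (Preserves-≤ col w-inj λ i → ℕₚ.≮⇒≥ λ lt → none (i , all-labelled i , lt))
    ... | yes found with minimize (Bad? w) col found
    ...   | i , bad , minimal = s * Module.sum scalars (λ i′ → proj₁ (summand i′)) , λ V Φ ex →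
      let open Module V
          open SetoidReasoning ≈ᴹ-setoid
      in begin
        Φ w
          ≈⟨ *ₗ-identityˡ _ ⟨
        1# *ₗ Φ w
          ≈⟨ *ₗ-congʳ (F.trans (F.*-comm s _) sN≈1) ⟨
        (s * nat (suc (countFin twin))) *ₗ Φ w
          ≈⟨ *ₗ-assoc s _ _ ⟩
        s *ₗ (nat (suc (countFin twin)) *ₗ Φ w)
          ≈⟨ *ₗ-congˡ (step V Φ ex) ⟩
        s *ₗ sum (λ i′ → Φ (w ∙ tr i′ i) when keep i′)
          ≈⟨ *ₗ-congˡ (sum-cong-≋ λ i′ → proj₂ (summand i′) V Φ ex) ⟩
        s *ₗ sum (λ i′ → proj₁ (summand i′) *ₗ Φ identityW)
          ≈⟨ *ₗ-congˡ (sum-*ₗ V {k} (λ i′ → proj₁ (summand i′)) _) ⟩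
        s *ₗ (Module.sum scalars (λ i′ → proj₁ (summand i′)) *ₗ Φ identityW)
          ≈⟨ *ₗ-assoc s _ _ ⟨
        (s * Module.sum scalars (λ i′ → proj₁ (summand i′))) *ₗ Φ identityW ∎
      where
      open Step w w-inj i bad minimal
      inverted-count : ∃[ s ] nat (suc (countFin twin)) * s ≈ 1#
      inverted-count = F.inverse _ (Module.nat≉0 scalars (countFin twin))
      s = proj₁ inverted-count
      sN≈1 = proj₂ inverted-count
      summand : ∀ i′ → IsMultiple (λ V Φ → Module._when_ V (Φ (w ∙ tr i′ i)) (keep i′))
      summand i′ with keep i′ in eq
      ... | false = 0# , λ V Φ ex → LeftModule.≈ᴹ-sym V (LeftModule.*ₗ-zeroˡ V _)
      ... | true  = rec (keep-potential {i′} (subst T (≡.sym eq) tt)) _ ≡.refl (Inj-∙ w-inj (Inj-tr i′ i))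


-- Straightening: arranging the labels in the shape of a partition

module Straighten {c ℓ : Level} (K : Char0Field c ℓ) {n : ℕ} (D : Diagram n) (k : ℕ) (target : Fin n → ℕ)
  {v ℓv : Level} (V : LeftModule (Char0Field.ring K) v ℓv) (f : Word n → LeftModule.Carrierᴹ V) where
  open Signs K
  open Counting K
  open Labels {n} k
  open F using (Carrier; _≈_; _+_; _*_; -_; 0#; 1#)
  open Diagram D
  open Young K D
  open Relations V f
  open Module V
  open SetoidReasoning ≈ᴹ-setoid

  total : Word n → ℕ
  total = labelSum col

  record WeaklyLeft (w : Word n) : Set where
    constructor weaklyLeft
    field toTheLeft : ∀ i → T (lab i) → col (lookup w i) ≤ target i
  open WeaklyLeft public

  -- Together the two conditions say that the labelled boxes form an order ideal, that is, the
  -- diagram of a partition δ as in condition (2) of 𝒢.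
  ClosedUp ClosedLeft : Word n → Set
  ClosedUp w = ∀ i i′ → T (lab i′) → col (lookup w i) ≡ col (lookup w i′) →
    suc (row (lookup w i)) ≡ row (lookup w i′) → T (lab i)
  ClosedLeft w = ∀ i i′ → T (lab i′) → row (lookup w i) ≡ row (lookup w i′) →
    suc (col (lookup w i)) ≡ col (lookup w i′) → T (lab i)

  -- The Garnir set of a cell (r , suc j): the part of column j from row r downwards together with
  -- the part of column suc j down to row r.
  module GarnirSet (r j : ℕ) (corner : Fin n) (corner-row : row corner ≡ r) (corner-col : col corner ≡ suc j) where

    Member : Fin n → Set
    Member x = (col x ≡ j × r ≤ row x) ⊎ (col x ≡ suc j × row x ≤ r)

    Member? : ∀ x → Dec (Member x)
    Member? x = ((col x ℕ.≟ j) ×-dec (r ℕ.≤? row x)) ⊎-dec ((col x ℕ.≟ suc j) ×-dec (row x ℕ.≤? r))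

    E : Fin n → Bool
    E x = does (Member? x)

    module _ {τ : Word n} (τ-inj : Inj τ) (τ-pres : Preserves col τ) where

      -- Replaces a member by the member that lies in the row to which τ sends it; the corner is
      -- never attained, so two members land in the same row.
      Landing : Fin n → Fin n → Set
      Landing x b = (Member x × row b ≡ row (lookup τ x) × ((row b < r × col b ≡ suc j) ⊎ (r ≤ row b × col b ≡ j)))
                  ⊎ (¬ Member x × b ≡ x)

      at-j : ∀ x → Member x → ∃[ b ] (row b ≡ row (lookup τ x) × col b ≡ j)
      at-j x (inj₁ (e , _)) = lookup τ x , ≡.refl , ≡.trans (τ-pres .preserves x) e
      at-j x (inj₂ (e , _)) = left (lookup τ x)
        (subst (j <_) (≡.sym (≡.trans (τ-pres .preserves x) e)) ℕₚ.≤-refl)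

      landing : ∀ x → ∃ (Landing x)
      landing x with Member? x
      ... | no ¬p = x , inj₂ (¬p , ≡.refl)
      ... | yes p with row (lookup τ x) ℕ.<? r
      ...   | yes lt = let b , rb , cb = up corner (subst (row (lookup τ x) <_) (≡.sym corner-row) lt) in
        b , inj₁ (p , rb , inj₁ (subst (_< r) (≡.sym rb) lt , ≡.trans cb corner-col))
      ...   | no ¬lt = let b , rb , cb = at-j x p in
        b , inj₁ (p , rb , inj₂ (subst (r ≤_) (≡.sym rb) (ℕₚ.≮⇒≥ ¬lt) , cb))

      landing-member : ∀ {x b} → Landing x b → Member x → Member b
      landing-member (inj₁ (_ , _ , inj₁ (lt , e))) _ = inj₂ (e , ℕₚ.<⇒≤ lt)
      landing-member (inj₁ (_ , _ , inj₂ (le , e))) _ = inj₁ (e , le)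
      landing-member (inj₂ (¬p , _)) p = contradiction p ¬p

      not-corner : ∀ {x b} → Landing x b → b ≢ corner
      not-corner (inj₁ (_ , _ , inj₁ (lt , _))) ≡.refl = ℕₚ.<⇒≢ lt corner-row
      not-corner (inj₁ (_ , _ , inj₂ (_ , e))) ≡.refl = ℕₚ.<⇒≢ (ℕₚ.n<1+n j) (≡.trans (≡.sym e) corner-col)
      not-corner (inj₂ (¬p , ≡.refl)) ≡.refl = ¬p (inj₂ (corner-col , ℕₚ.≤-reflexive corner-row))

      Collision : Fin n → Fin n → Set
      Collision x y = Member x × Member y × x ≢ y × row (lookup τ x) ≡ row (lookup τ y)

      collision : ∃₂ Collision
      collision with any? (λ x → any? (λ y →
        Member? x ×-dec Member? y ×-dec ¬? (x ≟ y) ×-dec (row (lookup τ x) ℕ.≟ row (lookup τ y))))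
      ... | yes found = found
      ... | no none = contradiction (proj₂ hit) (not-corner (proj₂ (landing (proj₁ hit))))
        where
        separate : ∀ {x y b} → Landing x b → Landing y b → x ≡ y
        separate {x} {y} (inj₁ (p , rx , _)) (inj₁ (q , ry , _)) with x ≟ y
        ... | yes e = e
        ... | no ¬e = contradiction (x , y , p , q , ¬e , ≡.trans (≡.sym rx) ry) none
        separate l@(inj₁ (p , _)) (inj₂ (¬q , ≡.refl)) = contradiction (landing-member l p) ¬q
        separate (inj₂ (¬p , ≡.refl)) l@(inj₁ (q , _)) = contradiction (landing-member l q) ¬p
        separate (inj₂ (_ , e)) (inj₂ (_ , e′)) = ≡.trans (≡.sym e) e′
        hit : ∃[ x ] proj₁ (landing x) ≡ corner
        hit = injective⇒surjective (λ x → proj₁ (landing x))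
          (λ x y e → separate (proj₂ (landing x)) (subst (Landing y) (≡.sym e) (proj₂ (landing y)))) corner

    E-collide : ∀ τ → Inj τ → Preserves col τ →
      ∃₂ λ x y → T (E x) × T (E y) × x ≢ y × row (lookup τ x) ≡ row (lookup τ y)
    E-collide τ τ-inj τ-pres with collision τ-inj τ-pres
    ... | x , y , p , q , x≢y , e = x , y , does-complete (Member? x) p , does-complete (Member? y) q , x≢y , e

    module _ (w : Word n) (w-inj : Inj w) (closedUp : ClosedUp w)
      {i i′ : Fin n} (lab-i′ : T (lab i′)) (wi′ : lookup w i′ ≡ corner)
      (unlab-i : ¬ T (lab i)) (wi-row : row (lookup w i) ≡ r) (wi-col : col (lookup w i) ≡ j) where

      above : ∀ d b → T (lab b) → ∀ a → col (lookup w a) ≡ col (lookup w b) →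
        d ℕ.+ row (lookup w a) ≡ row (lookup w b) → T (lab a)
      above zero    b t a e e′ = subst (T ∘ lab) (≡.sym (w-inj .injective a b (determined e′ e))) t
      above (suc d) b t a e e′ with up (lookup w b) (ℕₚ.≤-reflexive e′)
      ... | z , rz , cz = above d (preimage w z)
        (closedUp (preimage w z) b t (≡.trans (cong col wp≡z) cz)
          (≡.trans (cong suc (≡.trans (cong row wp≡z) rz)) e′))
        a (≡.trans e (≡.trans (≡.sym cz) (cong col (≡.sym wp≡z)))) (≡.trans (≡.sym rz) (cong row (≡.sym wp≡z)))
        where
        wp≡z : lookup w (preimage w z) ≡ z
        wp≡z = lookup-preimage w-inj z

      -- A label in the part of the Garnir set in column j would force, by upward closure, a label
      -- onto the unlabelled box (r , j).
      labelled-member : ∀ h → T (lab h) → Member (lookup w h) → col (lookup w h) ≡ suc j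
      labelled-member h t (inj₂ (e , _))  = e
      labelled-member h t (inj₁ (e , le)) = contradiction
        (above (row (lookup w h) ∸ r) h t i (≡.trans wi-col (≡.sym e))
          (≡.trans (cong (row (lookup w h) ∸ r ℕ.+_) wi-row) (ℕₚ.m∸n+n≡m le)))
        unlab-i

      -- These boxes lie above the labelled corner or are the corner. So the labels in the Garnir
      -- set fill exactly its part in column suc j, and a permutation of the set can move them only
      -- to the left.
      right-member-labelled : ∀ h → col (lookup w h) ≡ suc j → row (lookup w h) ≤ r → T (lab h)
      right-member-labelled h e le = above (r ∸ row (lookup w h)) i′ lab-i′ h
        (≡.trans e (≡.trans (≡.sym corner-col) (cong col (≡.sym wi′))))
        (≡.trans (ℕₚ.m∸n+n≡m le) (≡.trans (≡.sym corner-row) (cong row (≡.sym wi′))))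

      module _ {g : Word n} (g∈ : g ∈ grp E) where

        member-col : ∀ {x} → Member x → j ≤ col x × col x ≤ suc j
        member-col (inj₁ (e , _)) = ℕₚ.≤-reflexive (≡.sym e) , ℕₚ.≤-trans (ℕₚ.≤-reflexive e) (ℕₚ.n≤1+n j)
        member-col (inj₂ (e , _)) = ℕₚ.≤-trans (ℕₚ.n≤1+n j) (ℕₚ.≤-reflexive (≡.sym e)) , ℕₚ.≤-reflexive e

        g-inj : Inj g
        g-inj = proj₁ (∈-grp⁻ E g∈)

        g-fixes : ∀ x → ¬ Member x → lookup g x ≡ x
        g-fixes x ¬p = proj₂ (∈-grp⁻ E g∈) x (¬p ∘ does-sound (Member? x))

        g-member : ∀ x → Member x → Member (lookup g x)
        g-member x p = does-sound (Member? (lookup g x)) (grp-stable E g∈ x (does-complete (Member? x) p))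

        moves-left : ∀ h → T (lab h) → col (lookup (g ∙ w) h) ≤ col (lookup w h)
        moves-left h t rewrite lookup-∙ g w h with Member? (lookup w h)
        ... | no ¬p = ℕₚ.≤-reflexive (cong col (g-fixes _ ¬p))
        ... | yes p = subst (col (lookup g (lookup w h)) ≤_) (≡.sym (labelled-member h t p))
          (proj₂ (member-col (g-member _ p)))

        -- If no label moved strictly to the left, the part in column suc j would keep its column,
        -- and the part in column j cannot move left within the set. Then g decreases no column and
        -- therefore preserves them all.
        strictly-left : ¬ Preserves col g → ∃[ h ] (T (lab h) × col (lookup (g ∙ w) h) < col (lookup w h))
        strictly-left ¬pres with any? (λ h → T? (lab h) ×-dec (col (lookup (g ∙ w) h) ℕ.<? col (lookup w h)))
        ... | yes found = found
        ... | no none = contradiction (Preserves-≥ col g-inj nondecreasing) ¬pres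
          where
          nondecreasing : ∀ x → col x ≤ col (lookup g x)
          nondecreasing x with Member? x
          ... | no ¬p = ℕₚ.≤-reflexive (cong col (≡.sym (g-fixes x ¬p)))
          ... | yes p@(inj₁ (e , _)) = subst (_≤ col (lookup g x)) (≡.sym e) (proj₁ (member-col (g-member x p)))
          ... | yes (inj₂ (e , le)) = subst (λ z → col z ≤ col (lookup g z)) wh≡x
            (subst (λ z → col (lookup w h) ≤ col z) (lookup-∙ g w h)
              (ℕₚ.≮⇒≥ λ lt → none (h , right-member-labelled h (≡.trans (cong col wh≡x) e)
                                         (subst (_≤ r) (≡.sym (cong row wh≡x)) le) , lt)))
            where
            h = preimage w x
            wh≡x : lookup w h ≡ x
            wh≡x = lookup-preimage w-inj x

  -- Lexicographic induction on the column total and the row total of the labels. A gap above a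
  -- label is closed by a column transposition at the price of a sign: the column total stays and
  -- the row total drops. Once there is no such gap, a gap to the left of a label is treated by the
  -- Garnir relation, whose new terms have a smaller column total.
  straighten : ∀ N →
    (∀ w → Inj w → WeaklyLeft w → total w < N → ClosedUp w → ClosedLeft w → φ w ≈ᴹ 0ᴹ) →
    ∀ w → Inj w → WeaklyLeft w → total w < N → φ w ≈ᴹ 0ᴹ
  straighten N base w = <-rec Outer outer (total w) _ w ≡.refl ≡.refl
    where
    Inner : ℕ → ℕ → Set ℓv
    Inner t r = ∀ w → total w ≡ t → labelSum row w ≡ r → Inj w → WeaklyLeft w → total w < N → φ w ≈ᴹ 0ᴹ
    Outer : ℕ → Set ℓv
    Outer t = ∀ r → Inner t r
    outer : ∀ t → (∀ {t′} → t′ < t → Outer t′) → Outer t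
    outer t smaller-total r = <-rec (Inner t) inner r
      where
      inner : ∀ r → (∀ {r′} → r′ < r → Inner t r′) → Inner t r
      inner r smaller-rows w ≡.refl ≡.refl w-inj w-left w-total
        with any? (λ i → any? (λ i′ → ¬? (T? (lab i)) ×-dec T? (lab i′) ×-dec
               (col (lookup w i) ℕ.≟ col (lookup w i′)) ×-dec (suc (row (lookup w i)) ℕ.≟ row (lookup w i′))))
      ... | yes (i , i′ , ¬t , t , e , e′) = begin
        φ w             ≈⟨ -ᴹ-involutive _ ⟨
        -ᴹ (-ᴹ φ w)     ≈⟨ -ᴹ‿cong (φ-col w e wi≢wi′) ⟨
        -ᴹ φ (g ∙ w)    ≡⟨ cong (λ z → -ᴹ φ z) (tr-conj w-inj i i′) ⟨
        -ᴹ φ (w ∙ tr i i′) ≈⟨ -ᴹ‿cong (smaller-rows rows-decrease (w ∙ tr i i′) same-total ≡.refl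
                               (Inj-∙ w-inj (Inj-tr i i′)) left′ (subst (_< N) (≡.sym same-total) w-total)) ⟩
        -ᴹ 0ᴹ           ≈⟨ -ᴹ0≈0 ⟩
        0ᴹ              ∎
        where
        g = tr (lookup w i) (lookup w i′)
        wi≢wi′ : lookup w i ≢ lookup w i′
        wi≢wi′ q = ℕₚ.<⇒≢ (ℕₚ.≤-reflexive e′) (cong row q)
        same-col : ∀ a → col (lookup (w ∙ tr i i′) a) ≡ col (lookup w a)
        same-col a = ≡.trans (cong (λ z → col (lookup z a)) (tr-conj w-inj i i′))
          (≡.trans (cong col (lookup-∙ g w a)) (Preserves-tr {col = col} e .preserves (lookup w a)))
        same-total : total (w ∙ tr i i′) ≡ total w
        same-total = labelSum-≡ _ _ (λ a _ → same-col a)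
        left′ : WeaklyLeft (w ∙ tr i i′)
        left′ .toTheLeft a s = subst (_≤ target a) (≡.sym (same-col a)) (w-left .toTheLeft a s)
        rows-decrease : labelSum row (w ∙ tr i i′) < labelSum row w
        rows-decrease = weight-swap-< labelWeight row w {i′} {i} (ℕₚ.≤-reflexive e′)
          (≡.subst₂ _<_ (≡.sym (labelWeight-unlab ¬t)) (≡.sym (labelWeight-lab t)) (s≤s z≤n))
      ... | no upwards
        with any? (λ i → any? (λ i′ → ¬? (T? (lab i)) ×-dec T? (lab i′) ×-dec
               (row (lookup w i) ℕ.≟ row (lookup w i′)) ×-dec (suc (col (lookup w i)) ℕ.≟ col (lookup w i′))))
      ... | no leftwards = base w w-inj w-left w-total closedUp closedLeft
        where
        closedUp : ClosedUp w
        closedUp i i′ t e e′ = decidable-stable (T? (lab i)) λ ¬t → upwards (i , i′ , ¬t , t , e , e′)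
        closedLeft : ClosedLeft w
        closedLeft i i′ t e e′ = decidable-stable (T? (lab i)) λ ¬t → leftwards (i , i′ , ¬t , t , e , e′)
      -- In the Garnir sum each column-preserving g returns φ w, since its sign enters twice, and
      -- every other g gives a term that vanishes by induction. The identity makes the number of the
      -- former positive.
      ... | yes (i , i′ , ¬t , t , e , e′) = cancel-scalar count≉0 (begin
        nat (countB preserving (grp E)) *ₗ φ w
          ≈⟨ ∑-when V preserving (grp E) (φ w) ⟨
        ∑ (grp E) (λ g → φ w when preserving g)
          ≈⟨ ∑-cong (grp E) reduce ⟨
        ∑ (grp E) (λ g → sgn g *ₗ φ (g ∙ w))
          ≈⟨ garnir E E-collide w ⟩
        0ᴹ ∎)
        where
        open GarnirSet (row (lookup w i)) (col (lookup w i)) (lookup w i′) (≡.sym e) (≡.sym e′)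
        closedUp : ClosedUp w
        closedUp i i′ t e e′ = decidable-stable (T? (lab i)) λ ¬t → upwards (i , i′ , ¬t , t , e , e′)
        preserving : Word n → Bool
        preserving g = does (Preserves? col g)
        count≉0 : ¬ (nat (countB preserving (grp E)) ≈ 0#)
        count≉0 with countB-positive preserving (id∈grp E) (does-complete (Preserves? col identityW) Preserves-id)
        ... | q , eq rewrite eq = nat≉0 q
        reduce : ∀ {g} → g ∈ grp E → sgn g *ₗ φ (g ∙ w) ≈ᴹ φ w when preserving g
        reduce {g} g∈ with Preserves? col g
        ... | yes g-pres = begin
          sgn g *ₗ φ (g ∙ w)         ≈⟨ *ₗ-congˡ (φ-sign g w (proj₁ (∈-grp⁻ E g∈)) g-pres) ⟩
          sgn g *ₗ (sgn g *ₗ φ w)    ≈⟨ *ₗ-assoc _ _ _ ⟨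
          (sgn g * sgn g) *ₗ φ w     ≈⟨ *ₗ-congʳ (Unit±-square (sgn-unit g)) ⟩
          1# *ₗ φ w                  ≈⟨ *ₗ-identityˡ _ ⟩
          φ w                        ∎
        ... | no ¬pres = ≈ᴹ-trans (*ₗ-congˡ (smaller-total total-decreases _ (g ∙ w) ≡.refl ≡.refl
                (Inj-∙ (proj₁ (∈-grp⁻ E g∈)) w-inj) left′ (ℕₚ.<-trans total-decreases w-total)))
              (*ₗ-zeroʳ _)
          where
          shift : ∀ h → T (lab h) → col (lookup (g ∙ w) h) ≤ col (lookup w h)
          shift = moves-left w w-inj closedUp {i} {i′} t ≡.refl ¬t ≡.refl ≡.refl g∈
          total-decreases : total (g ∙ w) < total w
          total-decreases with strictly-left w w-inj closedUp {i} {i′} t ≡.refl ¬t ≡.refl ≡.refl g∈ ¬pres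
          ... | h , s , lt = labelSum-< _ _ shift h s lt
          left′ : WeaklyLeft (g ∙ w)
          left′ .toTheLeft h s = ℕₚ.≤-trans (shift h s) (w-left .toTheLeft h s)


-- Integrality of the coefficients

∙-inv≡id⇒≡ : ∀ {m} {p q : Word m} → Inj q → p ∙ inv q ≡ identityW → q ≡ p
∙-inv≡id⇒≡ {p = p} {q} q-inj e = begin
  q                   ≡⟨ ∙-idˡ q ⟨
  identityW ∙ q       ≡⟨ cong (_∙ q) e ⟨
  (p ∙ inv q) ∙ q     ≡⟨ ∙-assoc p (inv q) q ⟩
  p ∙ (inv q ∙ q)     ≡⟨ cong (p ∙_) (∙-invˡ q-inj) ⟩
  p ∙ identityW       ≡⟨ ∙-idʳ p ⟩
  p                   ∎
  where open ≡.≡-Reasoning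

module Integrality {c ℓ : Level} (K : Char0Field c ℓ) where
  open Signs K
  open Counting K
  open F using (Carrier; _≈_; _+_; _*_; -_; 0#; 1#)
  open Module scalars using (∑; ev; ev-++; ev-cong; ev-cong∈; ev-mapped; ev-mulGA; ev-swap; ev-0; ∑-cong; nat≉0)

  -- The integers inside the field, as differences of natural numbers. Their squares are natural
  -- numbers, which takes the place of an order.
  IsInteger : Carrier → Set ℓ
  IsInteger x = ∃₂ λ a b → x + nat b ≈ nat a

  integer-+ : ∀ {x y} → IsInteger x → IsInteger y → IsInteger (x + y)
  integer-+ {x} {y} (a , b , p) (a′ , b′ , q) = a ℕ.+ a′ , b ℕ.+ b′ , (begin
    (x + y) + nat (b ℕ.+ b′)     ≈⟨ F.+-congˡ (nat-+ b b′) ⟩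
    (x + y) + (nat b + nat b′)   ≈⟨ +-interchange _ _ _ _ ⟩
    (x + nat b) + (y + nat b′)   ≈⟨ F.+-cong p q ⟩
    nat a + nat a′               ≈⟨ nat-+ a a′ ⟨
    nat (a ℕ.+ a′)               ∎)
    where open SetoidReasoning F.setoid

  integer-0 : ∀ {x} → x ≈ 0# → IsInteger x
  integer-0 e = 0 , 0 , F.trans (F.+-identityʳ _) e

  integer-unit : ∀ {x} → Unit± x → IsInteger x
  integer-unit (inj₁ e) = 1 , 0 , F.trans (F.+-identityʳ _) (F.trans e (F.sym (F.+-identityʳ _)))
  integer-unit (inj₂ e) = 0 , 1 , F.trans (F.+-cong e (F.+-identityʳ _)) (F.-‿inverseˡ 1#)

  square : ∀ {x} → IsInteger x → ∃[ d ] (x * x ≈ nat d × (d ≡ 0 → x ≈ 0#))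
  square {x} (a , b , p) with ℕₚ.≤-total b a
  ... | inj₁ b≤a = d ℕ.* d , F.trans (F.*-cong x≈d x≈d) (F.sym (nat-* d d)) , vanish
    where
    open SetoidReasoning F.setoid
    d = a ∸ b
    x≈d : x ≈ nat d
    x≈d = RingProperties.+-cancelʳ F.ring (nat b) x (nat d) (begin
      x + nat b       ≈⟨ p ⟩
      nat a           ≡⟨ cong nat (ℕₚ.m∸n+n≡m b≤a) ⟨
      nat (d ℕ.+ b)   ≈⟨ nat-+ d b ⟩
      nat d + nat b   ∎)
    vanish : d ℕ.* d ≡ 0 → x ≈ 0#
    vanish e with ℕₚ.m*n≡0⇒m≡0∨n≡0 d e
    ... | inj₁ z = F.trans x≈d (F.reflexive (cong nat z))
    ... | inj₂ z = F.trans x≈d (F.reflexive (cong nat z))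
  ... | inj₂ a≤b = d ℕ.* d , (begin
      x * x              ≈⟨ F.*-cong x≈-d x≈-d ⟩
      (- nat d) * (- nat d) ≈⟨ RingProperties.-‿distribˡ-* F.ring _ _ ⟨
      - (nat d * (- nat d)) ≈⟨ F.-‿cong (RingProperties.-‿distribʳ-* F.ring _ _) ⟨
      - (- (nat d * nat d)) ≈⟨ -‿involutive _ ⟩
      nat d * nat d      ≈⟨ nat-* d d ⟨
      nat (d ℕ.* d)      ∎) , vanish
    where
    open SetoidReasoning F.setoid
    d = b ∸ a
    x≈-d : x ≈ - nat d
    x≈-d = Module.-ᴹ-uniqueˡ scalars x (nat d) (RingProperties.+-cancelʳ F.ring (nat a) (x + nat d) 0# (begin
      (x + nat d) + nat a   ≈⟨ F.+-assoc x _ _ ⟩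
      x + (nat d + nat a)   ≈⟨ F.+-congˡ (nat-+ d a) ⟨
      x + nat (d ℕ.+ a)     ≡⟨ cong (λ z → x + nat z) (ℕₚ.m∸n+n≡m a≤b) ⟩
      x + nat b             ≈⟨ p ⟩
      nat a                 ≈⟨ F.+-identityˡ _ ⟨
      0# + nat a            ∎))
    -0≈ : ∀ {z} → z ≡ 0 → - nat z ≈ 0#
    -0≈ ≡.refl = Module.-ᴹ0≈0 scalars
    vanish : d ℕ.* d ≡ 0 → x ≈ 0#
    vanish e with ℕₚ.m*n≡0⇒m≡0∨n≡0 d e
    ... | inj₁ z = F.trans x≈-d (-0≈ z)
    ... | inj₂ z = F.trans x≈-d (-0≈ z)

  -- The squares are natural numbers, so by characteristic zero their sum is zero as a natural
  -- number, and then so is every summand.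
  sum-of-squares : ∀ {A : Set} (xs : List A) (y : A → Carrier) → (∀ x → IsInteger (y x)) →
    ∑ xs (λ x → y x * y x) ≈ 0# → ∀ {x} → x ∈ xs → y x ≈ 0#
  sum-of-squares {A} xs y y-int e = λ x∈ → each x∈ (F.char0 _ (F.trans (F.sym (total xs)) e))
    where
    d : A → ℕ
    d x = proj₁ (square (y-int x))
    listSum : List A → ℕ
    listSum []       = 0
    listSum (x ∷ xs) = d x ℕ.+ listSum xs
    total : ∀ xs → ∑ xs (λ x → y x * y x) ≈ nat (listSum xs)
    total []       = F.refl
    total (x ∷ xs) = F.trans (F.+-cong (proj₁ (proj₂ (square (y-int x)))) (total xs)) (F.sym (nat-+ (d x) _))
    each : ∀ {xs x} → x ∈ xs → listSum xs ≡ 0 → y x ≈ 0#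
    each {x ∷ xs} (here ≡.refl) z = proj₂ (proj₂ (square (y-int x))) (ℕₚ.m+n≡0⇒m≡0 (d x) z)
    each {x ∷ xs} (there q)     z = each q (ℕₚ.m+n≡0⇒n≡0 (d x) z)

  module _ {m : ℕ} where

    _≟ʷ_ : (v w : Word m) → Dec (v ≡ w)
    _≟ʷ_ = Vecₚ.≡-dec _≟_

    δ : Word m → Word m → Carrier
    δ v w = if does (v ≟ʷ w) then 1# else 0#

    coefficient : Tm m → Word m → Carrier
    coefficient x w = ev x (λ v → δ v w)

    δ-cong : ∀ {v w v′ w′ : Word m} → (v ≡ w → v′ ≡ w′) → (v′ ≡ w′ → v ≡ w) → δ v w ≈ δ v′ w′
    δ-cong {v} {w} {v′} {w′} f g with v ≟ʷ w | v′ ≟ʷ w′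
    ... | yes _ | yes _ = F.refl
    ... | no _  | no _  = F.refl
    ... | yes p | no q  = contradiction (f p) q
    ... | no p  | yes q = contradiction (g q) p

    ∑-δ : ∀ {xs : List (Word m)} → Unique xs → ∀ {v} → v ∈ xs → ∀ (f : Word m → Carrier) →
      ∑ xs (λ w → δ v w * f w) ≈ f v
    ∑-δ {x ∷ xs} (u ∷ us) {v} (here ≡.refl) f with v ≟ʷ v
    ... | no q  = contradiction ≡.refl q
    ... | yes _ = F.trans (F.+-cong (F.*-identityˡ _) (absent xs u)) (F.+-identityʳ _)
      where
      absent : ∀ ys → All (v ≢_) ys → ∑ ys (λ w → δ v w * f w) ≈ 0#
      absent []       _        = F.refl
      absent (y ∷ ys) (p ∷ ps) with v ≟ʷ y
      ... | yes e = contradiction e p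
      ... | no _  = F.trans (F.+-cong (F.zeroˡ _) (absent ys ps)) (F.+-identityʳ _)
    ∑-δ {x ∷ xs} (u ∷ us) {v} (there q) f with v ≟ʷ x
    ... | yes ≡.refl = contradiction ≡.refl (All.lookup u q)
    ... | no _  = F.trans (F.+-cong (F.zeroˡ _) (∑-δ us q f)) (F.+-identityˡ _)

    ev-∑ : ∀ {A B : Set} (x : List (Carrier × A)) (ws : List B) (g : A → B → Carrier) →
      ev x (λ v → ∑ ws (g v)) ≈ ∑ ws (λ w → ev x (λ v → g v w))
    ev-∑ x []       g = ev-0 x (λ _ → F.refl)
    ev-∑ x (w ∷ ws) g = F.trans (Module.ev-+ scalars x (λ v → g v w) _) (F.+-congˡ (ev-∑ x ws g))

    -- Collects repeated words, so that each word occurs once, with its true coefficient.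
    ev-expand : ∀ (x : Tm m) f → ev x f ≈ ∑ (words m) (λ w → coefficient x w * f w)
    ev-expand x f = begin
      ev x f
        ≈⟨ ev-cong x (λ v → ∑-δ (words-unique m) (∈-vecsOver m v) f) ⟨
      ev x (λ v → ∑ (words m) (λ w → δ v w * f w))
        ≈⟨ ev-∑ x (words m) _ ⟩
      ∑ (words m) (λ w → ev x (λ v → δ v w * f w))
        ≈⟨ ∑-cong (words m) (λ {w} _ → ev-scalar-* scalars x (λ v → δ v w) (f w)) ⟩
      ∑ (words m) (λ w → coefficient x w * f w) ∎
      where open SetoidReasoning F.setoid

    coefficient-integer : ∀ (x : Tm m) → (∀ {s v} → (s , v) ∈ x → Unit± s) → ∀ w → IsInteger (coefficient x w)
    coefficient-integer []            units w = integer-0 F.refl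
    coefficient-integer ((s , v) ∷ x) units w =
      integer-+ (head (does (v ≟ʷ w))) (coefficient-integer x (units ∘ there) w)
      where
      head : ∀ b → IsInteger (s * (if b then 1# else 0#))
      head false = integer-0 (F.zeroʳ s)
      head true  with integer-unit (units (here ≡.refl))
      ... | a , b , p = a , b , F.trans (F.+-congʳ (F.*-identityʳ s)) p

    -- By `ev-expand` the hypothesis says that the squares of the coefficients sum to zero.
    coefficients-vanish : ∀ (x : Tm m) → (∀ {s v} → (s , v) ∈ x → Unit± s) →
      ev x (coefficient x) ≈ 0# → ∀ w → coefficient x w ≈ 0#
    coefficients-vanish x units e w = sum-of-squares (words m) (coefficient x) (coefficient-integer x units)
      (F.trans (F.sym (ev-expand x (coefficient x))) e) (∈-vecsOver m w)

    star : GA m → GA m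
    star = List.map (λ q → proj₁ q , inv (proj₂ q))

    -- With c* the adjoint of c, the identity coefficients of (c c*)(c c*)* and of c c* are sums of
    -- squares of coefficients.
    ccc-vanish : ∀ (x : GA m) → (∀ {s v} → (s , v) ∈ x → Unit± s × Inj v) →
      (∀ f → ev x (λ p → ev (star x) (λ q → ev x (λ r → f (p ∙ (q ∙ r))))) ≈ 0#) → ∀ f → ev x f ≈ 0#
    ccc-vanish x items xxx f = F.trans (ev-expand x f) (∑-0 (words m))
      where
      open SetoidReasoning F.setoid
      y = mulGA x (star x)
      y-units : ∀ {s v} → (s , v) ∈ y → Unit± s
      y-units q with ∈-mulGA⁻ x (star x) q
      ... | _ , _ , p , r , ≡.refl with ∈ₚ.∈-map⁻ _ r
      ...   | _ , r′ , ≡.refl = Unit±-* (proj₁ (items p)) (proj₁ (items r′))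
      ev-y : ∀ g → ev y g ≈ ev x (λ p → ev x (λ q → g (p ∙ inv q)))
      ev-y g = F.trans (ev-mulGA x (star x) g) (ev-cong x (λ p → ev-mapped inv x (λ q → g (p ∙ q))))
      rearrange : ∀ p q r s → Inj q → Inj r → δ (p ∙ (inv q ∙ r)) s ≈ δ (s ∙ inv r) (p ∙ inv q)
      rearrange p q r s q-inj r-inj = δ-cong to from
        where
        to : p ∙ (inv q ∙ r) ≡ s → s ∙ inv r ≡ p ∙ inv q
        to ≡.refl = ≡.trans (∙-assoc p (inv q ∙ r) (inv r)) (cong (p ∙_)
          (≡.trans (∙-assoc (inv q) r (inv r)) (≡.trans (cong (inv q ∙_) (∙-invʳ r-inj)) (∙-idʳ (inv q)))))
        from : s ∙ inv r ≡ p ∙ inv q → p ∙ (inv q ∙ r) ≡ s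
        from e = ≡.trans (≡.sym (∙-assoc p (inv q) r)) (≡.trans (cong (_∙ r) (≡.sym e))
          (≡.trans (∙-assoc s (inv r) r) (≡.trans (cong (s ∙_) (∙-invˡ r-inj)) (∙-idʳ s))))
      -- The sum of the squares of the coefficients of y = x x*. Moving r across the equation s r⁻¹
      -- = p q⁻¹ turns it into the sum over p q⁻¹ r = s, an instance of `xxx`.
      yy : ev y (coefficient y) ≈ 0#
      yy = begin
        ev y (coefficient y)
          ≈⟨ ev-y (coefficient y) ⟩
        ev x (λ p → ev x (λ q → coefficient y (p ∙ inv q)))
          ≈⟨ ev-cong x (λ p → ev-cong x (λ q → ev-y (λ v → δ v (p ∙ inv q)))) ⟩
        ev x (λ p → ev x (λ q → ev x (λ s → ev x (λ r → δ (s ∙ inv r) (p ∙ inv q)))))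
          ≈⟨ ev-cong x (λ p → ev-cong x (λ q → ev-swap x x _)) ⟩
        ev x (λ p → ev x (λ q → ev x (λ r → ev x (λ s → δ (s ∙ inv r) (p ∙ inv q)))))
          ≈⟨ ev-cong x (λ p → ev-cong∈ x (λ {_} {q} q∈ → ev-cong∈ x (λ {_} {r} r∈ → ev-cong x (λ s →
               rearrange p q r s (proj₂ (items q∈)) (proj₂ (items r∈)))))) ⟨
        ev x (λ p → ev x (λ q → ev x (λ r → ev x (λ s → δ (p ∙ (inv q ∙ r)) s))))
          ≈⟨ ev-cong x (λ p → ev-mapped inv x (λ q → ev x (λ r → ev x (λ s → δ (p ∙ (q ∙ r)) s)))) ⟨
        ev x (λ p → ev (star x) (λ q → ev x (λ r → ev x (λ s → δ (p ∙ (q ∙ r)) s))))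
          ≈⟨ xxx (λ v → ev x (δ v)) ⟩
        0# ∎
      -- The sum of squares for x is the coefficient of the identity in y, which is already known to
      -- vanish.
      xx : ev x (coefficient x) ≈ 0#
      xx = begin
        ev x (λ p → ev x (λ q → δ q p))
          ≈⟨ ev-cong x (λ p → ev-cong∈ x (λ {_} {q} q∈ → at-id p q (proj₂ (items q∈)))) ⟩
        ev x (λ p → ev x (λ q → δ (p ∙ inv q) identityW))
          ≈⟨ ev-y (λ v → δ v identityW) ⟨
        coefficient y identityW
          ≈⟨ coefficients-vanish y y-units yy identityW ⟩
        0# ∎
        where
        at-id : ∀ p q → Inj q → δ q p ≈ δ (p ∙ inv q) identityW
        at-id p q q-inj = δ-cong (λ { ≡.refl → ∙-invʳ q-inj }) (∙-inv≡id⇒≡ q-inj)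
      ∑-0 : ∀ ws → ∑ ws (λ w → coefficient x w * f w) ≈ 0#
      ∑-0 []       = F.refl
      ∑-0 (w ∷ ws) = F.trans (F.+-cong
        (F.trans (F.*-congʳ (coefficients-vanish x (proj₁ ∘ items) xx w)) (F.zeroˡ _)) (∑-0 ws)) (F.+-identityˡ _)

-- The Young symmetrizer does not vanish

module NonVanishing {c ℓ : Level} (K : Char0Field c ℓ) {m : ℕ} (D : Diagram m) where
  open Signs K
  open Counting K
  open Integrality K
  open F using (Carrier; _≈_; _+_; _*_; -_; 0#; 1#)
  open Diagram D
  open Young K D

  rowcol-trivial : ∀ {σ} → Preserves row σ → Preserves col σ → σ ≡ identityW
  rowcol-trivial p q = lookup-ext λ a →
    ≡.trans (determined (p .preserves a) (q .preserves a)) (≡.sym (lookup-id a))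

  Preserves-cancel : ∀ {σ τ : Word m} → Inj τ → Preserves col τ → Preserves col (σ ∙ τ) → Preserves col σ
  Preserves-cancel {σ} {τ} τ-inj q p .preserves a = begin
    col (lookup σ a)                   ≡⟨ cong (col ∘ lookup σ) τb≡a ⟨
    col (lookup σ (lookup τ b))        ≡⟨ cong col (lookup-∙ σ τ b) ⟨
    col (lookup (σ ∙ τ) b)             ≡⟨ p .preserves b ⟩
    col b                              ≡⟨ q .preserves b ⟨
    col (lookup τ b)                   ≡⟨ cong col τb≡a ⟩
    col a                              ∎
    where
    open ≡.≡-Reasoning
    b = preimage τ a
    τb≡a = lookup-preimage τ-inj a

  module _ {v ℓv : Level} (V : LeftModule F.ring v ℓv) where
    open Module V

    -- Each element of colSum carries the coefficient sgn τ, and (sgn τ)² = 1.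
    colSum-sgn : ∀ v → ev colSum (λ τ → sgn τ *ₗ v) ≈ᴹ nat (length colSum) *ₗ v
    colSum-sgn v = go colSum colSum-items
      where
      go : ∀ x → (∀ {s τ} → (s , τ) ∈ x → s ≈ sgn τ × Inj τ × Preserves col τ) →
        ev x (λ τ → sgn τ *ₗ v) ≈ᴹ nat (length x) *ₗ v
      go []            _ = ≈ᴹ-sym (*ₗ-zeroˡ v)
      go ((s , τ) ∷ x) h = ≈ᴹ-trans
        (+ᴹ-cong (≈ᴹ-trans (≈ᴹ-sym (*ₗ-assoc s _ v)) (≈ᴹ-trans
          (*ₗ-congʳ (F.trans (F.*-congʳ (proj₁ (h (here ≡.refl)))) (Unit±-square (sgn-unit τ)))) (*ₗ-identityˡ v)))
          (go x (h ∘ there)))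
        (≈ᴹ-sym (nat-suc V (length x) v))

  colSum-nonempty : ∃[ q ] length colSum ≡ suc q
  colSum-nonempty with colSum | proj₂ id∈colSum
  ... | _ ∷ x | _ = length x , ≡.refl

  open Module scalars using (ev; ev-cong∈; ev-cong; ev-mulGA; ev-0; _when_; when-cong; when-false)

  -- A functional that detects the Young symmetrizer: the sign on the column group, zero elsewhere.
  colSign : Word m → Carrier
  colSign w = sgn w when does (Preserves? col w)

  -- A product ρ ∙ τ preserves columns only if ρ does, and a row permutation that does is the
  -- identity. What remains is the number of listed identities in `rowSum` times the sum of the
  -- squared signs over `colSum`.
  young-colSign : ∃[ q ] ev young colSign ≈ nat (suc q)
  young-colSign with countB-positive (λ ρ → does (Preserves? col ρ)) (∈ₚ.∈-map⁺ proj₂ (proj₂ id∈rowSum))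
                       (does-complete (Preserves? col identityW) Preserves-id) | colSum-nonempty
  -- The witness is the predecessor of the product of `suc q` and `suc l`.
  ... | q , eq | l , eq′ = l ℕ.+ q ℕ.* suc l , (begin
    ev young colSign
      ≈⟨ ev-mulGA rowSum colSum colSign ⟩
    ev rowSum (λ ρ → ev colSum (λ τ → colSign (ρ ∙ τ)))
      ≈⟨ ev-cong∈ rowSum (λ r → inner (rowSum-items r)) ⟩
    ev rowSum (λ ρ → nat (suc l) when does (Preserves? col ρ))
      ≈⟨ outer rowSum (proj₁ ∘ rowSum-items) ⟩
    nat (countB (λ ρ → does (Preserves? col ρ)) (List.map proj₂ rowSum)) * nat (suc l)
      ≡⟨ cong (λ z → nat z * nat (suc l)) eq ⟩
    nat (suc q) * nat (suc l)
      ≈⟨ nat-* (suc q) (suc l) ⟨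
    nat (suc l ℕ.+ q ℕ.* suc l) ∎)
    where
    open SetoidReasoning F.setoid
    colSign-pres : ∀ {τ} → Preserves col τ → colSign τ ≈ sgn τ
    colSign-pres {τ} p with Preserves? col τ
    ... | yes _ = F.refl
    ... | no ¬p = contradiction p ¬p
    inner : ∀ {s ρ} → s ≈ 1# × Inj ρ × Preserves row ρ →
      ev colSum (λ τ → colSign (ρ ∙ τ)) ≈ nat (suc l) when does (Preserves? col ρ)
    inner {_} {ρ} (_ , _ , ρ-row) with Preserves? col ρ
    ... | no ¬p = ev-0 colSum (λ {_} {τ} r → let _ , τ-inj , τ-pres = colSum-items r in
      when-false (¬p ∘ Preserves-cancel τ-inj τ-pres ∘ does-sound (Preserves? col (ρ ∙ τ))))
    ... | yes p = begin
      ev colSum (λ τ → colSign (ρ ∙ τ))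
        ≈⟨ ev-cong∈ colSum (λ {_} {τ} r → F.trans
             (F.reflexive (cong colSign (≡.trans (cong (_∙ τ) (rowcol-trivial ρ-row p)) (∙-idˡ τ))))
             (F.trans (colSign-pres (proj₂ (proj₂ (colSum-items r)))) (F.sym (F.*-identityʳ _)))) ⟩
      ev colSum (λ τ → sgn τ * 1#)
        ≈⟨ colSum-sgn scalars 1# ⟩
      nat (length colSum) * 1#
        ≈⟨ F.*-identityʳ _ ⟩
      nat (length colSum)
        ≡⟨ cong nat eq′ ⟩
      nat (suc l) ∎
    outer : ∀ (x : GA m) → (∀ {s ρ} → (s , ρ) ∈ x → s ≈ 1#) →
      ev x (λ ρ → nat (suc l) when does (Preserves? col ρ)) ≈
      nat (countB (λ ρ → does (Preserves? col ρ)) (List.map proj₂ x)) * nat (suc l)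
    outer []            _ = F.sym (F.zeroˡ _)
    outer ((s , ρ) ∷ x) h with does (Preserves? col ρ)
    ... | true  = F.trans (F.+-cong (F.trans (F.*-congʳ (h (here ≡.refl))) (F.*-identityˡ _)) (outer x (h ∘ there)))
                          (F.sym (nat-suc scalars (countB (λ ρ → does (Preserves? col ρ)) (List.map proj₂ x)) (nat (suc l))))
    ... | false = F.trans (F.+-congʳ (F.zeroʳ s)) (F.trans (F.+-identityˡ _) (outer x (h ∘ there)))

  young-ccc : ¬ (∀ f → ev young (λ p → ev (star young) (λ q → ev young (λ r → f (p ∙ (q ∙ r))))) ≈ 0#)
  young-ccc vanishes with young-colSign
  ... | q , e = Module.nat≉0 scalars q (F.trans (F.sym e) (ccc-vanish young young-items vanishes colSign))


-- Quotients of the free module on words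

module Quotient {c ℓ : Level} (K : Char0Field c ℓ) {m : ℕ} where
  open Signs K
  open F using (Carrier; _≈_; _+_; _*_; -_; 0#; 1#)
  private module S = Module scalars

  record IsSubspace (I : Tm m → Set (c ⊔ ℓ)) : Set (lsuc (c ⊔ ℓ)) where
    field
      has-0     : I []
      has-+     : ∀ {x y} → I x → I y → I (x ++ y)
      has-scale : ∀ {x} a → I x → I (scaleT a x)

  module _ (I : Tm m → Set (c ⊔ ℓ)) (isSubspace : IsSubspace I) where
    open IsSubspace isSubspace

    infix 4 _≋_
    -- Congruence modulo I, with z as the difference. Formal sums are compared through all scalar
    -- functions f on words, which reduces the module laws to those of the field.
    record _≋_ (x y : Tm m) : Set (c ⊔ ℓ) where
      constructor modulo
      field
        z    : Tm m
        z∈I  : I z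
        ev-≈ : ∀ f → S.ev x f ≈ S.ev y f + S.ev z f

    private
      open SetoidReasoning F.setoid

      ≋-ev : ∀ {x y} → (∀ f → S.ev x f ≈ S.ev y f) → x ≋ y
      ≋-ev e = modulo [] has-0 λ f → F.trans (e f) (F.sym (F.+-identityʳ _))

      ev-scale : ∀ a (x : Tm m) f → S.ev (scaleT a x) f ≈ a * S.ev x f
      ev-scale a x f = S.ev-scaled a id x f

      ≋-sym : ∀ {x y} → x ≋ y → y ≋ x
      ≋-sym {x} {y} (modulo z Iz e) = modulo (scaleT (- 1#) z) (has-scale (- 1#) Iz) λ f → begin
        S.ev y f                                  ≈⟨ F.+-identityʳ _ ⟨
        S.ev y f + 0#                             ≈⟨ F.+-congˡ (F.-‿inverseʳ _) ⟨
        S.ev y f + (S.ev z f + - S.ev z f)        ≈⟨ F.+-assoc _ _ _ ⟨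
        (S.ev y f + S.ev z f) + - S.ev z f        ≈⟨ F.+-cong (e f) (-1*x≈-x _) ⟨
        S.ev x f + (- 1#) * S.ev z f              ≈⟨ F.+-congˡ (ev-scale (- 1#) z f) ⟨
        S.ev x f + S.ev (scaleT (- 1#) z) f       ∎

      ≋-trans : ∀ {x y w} → x ≋ y → y ≋ w → x ≋ w
      ≋-trans {x} {y} {w} (modulo z Iz e) (modulo z′ Iz′ e′) = modulo (z′ ++ z) (has-+ Iz′ Iz) λ f → begin
        S.ev x f                                ≈⟨ e f ⟩
        S.ev y f + S.ev z f                     ≈⟨ F.+-congʳ (e′ f) ⟩
        (S.ev w f + S.ev z′ f) + S.ev z f       ≈⟨ F.+-assoc _ _ _ ⟩
        S.ev w f + (S.ev z′ f + S.ev z f)       ≈⟨ F.+-congˡ (S.ev-++ z′ z f) ⟨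
        S.ev w f + S.ev (z′ ++ z) f             ∎

      ++-cong : ∀ {x y x′ y′} → x ≋ y → x′ ≋ y′ → x ++ x′ ≋ y ++ y′
      ++-cong {x} {y} {x′} {y′} (modulo z Iz e) (modulo z′ Iz′ e′) = modulo (z ++ z′) (has-+ Iz Iz′) λ f → begin
        S.ev (x ++ x′) f                                          ≈⟨ S.ev-++ x x′ f ⟩
        S.ev x f + S.ev x′ f                                      ≈⟨ F.+-cong (e f) (e′ f) ⟩
        (S.ev y f + S.ev z f) + (S.ev y′ f + S.ev z′ f)           ≈⟨ +-interchange _ _ _ _ ⟩
        (S.ev y f + S.ev y′ f) + (S.ev z f + S.ev z′ f)           ≈⟨ F.+-cong (S.ev-++ y y′ f) (S.ev-++ z z′ f) ⟨
        S.ev (y ++ y′) f + S.ev (z ++ z′) f                       ∎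

      scale-cong : ∀ {a b x y} → a ≈ b → x ≋ y → scaleT a x ≋ scaleT b y
      scale-cong {a} {b} {x} {y} a≈b (modulo z Iz e) = modulo (scaleT b z) (has-scale b Iz) λ f → begin
        S.ev (scaleT a x) f                              ≈⟨ ev-scale a x f ⟩
        a * S.ev x f                                     ≈⟨ F.*-cong a≈b (e f) ⟩
        b * (S.ev y f + S.ev z f)                        ≈⟨ F.distribˡ b _ _ ⟩
        b * S.ev y f + b * S.ev z f                      ≈⟨ F.+-cong (ev-scale b y f) (ev-scale b z f) ⟨
        S.ev (scaleT b y) f + S.ev (scaleT b z) f        ∎

      neg-inverse : ∀ (x : Tm m) f → S.ev (scaleT (- 1#) x) f + S.ev x f ≈ 0#
      neg-inverse x f = F.trans (F.+-congʳ (F.trans (ev-scale (- 1#) x f) (-1*x≈-x _))) (F.-‿inverseˡ _)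

    quotient : LeftModule F.ring c (c ⊔ ℓ)
    quotient = record
      { Carrierᴹ = Tm m
      ; _≈ᴹ_ = _≋_
      ; _+ᴹ_ = _++_
      ; _*ₗ_ = scaleT
      ; 0ᴹ = []
      ; -ᴹ_ = scaleT (- 1#)
      ; isLeftModule = record
        { isLeftSemimodule = record
          { +ᴹ-isCommutativeMonoid = record
            { isMonoid = record
              { isSemigroup = record
                { isMagma = record
                  { isEquivalence = record { refl = ≋-ev (λ _ → F.refl) ; sym = ≋-sym ; trans = ≋-trans }
                  ; ∙-cong = ++-cong
                  }
                ; assoc = λ x y z → ≋-ev λ f → F.reflexive (cong (λ w → S.ev w f) (Listₚ.++-assoc x y z))
                }
              ; identity = (λ x → ≋-ev λ _ → F.refl)
                         , (λ x → ≋-ev λ f → F.reflexive (cong (λ w → S.ev w f) (Listₚ.++-identityʳ x)))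
              }
            ; comm = λ x y → ≋-ev λ f → begin
                S.ev (x ++ y) f        ≈⟨ S.ev-++ x y f ⟩
                S.ev x f + S.ev y f    ≈⟨ F.+-comm _ _ ⟩
                S.ev y f + S.ev x f    ≈⟨ S.ev-++ y x f ⟨
                S.ev (y ++ x) f        ∎
            }
          ; isPreleftSemimodule = record
            { *ₗ-cong = scale-cong
            ; *ₗ-zeroˡ = λ x → ≋-ev λ f → F.trans (ev-scale 0# x f) (F.zeroˡ _)
            ; *ₗ-distribʳ = λ x a b → ≋-ev λ f → begin
                S.ev (scaleT (a + b) x) f                    ≈⟨ ev-scale (a + b) x f ⟩
                (a + b) * S.ev x f                           ≈⟨ F.distribʳ _ a b ⟩
                a * S.ev x f + b * S.ev x f                  ≈⟨ F.+-cong (ev-scale a x f) (ev-scale b x f) ⟨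
                S.ev (scaleT a x) f + S.ev (scaleT b x) f    ≈⟨ S.ev-++ (scaleT a x) (scaleT b x) f ⟨
                S.ev (scaleT a x ++ scaleT b x) f            ∎
            ; *ₗ-identityˡ = λ x → ≋-ev λ f → F.trans (ev-scale 1# x f) (F.*-identityˡ _)
            ; *ₗ-assoc = λ a b x → ≋-ev λ f → begin
                S.ev (scaleT (a * b) x) f           ≈⟨ ev-scale (a * b) x f ⟩
                (a * b) * S.ev x f                  ≈⟨ F.*-assoc a b _ ⟩
                a * (b * S.ev x f)                  ≈⟨ F.*-congˡ (ev-scale b x f) ⟨
                a * S.ev (scaleT b x) f             ≈⟨ ev-scale a (scaleT b x) f ⟨
                S.ev (scaleT a (scaleT b x)) f      ∎
            ; *ₗ-zeroʳ = λ a → ≋-ev λ f → F.refl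
            ; *ₗ-distribˡ = λ a x y → ≋-ev λ f → F.reflexive
                (cong (λ w → S.ev w f) (Listₚ.map-++ (λ p → a * proj₁ p , proj₂ p) x y))
            }
          }
        ; -ᴹ‿cong = scale-cong F.refl
        ; -ᴹ‿inverse = (λ x → ≋-ev λ f → F.trans (S.ev-++ (scaleT (- 1#) x) x f) (neg-inverse x f))
                     , (λ x → ≋-ev λ f → F.trans (S.ev-++ x (scaleT (- 1#) x) f) (F.trans (F.+-comm _ _) (neg-inverse x f)))
        }
      }

    word : Word m → Tm m
    word w = (1# , w) ∷ []

    ev-word : ∀ w f → S.ev (word w) f ≈ f w
    ev-word w f = F.trans (F.+-identityʳ _) (F.*-identityˡ _)

    ev-ev : ∀ {A : Set} (x : List (Carrier × A)) (g : A → Tm m) f →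
      S.ev (Module.ev quotient x g) f ≈ S.ev x (λ v → S.ev (g v) f)
    ev-ev []            g f = F.refl
    ev-ev ((a , v) ∷ x) g f = F.trans (S.ev-++ (scaleT a (g v)) _ f)
      (F.+-cong (ev-scale a (g v) f) (ev-ev x g f))

    ≋0 : ∀ {x z} → I z → (∀ f → S.ev x f ≈ S.ev z f) → x ≋ []
    ≋0 {z = z} Iz e = modulo z Iz λ f → F.trans (e f) (F.sym (F.+-identityˡ _))

-- Averages of functions that satisfy the exchange relation

module Averaging {c ℓ : Level} (K : Char0Field c ℓ) {v ℓv : Level} (V : LeftModule (Char0Field.ring K) v ℓv)
  {n : ℕ} (col : Fin n → ℕ) where
  open Signs K
  open Module V
  open F using (Carrier)
  open SetoidReasoning ≈ᴹ-setoid

  SatisfiesExchange : (Word n → Carrierᴹ) → Set ℓv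
  SatisfiesExchange Ψ = ∀ w → Inj w → ∀ i {j} → j < col (lookup w i) →
    Ψ w ≈ᴹ sum (λ i′ → Ψ (w ∙ tr i′ i) when (col (lookup w i′) ≡ᵇ j))

  -- Right multiplication by h τ only renames positions: the relation for w ∙ h τ at the position
  -- that h τ sends to i, reindexed along h τ, has the shape of the relation for w at i.
  average-exchange : ∀ {A : Set} (y : List (Carrier × A)) (h : A → Word n) →
    (∀ {s τ} → (s , τ) ∈ y → Inj (h τ)) → ∀ Ψ → SatisfiesExchange Ψ →
    SatisfiesExchange (λ w → ev y (λ τ → Ψ (w ∙ h τ)))
  average-exchange y h h-inj Ψ ex w w-inj i {j} j< = begin
    ev y (λ τ → Ψ (w ∙ h τ))
      ≈⟨ ev-cong∈ y (λ {_} {τ} q → at τ (h-inj q)) ⟩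
    ev y (λ τ → sum (λ i′ → Ψ ((w ∙ tr i′ i) ∙ h τ) when (col (lookup w i′) ≡ᵇ j)))
      ≈⟨ ev-sum {n = n} y _ ⟩
    sum (λ i′ → ev y (λ τ → Ψ ((w ∙ tr i′ i) ∙ h τ) when (col (lookup w i′) ≡ᵇ j)))
      ≈⟨ sum-cong-≋ (λ i′ → ev-when (col (lookup w i′) ≡ᵇ j) y _) ⟩
    sum (λ i′ → ev y (λ τ → Ψ ((w ∙ tr i′ i) ∙ h τ)) when (col (lookup w i′) ≡ᵇ j)) ∎
    where
    at : ∀ τ → Inj (h τ) → Ψ (w ∙ h τ) ≈ᴹ sum (λ i′ → Ψ ((w ∙ tr i′ i) ∙ h τ) when (col (lookup w i′) ≡ᵇ j))
    at τ g-inj = begin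
      Ψ (w ∙ g)
        ≈⟨ ex (w ∙ g) (Inj-∙ w-inj g-inj) (g⁻¹ i) (subst (j <_) (cong col (≡.sym (w∙g i))) j<) ⟩
      sum (λ a → Ψ ((w ∙ g) ∙ tr a (g⁻¹ i)) when (col (lookup (w ∙ g) a) ≡ᵇ j))
        ≈⟨ sum-permute _ (word-permutation (Inj-inv g-inj)) ⟩
      sum (λ i′ → Ψ ((w ∙ g) ∙ tr (g⁻¹ i′) (g⁻¹ i)) when (col (lookup (w ∙ g) (g⁻¹ i′)) ≡ᵇ j))
        ≈⟨ sum-cong-≋ (λ i′ → ≈ᴹ-reflexive (cong₂ (λ u x → Ψ u when (col x ≡ᵇ j)) (moved i′) (w∙g i′))) ⟩
      sum (λ i′ → Ψ ((w ∙ tr i′ i) ∙ g) when (col (lookup w i′) ≡ᵇ j)) ∎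
      where
      g = h τ
      g⁻¹ : Fin n → Fin n
      g⁻¹ = lookup (inv g)
      w∙g : ∀ a → lookup (w ∙ g) (g⁻¹ a) ≡ lookup w a
      w∙g a = ≡.trans (lookup-∙ w g (g⁻¹ a)) (cong (lookup w) (lookup-inv g-inj a))
      moved : ∀ i′ → (w ∙ g) ∙ tr (g⁻¹ i′) (g⁻¹ i) ≡ (w ∙ tr i′ i) ∙ g
      moved i′ = ≡.trans (∙-assoc w g (tr (g⁻¹ i′) (g⁻¹ i))) (≡.trans
        (cong (w ∙_) (≡.trans (tr-conj g-inj (g⁻¹ i′) (g⁻¹ i))
          (cong₂ (λ a b → tr a b ∙ g) (lookup-inv g-inj i′) (lookup-inv g-inj i))))
        (≡.sym (∙-assoc w (tr i′ i) g)))

-- The scalar β and its invertibility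

module Scale {c ℓ : Level} (K : Char0Field c ℓ) {k : ℕ} (D : Diagram k) where
  open Signs K
  open Integrality K using (star)
  open F using (Carrier; _≈_; _+_; _*_; -_; 0#; 1#)
  open Diagram D
  open Young K D
  open Exchange K k col col using (Exchangeable)
  open Multiples K c (c ⊔ ℓ) col using (multiple)
  private module S = Module scalars

  -- The scalars m_σ. The value 0 for words that are not permutations is never reached, because β
  -- evaluates products of permutations only.
  factor : Word k → Carrier
  factor w with Inj? w
  ... | yes w-inj = proj₁ (multiple w w-inj)
  ... | no _      = 0#

  β : Carrier
  β = S.ev (star young) (λ q → S.ev rowSum (λ ρ → factor (q ∙ ρ)))

  star-items : ∀ {s q} → (s , q) ∈ star young → Inj q
  star-items r with ∈ₚ.∈-map⁻ _ r
  ... | _ , r′ , ≡.refl = Inj-inv (proj₂ (young-items r′))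

  module _ (V : LeftModule F.ring c (c ⊔ ℓ)) where
    open Module V
    open SetoidReasoning ≈ᴹ-setoid

    factor-multiple : ∀ Φ → Exchangeable V Φ → ∀ {w} → Inj w → Φ w ≈ᴹ factor w *ₗ Φ identityW
    factor-multiple Φ ex {w} w-inj with Inj? w
    ... | yes w-inj′ = proj₂ (multiple w w-inj′) V Φ ex
    ... | no ¬p      = contradiction w-inj ¬p

    antisymmetrized : (Word k → Carrierᴹ) → Word k → Carrierᴹ
    antisymmetrized Ψ u = ev colSum (λ τ → Ψ (u ∙ τ))

    antisymmetrized-alternating : ∀ Ψ u i i′ → i ≢ i′ → col i ≡ col i′ →
      antisymmetrized Ψ (u ∙ tr i i′) ≈ᴹ -ᴹ antisymmetrized Ψ u
    antisymmetrized-alternating Ψ u i i′ i≢i′ e = ≈ᴹ-trans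
      (ev-cong colSum (λ τ → ≈ᴹ-reflexive (cong Ψ (∙-assoc u (tr i i′) τ))))
      (colSum-left V e i≢i′ (λ τ → Ψ (u ∙ τ)))

    -- Splitting c_μ into row sum and column sum leaves b_μ on the right. There each q ∙ ρ in front
    -- of it may be replaced by its scalar, and the scalars add up to β.
    β-multiple : ∀ Ψ → Exchangeable V (antisymmetrized Ψ) →
      ev (star young) (λ q → ev young (λ p → Ψ (q ∙ p))) ≈ᴹ β *ₗ antisymmetrized Ψ identityW
    β-multiple Ψ ex = begin
      ev (star young) (λ q → ev young (λ p → Ψ (q ∙ p)))
        ≈⟨ ev-cong (star young) (λ q → ev-mulGA rowSum colSum _) ⟩
      ev (star young) (λ q → ev rowSum (λ ρ → ev colSum (λ τ → Ψ (q ∙ (ρ ∙ τ)))))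
        ≈⟨ ev-cong (star young) (λ q → ev-cong rowSum (λ ρ → ev-cong colSum (λ τ →
             ≈ᴹ-reflexive (cong Ψ (∙-assoc q ρ τ))))) ⟨
      ev (star young) (λ q → ev rowSum (λ ρ → antisymmetrized Ψ (q ∙ ρ)))
        ≈⟨ ev-cong∈ (star young) (λ q∈ → ev-cong∈ rowSum (λ ρ∈ →
             factor-multiple (antisymmetrized Ψ) ex (Inj-∙ (star-items q∈) (proj₁ (proj₂ (rowSum-items ρ∈)))))) ⟩
      ev (star young) (λ q → ev rowSum (λ ρ → factor (q ∙ ρ) *ₗ antisymmetrized Ψ identityW))
        ≈⟨ ev-cong (star young) (λ q → ev-scalar-* V rowSum (λ ρ → factor (q ∙ ρ)) _) ⟩
      ev (star young) (λ q → S.ev rowSum (λ ρ → factor (q ∙ ρ)) *ₗ antisymmetrized Ψ identityW)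
        ≈⟨ ev-scalar-* V (star young) (λ q → S.ev rowSum (λ ρ → factor (q ∙ ρ))) _ ⟩
      β *ₗ antisymmetrized Ψ identityW ∎

  -- Applied to the free module, β-multiple expresses c c* c through β, where c is the Young symmetrizer.
  β≉0 : ¬ (β ≈ 0#)
  β≉0 β≈0 = NonVanishing.young-ccc K D vanishes
    where
    -- Only what every functional kills is divided out, so the quotient is the free module on the
    -- words.
    Null : Tm k → Set (c ⊔ ℓ)
    Null z = ∀ f → S.ev z f ≈ 0#
    isSubspace : Quotient.IsSubspace K Null
    isSubspace = record
      { has-0     = λ f → F.refl
      ; has-+     = λ {x} {y} p q f → F.trans (S.ev-++ x y f) (F.trans (F.+-cong (p f) (q f)) (F.+-identityˡ _))
      ; has-scale = λ {x} a p f → F.trans (S.ev-scaled a id x f) (F.trans (F.*-congˡ (p f)) (F.zeroʳ a))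
      }
    open Quotient K {k}
    free : LeftModule F.ring c (c ⊔ ℓ)
    free = quotient Null isSubspace
    module V = Module free
    [_] : Word k → Tm k
    [_] = word Null isSubspace
    open Relations free [_] using (φ; exchange)
    exchangeable : Exchangeable free (antisymmetrized free φ)
    exchangeable = record
      { alternating = λ w _ i i′ _ _ → antisymmetrized-alternating free φ w i i′
      ; exchanges = λ w w-inj i _ → Averaging.average-exchange K free col colSum id
          (λ q → proj₁ (proj₂ (colSum-items q))) φ exchange w w-inj i
      }
    zero-in-free : V.ev (star young) (λ q → V.ev young (λ p → φ (q ∙ p))) V.≈ᴹ []
    zero-in-free = V.≈ᴹ-trans (β-multiple free φ exchangeable)
      (V.≈ᴹ-trans (V.*ₗ-congʳ β≈0) (V.*ₗ-zeroˡ _))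
    -- The sum that comes from φ stands innermost, but its permutations are the leftmost factors.
    triple : ∀ (x y : GA k) f →
      S.ev (V.ev y (λ q → V.ev x (λ r → V.ev x (λ p → [ p ∙ (q ∙ r) ])))) f ≈
      S.ev x (λ p → S.ev y (λ q → S.ev x (λ r → f (p ∙ (q ∙ r)))))
    triple x y f = begin
      S.ev (V.ev y (λ q → V.ev x (λ r → V.ev x (λ p → [ p ∙ (q ∙ r) ])))) f
        ≈⟨ ev-ev Null isSubspace y _ f ⟩
      S.ev y (λ q → S.ev (V.ev x (λ r → V.ev x (λ p → [ p ∙ (q ∙ r) ]))) f)
        ≈⟨ S.ev-cong y (λ q → ev-ev Null isSubspace x _ f) ⟩
      S.ev y (λ q → S.ev x (λ r → S.ev (V.ev x (λ p → [ p ∙ (q ∙ r) ])) f))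
        ≈⟨ S.ev-cong y (λ q → S.ev-cong x (λ r → ev-ev Null isSubspace x _ f)) ⟩
      S.ev y (λ q → S.ev x (λ r → S.ev x (λ p → S.ev [ p ∙ (q ∙ r) ] f)))
        ≈⟨ S.ev-cong y (λ q → S.ev-cong x (λ r → S.ev-cong x (λ p → ev-word Null isSubspace (p ∙ (q ∙ r)) f))) ⟩
      S.ev y (λ q → S.ev x (λ r → S.ev x (λ p → f (p ∙ (q ∙ r)))))
        ≈⟨ S.ev-cong y (λ q → S.ev-swap x x _) ⟩
      S.ev y (λ q → S.ev x (λ p → S.ev x (λ r → f (p ∙ (q ∙ r)))))
        ≈⟨ S.ev-swap y x _ ⟩
      S.ev x (λ p → S.ev y (λ q → S.ev x (λ r → f (p ∙ (q ∙ r))))) ∎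
      where open SetoidReasoning F.setoid
    vanishes : ∀ f → S.ev young (λ p → S.ev (star young) (λ q → S.ev young (λ r → f (p ∙ (q ∙ r))))) ≈ 0#
    vanishes f = F.trans (F.sym (triple young (star young) f)) (at zero-in-free)
      where
      at : ∀ {x} → x V.≈ᴹ [] → S.ev x f ≈ 0#
      at (modulo z null e) = F.trans (e f) (F.trans (F.+-identityˡ _) (null f))


-- Extending words by the identity

module _ {k : ℕ} (s : ℕ) where

  -- Written exactly as the product of z_u with the identity word, so that `mulI` followed by a
  -- transport yields such words.
  embed : Word k → Word (k ℕ.+ s)
  embed u = Vec.map (_↑ˡ s) u Vec.++ Vec.map (k ↑ʳ_) identityW

  lookup-embedˡ : ∀ u a → lookup (embed u) (a ↑ˡ s) ≡ lookup u a ↑ˡ s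
  lookup-embedˡ u a = ≡.trans (Vecₚ.lookup-++ˡ (Vec.map (_↑ˡ s) u) _ a) (Vecₚ.lookup-map a (_↑ˡ s) u)

  lookup-embedʳ : ∀ u b → lookup (embed u) (k ↑ʳ b) ≡ k ↑ʳ b
  lookup-embedʳ u b = ≡.trans (Vecₚ.lookup-++ʳ (Vec.map (_↑ˡ s) u) _ b)
    (≡.trans (Vecₚ.lookup-map b (k ↑ʳ_) identityW) (cong (k ↑ʳ_) (lookup-id b)))

  data SumView : Fin (k ℕ.+ s) → Set where
    inˡ : ∀ a → SumView (a ↑ˡ s)
    inʳ : ∀ b → SumView (k ↑ʳ b)

  sumView : ∀ i → SumView i
  sumView i with splitAt k i in eq
  ... | inj₁ a = subst SumView (Finₚ.splitAt⁻¹-↑ˡ {i = i} eq) (inˡ a)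
  ... | inj₂ b = subst SumView (Finₚ.splitAt⁻¹-↑ʳ {i = i} eq) (inʳ b)

  left≢right : ∀ {a b} → a ↑ˡ s ≢ k ↑ʳ b
  left≢right {a} {b} e = ℕₚ.<⇒≱ (Finₚ.toℕ<n a) (ℕₚ.≤-trans (ℕₚ.m≤m+n k (toℕ b))
    (ℕₚ.≤-reflexive (≡.trans (≡.sym (Finₚ.toℕ-↑ʳ k b)) (≡.trans (cong toℕ (≡.sym e)) (Finₚ.toℕ-↑ˡ a s)))))

  embed-∙ : ∀ u v → embed (u ∙ v) ≡ embed u ∙ embed v
  embed-∙ u v = lookup-ext λ i → pointwise (sumView i)
    where
    open ≡.≡-Reasoning
    pointwise : ∀ {i} → SumView i → lookup (embed (u ∙ v)) i ≡ lookup (embed u ∙ embed v) i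
    pointwise (inˡ a) = begin
      lookup (embed (u ∙ v)) (a ↑ˡ s)             ≡⟨ lookup-embedˡ (u ∙ v) a ⟩
      lookup (u ∙ v) a ↑ˡ s                       ≡⟨ cong (_↑ˡ s) (lookup-∙ u v a) ⟩
      lookup u (lookup v a) ↑ˡ s                  ≡⟨ lookup-embedˡ u (lookup v a) ⟨
      lookup (embed u) (lookup v a ↑ˡ s)          ≡⟨ cong (lookup (embed u)) (lookup-embedˡ v a) ⟨
      lookup (embed u) (lookup (embed v) (a ↑ˡ s)) ≡⟨ lookup-∙ (embed u) (embed v) _ ⟨
      lookup (embed u ∙ embed v) (a ↑ˡ s)         ∎
    pointwise (inʳ b) = begin
      lookup (embed (u ∙ v)) (k ↑ʳ b)             ≡⟨ lookup-embedʳ (u ∙ v) b ⟩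
      k ↑ʳ b                                      ≡⟨ lookup-embedʳ u b ⟨
      lookup (embed u) (k ↑ʳ b)                   ≡⟨ cong (lookup (embed u)) (lookup-embedʳ v b) ⟨
      lookup (embed u) (lookup (embed v) (k ↑ʳ b)) ≡⟨ lookup-∙ (embed u) (embed v) _ ⟨
      lookup (embed u ∙ embed v) (k ↑ʳ b)         ∎

  embed-id : embed identityW ≡ identityW
  embed-id = lookup-ext λ i → pointwise (sumView i)
    where
    pointwise : ∀ {i} → SumView i → lookup (embed identityW) i ≡ lookup identityW i
    pointwise (inˡ a)  = ≡.trans (lookup-embedˡ identityW a) (≡.trans (cong (_↑ˡ s) (lookup-id a)) (≡.sym (lookup-id _)))
    pointwise (inʳ b) = ≡.trans (lookup-embedʳ identityW b) (≡.sym (lookup-id _))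

  embed-tr : ∀ i j → embed (tr i j) ≡ tr (i ↑ˡ s) (j ↑ˡ s)
  embed-tr i j = lookup-ext λ a → pointwise (sumView a)
    where
    pointwise : ∀ {a} → SumView a → lookup (embed (tr i j)) a ≡ lookup (tr (i ↑ˡ s) (j ↑ˡ s)) a
    pointwise (inˡ a) = ≡.trans (lookup-embedˡ (tr i j) a) inner
      where
      inner : lookup (tr i j) a ↑ˡ s ≡ lookup (tr (i ↑ˡ s) (j ↑ˡ s)) (a ↑ˡ s)
      inner with lookup (tr i j) a | tr-view i j a
      ... | _ | fst ≡.refl   = ≡.sym (tr-fst (i ↑ˡ s) (j ↑ˡ s))
      ... | _ | snd _ ≡.refl = ≡.sym (tr-snd (i ↑ˡ s) (j ↑ˡ s))
      ... | _ | other p q    = ≡.sym (tr-other (i ↑ˡ s) (j ↑ˡ s) (p ∘ Finₚ.↑ˡ-injective s a i) (q ∘ Finₚ.↑ˡ-injective s a j))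
    pointwise (inʳ b) = ≡.trans (lookup-embedʳ (tr i j) b)
      (≡.sym (tr-other (i ↑ˡ s) (j ↑ˡ s) (λ e → left≢right (≡.sym e)) (λ e → left≢right (≡.sym e))))

  Inj-embed : ∀ {u} → Inj u → Inj (embed u)
  Inj-embed {u} u-inj .injective i j = pointwise (sumView i) (sumView j)
    where
    pointwise : ∀ {i j} → SumView i → SumView j → lookup (embed u) i ≡ lookup (embed u) j → i ≡ j
    pointwise (inˡ a)  (inˡ a′) e = cong (_↑ˡ s) (u-inj .injective a a′ (Finₚ.↑ˡ-injective s _ _
      (≡.trans (≡.sym (lookup-embedˡ u a)) (≡.trans e (lookup-embedˡ u a′)))))
    pointwise (inˡ a)  (inʳ b) e = contradiction
      (≡.trans (≡.sym (lookup-embedˡ u a)) (≡.trans e (lookup-embedʳ u b))) left≢right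
    pointwise (inʳ b) (inˡ a)  e = contradiction
      (≡.trans (≡.sym (lookup-embedˡ u a)) (≡.trans (≡.sym e) (lookup-embedʳ u b))) left≢right
    pointwise (inʳ b) (inʳ b′) e =
      ≡.trans (≡.sym (lookup-embedʳ u b)) (≡.trans e (lookup-embedʳ u b′))

  open Labels {k ℕ.+ s} k

  lab-left : ∀ a → T (lab (a ↑ˡ s))
  lab-left a = ℕₚ.<⇒<ᵇ (subst (_< k) (≡.sym (Finₚ.toℕ-↑ˡ a s)) (Finₚ.toℕ<n a))

  unlab-right : ∀ b → ¬ T (lab (k ↑ʳ b))
  unlab-right b t = ℕₚ.<⇒≱ (ℕₚ.<ᵇ⇒< _ _ t)
    (ℕₚ.≤-trans (ℕₚ.m≤m+n k (toℕ b)) (ℕₚ.≤-reflexive (≡.sym (Finₚ.toℕ-↑ʳ k b))))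

  labelWeight-embed : ∀ u i → labelWeight (lookup (embed u) i) ≡ labelWeight i
  labelWeight-embed u i = pointwise (sumView i)
    where
    pointwise : ∀ {i} → SumView i → labelWeight (lookup (embed u) i) ≡ labelWeight i
    pointwise (inˡ a)  = ≡.trans (cong labelWeight (lookup-embedˡ u a))
      (≡.trans (labelWeight-lab (lab-left (lookup u a))) (≡.sym (labelWeight-lab (lab-left a))))
    pointwise (inʳ b) = cong labelWeight (lookup-embedʳ u b)

  labelSum-embed : ∀ (g : Fin (k ℕ.+ s) → ℕ) w {u} → Inj u → labelSum g (w ∙ embed u) ≡ labelSum g w
  labelSum-embed g w {u} u-inj = begin
    ΣN.sum (λ i → labelWeight i ℕ.* g (lookup (w ∙ embed u) i))
      ≡⟨ ΣN.sum-cong-≋ (λ i → cong₂ (λ x y → x ℕ.* g y) (≡.sym (labelWeight-embed u i)) (lookup-∙ w (embed u) i)) ⟩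
    ΣN.sum (λ i → labelWeight (lookup (embed u) i) ℕ.* g (lookup w (lookup (embed u) i)))
      ≡⟨ ΣN.sum-permute (λ i → labelWeight i ℕ.* g (lookup w i)) (word-permutation (Inj-embed u-inj)) ⟨
    ΣN.sum (λ i → labelWeight i ℕ.* g (lookup w i)) ∎
    where open ≡.≡-Reasoning

-- The diagram of a tableau

module _ {sh : List ℕ} (partition : IsPartition sh) where

  rowLen-length : ∀ sh {i j} → j < rowLen sh i → i < length sh
  rowLen-length (x ∷ sh) {zero}  p = s≤s z≤n
  rowLen-length (x ∷ sh) {suc i} p = s≤s (rowLen-length sh p)

  rowLen-suc : ∀ i → rowLen sh (suc i) ≤ rowLen sh i
  rowLen-suc i with rowLen sh (suc i) in eq
  ... | zero  = z≤n
  ... | suc l = ℕₚ.≤-trans (ℕₚ.≤-reflexive (≡.sym eq))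
    (proj₂ partition i (rowLen-length sh (ℕₚ.≤-trans (s≤s z≤n) (ℕₚ.≤-reflexive (≡.sym eq)))))

  rowLen-antitone : ∀ d i → rowLen sh (d ℕ.+ i) ≤ rowLen sh i
  rowLen-antitone zero    i = ℕₚ.≤-refl
  rowLen-antitone (suc d) i = ℕₚ.≤-trans (rowLen-suc (d ℕ.+ i)) (rowLen-antitone d i)

  box-≡ : {b b′ : Box sh} → Box.pos b ≡ Box.pos b′ → b ≡ b′
  box-≡ {box pos p} {box .pos q} ≡.refl = cong (box pos) (ℕₚ.≤-irrelevant p q)

  diagram : ∀ {m} → Tableau sh (Fin m) → Diagram m
  diagram t = record
    { row        = rowOf ∘ Inverse.from t
    ; col        = colOf ∘ Inverse.from t
    ; rows       = length sh
    ; cols       = rowLen sh 0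
    ; row<rows   = λ a → rowLen-length sh (Box.inD (Inverse.from t a))
    ; col<cols   = λ a → ℕₚ.<-≤-trans (Box.inD (Inverse.from t a)) (subst (λ i → rowLen sh i ≤ rowLen sh 0)
                     (ℕₚ.+-identityʳ _) (rowLen-antitone (rowOf (Inverse.from t a)) 0))
    ; determined = λ {a} {b} e e′ → ≡.trans (≡.sym (Inverse.strictlyInverseˡ t a))
                     (≡.trans (cong (Inverse.to t) (box-≡ (cong₂ _,_ e e′))) (Inverse.strictlyInverseˡ t b))
    ; left       = λ a j< → cell a (ℕₚ.<-trans j< (Box.inD (Inverse.from t a)))
    ; up         = λ a {i} i< → cell′ a (ℕₚ.<-≤-trans (Box.inD (Inverse.from t a))
                     (subst (λ i′ → rowLen sh i′ ≤ rowLen sh i) (ℕₚ.m∸n+n≡m (ℕₚ.<⇒≤ i<)) (rowLen-antitone _ i)))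
    }
    where
    cell : ∀ a {j} → j < rowLen sh (rowOf (Inverse.from t a)) →
      ∃[ b ] (rowOf (Inverse.from t b) ≡ rowOf (Inverse.from t a) × colOf (Inverse.from t b) ≡ j)
    cell a {j} p = Inverse.to t (box (_ , j) p) ,
      cong rowOf (Inverse.strictlyInverseʳ t (box (_ , j) p)) , cong colOf (Inverse.strictlyInverseʳ t (box (_ , j) p))
    cell′ : ∀ a {i} → colOf (Inverse.from t a) < rowLen sh i →
      ∃[ b ] (rowOf (Inverse.from t b) ≡ i × colOf (Inverse.from t b) ≡ colOf (Inverse.from t a))
    cell′ a {i} p = Inverse.to t (box (i , _) p) ,
      cong rowOf (Inverse.strictlyInverseʳ t (box (i , _) p)) , cong colOf (Inverse.strictlyInverseʳ t (box (i , _) p))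

-- Order ideals of a diagram

-- The search runs from the top: the largest element of a down-closed set determines the set.
prefix : ∀ (P : ℕ → Bool) N → (∀ j → suc j < N → T (P (suc j)) → T (P j)) →
  ∃[ r ] (r ≤ N × ∀ j → j < N → (T (P j) → j < r) × (j < r → T (P j)))
prefix P zero    closed = 0 , z≤n , λ _ ()
prefix P (suc N) closed with P N in eq
... | true = suc N , ℕₚ.≤-refl , λ j j<N → (λ _ → j<N) , λ j< → downward (N ∸ j) j (ℕₚ.m∸n+n≡m (ℕₚ.≤-pred j<))
  where
  downward : ∀ d j → d ℕ.+ j ≡ N → T (P j)
  downward zero    j ≡.refl = subst T (≡.sym eq) tt
  downward (suc d) j e = closed j (s≤s (ℕₚ.≤-trans (s≤s (ℕₚ.m≤n+m j d)) (ℕₚ.≤-reflexive e)))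
    (downward d (suc j) (≡.trans (ℕₚ.+-suc d j) e))
... | false with prefix P N (λ j p → closed j (ℕₚ.m≤n⇒m≤1+n p))
...   | r , r≤N , spec = r , ℕₚ.m≤n⇒m≤1+n r≤N , spec′
  where
  spec′ : ∀ j → j < suc N → (T (P j) → j < r) × (j < r → T (P j))
  spec′ j p with ℕₚ.m≤n⇒m<n∨m≡n (ℕₚ.≤-pred p)
  ... | inj₁ q      = spec j q
  ... | inj₂ ≡.refl = (λ t → ⊥-elim (subst T eq t)) , λ q → contradiction (ℕₚ.≤-trans q r≤N) (ℕₚ.<-irrefl ≡.refl)

partition-of : ∀ N (r : ℕ → ℕ) → (∀ i → r (suc i) ≤ r i) → (∀ i → N ≤ i → r i ≡ 0) →
  ∃[ δ ] (IsPartition δ × ∀ i → rowLen δ i ≡ r i)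
partition-of zero    r antitone vanish = [] , ((λ _ ()) , (λ _ ())) , λ i → ≡.sym (vanish i z≤n)
partition-of (suc N) r antitone vanish with r 0 in eq
... | zero = [] , ((λ _ ()) , (λ _ ())) , all-zero
  where
  all-zero : ∀ i → 0 ≡ r i
  all-zero zero    = ≡.sym eq
  all-zero (suc i) = ≡.sym (ℕₚ.n≤0⇒n≡0 (subst (r (suc i) ≤_) (≡.sym (all-zero i)) (antitone i)))
... | suc x with partition-of N (r ∘ suc) (antitone ∘ suc) (λ i p → vanish (suc i) (s≤s p))
...   | δ , (positive , decreasing) , spec = suc x ∷ δ , (positive′ , decreasing′) , spec′
  where
  spec′ : ∀ i → rowLen (suc x ∷ δ) i ≡ r i
  spec′ zero    = ≡.sym eq
  spec′ (suc i) = spec i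
  positive′ : ∀ i → i < suc (length δ) → 0 < rowLen (suc x ∷ δ) i
  positive′ zero    _       = s≤s z≤n
  positive′ (suc i) (s≤s p) = positive i p
  decreasing′ : ∀ i → suc i < suc (length δ) → rowLen (suc x ∷ δ) (suc i) ≤ rowLen (suc x ∷ δ) i
  decreasing′ i _ = ≡.subst₂ _≤_ (≡.sym (spec′ (suc i))) (≡.sym (spec′ i)) (antitone i)

module _ {sh : List ℕ} (partition : IsPartition sh) (P : Box sh → Bool)
  (closed-left : ∀ b b′ → T (P b′) → rowOf b ≡ rowOf b′ → suc (colOf b) ≡ colOf b′ → T (P b))
  (closed-up : ∀ b b′ → T (P b′) → colOf b ≡ colOf b′ → suc (rowOf b) ≡ rowOf b′ → T (P b)) where

  private
    cells : ℕ → ℕ → Bool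
    cells i j with j ℕ.<? rowLen sh i
    ... | yes p = P (box (i , j) p)
    ... | no _  = false

    cells-box : ∀ i j p → cells i j ≡ P (box (i , j) p)
    cells-box i j p with j ℕ.<? rowLen sh i
    ... | yes q = cong P (box-≡ partition ≡.refl)
    ... | no ¬q = contradiction p ¬q

    cells-T : ∀ {i j} p → T (P (box (i , j) p)) → T (cells i j)
    cells-T {i} {j} p = subst T (≡.sym (cells-box i j p))

    T-cells : ∀ {i j} p → T (cells i j) → T (P (box (i , j) p))
    T-cells {i} {j} p = subst T (cells-box i j p)

    row-prefix : ∀ i → ∃[ r ] (r ≤ rowLen sh i × ∀ j → j < rowLen sh i → (T (cells i j) → j < r) × (j < r → T (cells i j)))
    row-prefix i = prefix (cells i) (rowLen sh i) λ j p t →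
      cells-T (ℕₚ.<-trans (ℕₚ.n<1+n j) p) (closed-left _ (box (i , suc j) p) (T-cells p t) ≡.refl ≡.refl)

    r : ℕ → ℕ
    r i = proj₁ (row-prefix i)

    r≤ : ∀ i → r i ≤ rowLen sh i
    r≤ i = proj₁ (proj₂ (row-prefix i))

    r-antitone : ∀ i → r (suc i) ≤ r i
    r-antitone i with r (suc i) in eq
    ... | zero  = z≤n
    ... | suc j = proj₁ (proj₂ (proj₂ (row-prefix i)) j p′)
      (cells-T p′ (closed-up _ (box (suc i , j) p) (T-cells p
        (proj₂ (proj₂ (proj₂ (row-prefix (suc i))) j p) (subst (j <_) (≡.sym eq) ℕₚ.≤-refl))) ≡.refl ≡.refl))
      where
      p : j < rowLen sh (suc i)
      p = ℕₚ.<-≤-trans (subst (j <_) (≡.sym eq) ℕₚ.≤-refl) (r≤ (suc i))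
      p′ : j < rowLen sh i
      p′ = ℕₚ.<-≤-trans p (rowLen-suc {sh} partition i)

    rowLen-beyond : ∀ sh i → length sh ≤ i → rowLen sh i ≡ 0
    rowLen-beyond []       i       _       = ≡.refl
    rowLen-beyond (x ∷ sh) (suc i) (s≤s p) = rowLen-beyond sh i p

  -- Closure to the left makes each row of the ideal a prefix of a row of `sh`, and closure upwards
  -- makes the lengths of the prefixes weakly decreasing. They form a partition once the zeros are
  -- cut off.
  order-ideal : ∃[ δ ] (IsPartition δ × δ ⊆sh sh × ∀ b → T (P b) ⇔ InD δ (Box.pos b))
  order-ideal with partition-of (length sh) r r-antitone
    (λ i p → ℕₚ.n≤0⇒n≡0 (ℕₚ.≤-trans (r≤ i) (ℕₚ.≤-reflexive (rowLen-beyond sh i p))))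
  ... | δ , δ-partition , spec = δ , δ-partition , (λ i → subst (_≤ rowLen sh i) (≡.sym (spec i)) (r≤ i)) , λ where
    (box (i , j) p) →
      (λ t → subst (j <_) (≡.sym (spec i)) (proj₁ (proj₂ (proj₂ (row-prefix i)) j p) (cells-T p t))) ,
      (λ q → T-cells p (proj₂ (proj₂ (proj₂ (row-prefix i)) j p) (subst (j <_) (spec i) q)))


-- Reduction of a tabloid modulo the two ideals

module Core {c ℓ : Level} (K : Char0Field c ℓ) {k s : ℕ} {la mu : List ℕ}
  (la-partition : IsPartition la) (mu-partition : IsPartition mu) (mu⊆la : mu ⊆sh la)
  (F : Tableau la (Fin (k ℕ.+ s))) (F₀ : Tableau mu (Fin k)) (restricts : IsRestriction F₀ F)
  (t : Tableau la (Fin (k ℕ.+ s))) where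
  open Signs K
  open Char0Field K using (Carrier; _≈_; _+_; _*_; -_; 0#; 1#)
  module 𝕂 = Char0Field K
  open Quotient K {k ℕ.+ s} using (IsSubspace; quotient; word; ev-word; ev-ev; ≋0; _≋_; modulo)
  open Integrality K using (star; _≟ʷ_) renaming (δ to indicator)

  private
    n = k ℕ.+ s
    Dλ = diagram la-partition t
    Dμ = diagram mu-partition F₀
    module Λ = Young K Dλ
    module M = Young K Dμ
    module S = Module scalars

  open Diagram Dλ using () renaming (col to colλ; row to rowλ)
  open Diagram Dμ using () renaming (col to colμ)
  open Labels {n} k
  open Scale K Dμ using (β; β≉0; star-items; antisymmetrized; antisymmetrized-alternating; β-multiple)

  target : Fin n → ℕ
  target i = colOf (Inverse.from F i)

  -- The sum of the two ideals in degree n. In the quotient by it the claim reads φ w₀ = 0.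
  I : Tm n → Set (c ⊔ ℓ)
  I z = ∃[ y ] ∃[ y′ ] (InIdeal (TabGen mu F₀) n y × InIdeal (GenCalG k la F) n y′ ×
    ∀ f → S.ev z f ≈ S.ev y f + S.ev y′ f)

  isSubspace : IsSubspace I
  isSubspace = record
    { has-0 = [] , [] , zeroI , zeroI , λ f → 𝕂.sym (𝕂.+-identityˡ _)
    ; has-+ = λ {x} {x′} (y , z , y∈ , z∈ , e) (y′ , z′ , y′∈ , z′∈ , e′) →
        y ++ y′ , z ++ z′ , addI y∈ y′∈ , addI z∈ z′∈ , λ f → begin
          S.ev (x ++ x′) f                                    ≈⟨ S.ev-++ x x′ f ⟩
          S.ev x f + S.ev x′ f                                ≈⟨ 𝕂.+-cong (e f) (e′ f) ⟩
          (S.ev y f + S.ev z f) + (S.ev y′ f + S.ev z′ f)     ≈⟨ +-interchange _ _ _ _ ⟩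
          (S.ev y f + S.ev y′ f) + (S.ev z f + S.ev z′ f)     ≈⟨ 𝕂.+-cong (S.ev-++ y y′ f) (S.ev-++ z z′ f) ⟨
          S.ev (y ++ y′) f + S.ev (z ++ z′) f                 ∎
    ; has-scale = λ {x} a (y , z , y∈ , z∈ , e) →
        scaleT a y , scaleT a z , scaleI a y∈ , scaleI a z∈ , λ f → begin
          S.ev (scaleT a x) f                       ≈⟨ S.ev-scaled a id x f ⟩
          a * S.ev x f                              ≈⟨ 𝕂.*-congˡ (e f) ⟩
          a * (S.ev y f + S.ev z f)                 ≈⟨ 𝕂.distribˡ a _ _ ⟩
          a * S.ev y f + a * S.ev z f               ≈⟨ 𝕂.+-cong (S.ev-scaled a id y f) (S.ev-scaled a id z f) ⟨
          S.ev (scaleT a y) f + S.ev (scaleT a z) f ∎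
    }
    where
    open SetoidReasoning 𝕂.setoid

  V : LeftModule 𝕂.ring c (c ⊔ ℓ)
  V = quotient I isSubspace

  module V = Module V

  [_] : Word n → Tm n
  [_] = word I isSubspace

  open Λ.Relations V [_] using (φ; φ-col; exchange)
  open Straighten K Dλ k target V [_] using (total; WeaklyLeft; weaklyLeft; toTheLeft; ClosedUp; ClosedLeft; straighten)

  ev-φ : ∀ w f → S.ev (φ w) f ≈ S.ev Λ.young (λ p → f (p ∙ w))
  ev-φ w f = 𝕂.trans (ev-ev I isSubspace Λ.young _ f)
    (S.ev-cong Λ.young (λ p → ev-word I isSubspace (p ∙ w) f))

  ev-tabElem : ∀ (sh : List ℕ) {m} (G t : Tableau sh (Fin m)) {w} →
    tabulate (λ i → Inverse.to t (Inverse.from G i)) ≡ w →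
    ∀ f → S.ev (tabElem sh G t) f ≈ S.ev (youngSym sh t) (λ p → f (p ∙ w))
  ev-tabElem sh G t ≡.refl f = 𝕂.trans (S.ev-mulGA (youngSym sh t) _ f)
    (S.ev-cong (youngSym sh t) (λ p → 𝕂.trans (𝕂.+-identityʳ _) (𝕂.*-identityˡ _)))

  w₀ : Word n
  w₀ = tabulate (λ i → Inverse.to t (Inverse.from F i))

  lookup-w₀ : ∀ i → lookup w₀ i ≡ Inverse.to t (Inverse.from F i)
  lookup-w₀ = Vecₚ.lookup∘tabulate _

  w₀-inj : Inj w₀
  w₀-inj .injective i j e = begin
    i                                     ≡⟨ Inverse.strictlyInverseˡ F i ⟨
    Inverse.to F (Inverse.from F i)       ≡⟨ cong (Inverse.to F) (same-box) ⟩
    Inverse.to F (Inverse.from F j)       ≡⟨ Inverse.strictlyInverseˡ F j ⟩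
    j                                     ∎
    where
    open ≡.≡-Reasoning
    same-box : Inverse.from F i ≡ Inverse.from F j
    same-box = begin
      Inverse.from F i                                  ≡⟨ Inverse.strictlyInverseʳ t _ ⟨
      Inverse.from t (Inverse.to t (Inverse.from F i))  ≡⟨ cong (Inverse.from t) (≡.trans (≡.sym (lookup-w₀ i)) (≡.trans e (lookup-w₀ j))) ⟩
      Inverse.from t (Inverse.to t (Inverse.from F j))  ≡⟨ Inverse.strictlyInverseʳ t _ ⟩
      Inverse.from F j                                  ∎

  col-w₀ : ∀ i → colλ (lookup w₀ i) ≡ target i
  col-w₀ i = ≡.trans (cong colλ (lookup-w₀ i)) (cong colOf (Inverse.strictlyInverseʳ t _))

  target-left : ∀ a → target (a ↑ˡ s) ≡ colμ a
  target-left a = cong colOf (≡.trans (cong (Inverse.from F) (≡.sym at-box)) (Inverse.strictlyInverseʳ F b′))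
    where
    b = Inverse.from F₀ a
    b′ : Box la
    b′ = box (Box.pos b) (ℕₚ.<-≤-trans (Box.inD b) (mu⊆la (rowOf b)))
    at-box : Inverse.to F b′ ≡ a ↑ˡ s
    at-box = Finₚ.toℕ-injective (begin
      toℕ (Inverse.to F b′)  ≡⟨ restricts (rowOf b) (colOf b) (Box.inD b) (Box.inD b′) ⟨
      toℕ (Inverse.to F₀ b)  ≡⟨ cong toℕ (Inverse.strictlyInverseˡ F₀ a) ⟩
      toℕ a                  ≡⟨ Finₚ.toℕ-↑ˡ a s ⟨
      toℕ (a ↑ˡ s)           ∎)
      where open ≡.≡-Reasoning

  -- The column total of the labels in F itself. Words with a smaller total are to vanish in the
  -- quotient after antisymmetrization.
  N : ℕ
  N = total w₀

  module _ (w : Word n) (w-inj : Inj w) where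

    -- The tableau with T ∘ G⁻¹ = w, which makes φ w the generator t_G of the given T.
    G : Tableau la (Fin n)
    G = mk↔ₛ′ (λ b → lookup (inv w) (Inverse.to t b)) (λ i → Inverse.from t (lookup w i))
      (λ i → ≡.trans (cong (lookup (inv w)) (Inverse.strictlyInverseˡ t _)) (inv-lookup w-inj i))
      (λ b → ≡.trans (cong (Inverse.from t) (lookup-inv w-inj _)) (Inverse.strictlyInverseʳ t b))

    tabulate-G : tabulate (λ i → Inverse.to t (Inverse.from G i)) ≡ w
    tabulate-G = lookup-ext λ i → ≡.trans (Vecₚ.lookup∘tabulate _ i) (Inverse.strictlyInverseˡ t (lookup w i))

    strict-label : WeaklyLeft w → total w < N → ∃[ i ] (toℕ i < k × colλ (lookup w i) < target i)
    strict-label left smaller with any? (λ i → T? (lab i) ×-dec (colλ (lookup w i) ℕ.<? target i))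
    ... | yes (i , l , lt) = i , ℕₚ.<ᵇ⇒< _ _ l , lt
    ... | no none = contradiction smaller (ℕₚ.<-irrefl (labelSum-≡ (colλ ∘ lookup w) (colλ ∘ lookup w₀) λ i l →
      ≡.trans (ℕₚ.≤-antisym (left .toTheLeft i l) (ℕₚ.≮⇒≥ λ lt → none (i , l , lt))) (≡.sym (col-w₀ i))))

    G∈𝒢 : WeaklyLeft w → total w < N → ClosedUp w → ClosedLeft w → InCalG k F G
    G∈𝒢 left smaller closedUp closedLeft =
      (λ i i<k → left .toTheLeft i (ℕₚ.<⇒<ᵇ i<k)) ,
      strict-label left smaller ,
      δ , δ-partition , δ⊆la , λ b → (λ lt → proj₁ (spec b) (ℕₚ.<⇒<ᵇ lt)) , (λ q → ℕₚ.<ᵇ⇒< _ _ (proj₂ (spec b) q))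
      where
      at : ∀ b → Inverse.from t (lookup w (lookup (inv w) (Inverse.to t b))) ≡ b
      at = Inverse.strictlyInverseʳ G
      ideal = order-ideal la-partition (λ b → lab (Inverse.to G b))
        (λ b b′ l e e′ → closedLeft _ _ l
          (≡.trans (cong rowOf (at b)) (≡.trans e (cong rowOf (≡.sym (at b′)))))
          (≡.trans (cong (suc ∘ colOf) (at b)) (≡.trans e′ (cong colOf (≡.sym (at b′))))))
        (λ b b′ l e e′ → closedUp _ _ l
          (≡.trans (cong colOf (at b)) (≡.trans e (cong colOf (≡.sym (at b′)))))
          (≡.trans (cong (suc ∘ rowOf) (at b)) (≡.trans e′ (cong rowOf (≡.sym (at b′))))))
      δ = proj₁ ideal
      δ-partition = proj₁ (proj₂ ideal)
      δ⊆la = proj₁ (proj₂ (proj₂ ideal))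
      spec = proj₂ (proj₂ (proj₂ ideal))

    φ-closed : WeaklyLeft w → total w < N → ClosedUp w → ClosedLeft w → φ w V.≈ᴹ []
    φ-closed left smaller closedUp closedLeft = ≋0 I isSubspace {z = tabElem la G t}
      ([] , tabElem la G t , zeroI , gen (G , G∈𝒢 left smaller closedUp closedLeft , tgen t) , λ f → 𝕂.sym (𝕂.+-identityˡ _))
      (λ f → 𝕂.trans (ev-φ w f) (𝕂.sym (ev-tabElem la G t tabulate-G f)))

  φ-left : ∀ w → Inj w → WeaklyLeft w → total w < N → φ w V.≈ᴹ []
  φ-left = straighten N φ-closed

  -- The column group of μ acts on the positions here, so labels with the same target column
  -- alternate, as the treatment of twins requires.
  Φ : Word n → Tm n
  Φ w = V.ev M.colSum (λ τ → φ (w ∙ embed s τ))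

  colSum-inj : ∀ {a τ} → (a , τ) ∈ M.colSum → Inj τ
  colSum-inj q = proj₁ (proj₂ (M.colSum-items q))

  open Exchange K k colλ target using (Exchangeable; vanish-left)
  open Averaging K V colλ using (average-exchange)

  Φ-alternating : ∀ w → ∀ {i i′} → SumView s i → SumView s i′ → T (lab i) → T (lab i′) → i ≢ i′ →
    target i ≡ target i′ → Φ (w ∙ tr i i′) V.≈ᴹ V.-ᴹ Φ w
  Φ-alternating w (inˡ a) (inˡ a′) _ _ a≢a′ e = V.≈ᴹ-trans
    (V.ev-cong M.colSum (λ τ → V.≈ᴹ-reflexive (cong φ (begin
      (w ∙ tr (a ↑ˡ s) (a′ ↑ˡ s)) ∙ embed s τ ≡⟨ cong (λ u → (w ∙ u) ∙ embed s τ) (embed-tr s a a′) ⟨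
      (w ∙ embed s (tr a a′)) ∙ embed s τ     ≡⟨ ∙-assoc w (embed s (tr a a′)) (embed s τ) ⟩
      w ∙ (embed s (tr a a′) ∙ embed s τ)     ≡⟨ cong (w ∙_) (embed-∙ s (tr a a′) τ) ⟨
      w ∙ embed s (tr a a′ ∙ τ)               ∎))))
    (M.colSum-left V (≡.trans (≡.sym (target-left a)) (≡.trans e (target-left a′))) (a≢a′ ∘ cong (_↑ˡ s))
      (λ τ → φ (w ∙ embed s τ)))
    where open ≡.≡-Reasoning
  Φ-alternating w (inʳ b) _         l _ _ _ = contradiction l (unlab-right {k} s b)
  Φ-alternating w (inˡ _)  (inʳ b) _ l _ _ = contradiction l (unlab-right {k} s b)

  Φ-exchangeable : Exchangeable V Φ
  Φ-exchangeable = record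
    { alternating = λ w _ i i′ → Φ-alternating w (sumView s i) (sumView s i′)
    ; exchanges   = λ w w-inj i _ → average-exchange M.colSum (embed s) (λ q → Inj-embed s (colSum-inj q)) φ exchange w w-inj i
    }

  -- Labels trade places only within a column of μ, hence with labels of the same target.
  embed-weaklyLeft : ∀ {w τ} → WeaklyLeft w → Preserves colμ τ → WeaklyLeft (w ∙ embed s τ)
  embed-weaklyLeft {w} {τ} w-left τ-pres .toTheLeft i l = at (sumView s i) l
    where
    open ℕₚ.≤-Reasoning
    at : ∀ {i} → SumView s i → T (lab i) → colλ (lookup (w ∙ embed s τ) i) ≤ target i
    at (inʳ b) l = contradiction l (unlab-right {k} s b)
    at (inˡ a)  _ = begin
      colλ (lookup (w ∙ embed s τ) (a ↑ˡ s))         ≡⟨ cong colλ (lookup-∙ w (embed s τ) (a ↑ˡ s)) ⟩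
      colλ (lookup w (lookup (embed s τ) (a ↑ˡ s)))  ≡⟨ cong (colλ ∘ lookup w) (lookup-embedˡ s τ a) ⟩
      colλ (lookup w (lookup τ a ↑ˡ s))              ≤⟨ w-left .toTheLeft _ (lab-left s (lookup τ a)) ⟩
      target (lookup τ a ↑ˡ s)                       ≡⟨ target-left (lookup τ a) ⟩
      colμ (lookup τ a)                              ≡⟨ τ-pres .preserves a ⟩
      colμ a                                         ≡⟨ target-left a ⟨
      target (a ↑ˡ s)                                ∎

  Φ-vanish : ∀ w → Inj w → total w < N → Φ w V.≈ᴹ []
  Φ-vanish = vanish-left V Φ Φ-exchangeable N λ w w-inj w-left smaller →
    V.ev-0 M.colSum (λ {_} {τ} q → φ-left (w ∙ embed s τ) (Inj-∙ w-inj (Inj-embed s (colSum-inj q)))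
      (embed-weaklyLeft {w} {τ} (weaklyLeft w-left) (proj₂ (proj₂ (M.colSum-items q))))
      (subst (_< N) (≡.sym (labelSum-embed s colλ w (colSum-inj q))) smaller))

  Ψ : Word k → Tm n
  Ψ u = φ (w₀ ∙ embed s u)

  Ψ̂ : Word k → Tm n
  Ψ̂ = antisymmetrized V Ψ

  Ψ̂-Φ : ∀ u → Ψ̂ u V.≈ᴹ Φ (w₀ ∙ embed s u)
  Ψ̂-Φ u = V.ev-cong M.colSum (λ τ → V.≈ᴹ-reflexive (cong φ
    (≡.trans (cong (w₀ ∙_) (embed-∙ s u τ)) (≡.sym (∙-assoc w₀ (embed s u) (embed s τ))))))

  lookup-w₀-embed : ∀ u a → lookup (w₀ ∙ embed s u) (a ↑ˡ s) ≡ lookup w₀ (lookup u a ↑ˡ s)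
  lookup-w₀-embed u a = ≡.trans (lookup-∙ w₀ (embed s u) (a ↑ˡ s)) (cong (lookup w₀) (lookup-embedˡ s u a))

  col-w₀-embed : ∀ u a → colλ (lookup (w₀ ∙ embed s u) (a ↑ˡ s)) ≡ colμ (lookup u a)
  col-w₀-embed u a = ≡.trans (cong colλ (lookup-w₀-embed u a)) (≡.trans (col-w₀ _) (target-left (lookup u a)))

  sum-split : ∀ {k} (f : Fin (k ℕ.+ s) → Tm n) → V.sum f V.≈ᴹ V.sum (λ a → f (a ↑ˡ s)) V.+ᴹ V.sum (λ b → f (k ↑ʳ b))
  sum-split {zero}  f = V.≈ᴹ-sym (V.+ᴹ-identityˡ _)
  sum-split {suc k} f = V.≈ᴹ-trans (V.+ᴹ-congˡ (sum-split (f ∘ suc))) (V.≈ᴹ-sym (V.+ᴹ-assoc (f zero) _ _))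

  -- The labels fill D_μ. Exchanging one of them with an unlabelled position further to the left
  -- lowers the column total below N, so such terms vanish and the relation closes up on the
  -- permutations of D_μ.
  Ψ̂-exchanges : ∀ u → Inj u → ∀ i {j} → j < colμ (lookup u i) →
    Ψ̂ u V.≈ᴹ V.sum (λ a → Ψ̂ (u ∙ tr a i) V.when (colμ (lookup u a) ≡ᵇ j))
  Ψ̂-exchanges u u-inj i {j} j< = begin
    Ψ̂ u
      ≈⟨ Ψ̂-Φ u ⟩
    Φ w
      ≈⟨ Exchangeable.exchanges Φ-exchangeable w w-inj (i ↑ˡ s) (lab-left s i) j<col ⟩
    V.sum term
      ≈⟨ sum-split term ⟩
    V.sum (λ a → term (a ↑ˡ s)) V.+ᴹ V.sum (λ b → term (k ↑ʳ b))
      ≈⟨ V.+ᴹ-cong (V.sum-cong-≋ inside) (V.sum-0 outside) ⟩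
    V.sum (λ a → Ψ̂ (u ∙ tr a i) V.when (colμ (lookup u a) ≡ᵇ j)) V.+ᴹ []
      ≈⟨ V.+ᴹ-identityʳ _ ⟩
    V.sum (λ a → Ψ̂ (u ∙ tr a i) V.when (colμ (lookup u a) ≡ᵇ j)) ∎
    where
    open SetoidReasoning V.≈ᴹ-setoid
    w = w₀ ∙ embed s u
    w-inj : Inj w
    w-inj = Inj-∙ w₀-inj (Inj-embed s u-inj)
    j<col : j < colλ (lookup w (i ↑ˡ s))
    j<col = subst (j <_) (≡.sym (col-w₀-embed u i)) j<
    term : Fin n → Tm n
    term i′ = Φ (w ∙ tr i′ (i ↑ˡ s)) V.when (colλ (lookup w i′) ≡ᵇ j)
    inside : ∀ a → term (a ↑ˡ s) V.≈ᴹ Ψ̂ (u ∙ tr a i) V.when (colμ (lookup u a) ≡ᵇ j)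
    inside a = V.≈ᴹ-trans
      (V.≈ᴹ-reflexive (cong₂ (λ z x → Φ z V.when (x ≡ᵇ j)) moved (col-w₀-embed u a)))
      (V.when-cong (colμ (lookup u a) ≡ᵇ j) (λ _ → V.≈ᴹ-sym (Ψ̂-Φ (u ∙ tr a i))))
      where
      moved : w ∙ tr (a ↑ˡ s) (i ↑ˡ s) ≡ w₀ ∙ embed s (u ∙ tr a i)
      moved = ≡.trans (∙-assoc w₀ (embed s u) (tr (a ↑ˡ s) (i ↑ˡ s))) (cong (w₀ ∙_)
        (≡.trans (cong (embed s u ∙_) (≡.sym (embed-tr s a i))) (≡.sym (embed-∙ s u (tr a i)))))
    outside : ∀ b → term (k ↑ʳ b) V.≈ᴹ []
    outside b = V.≈ᴹ-trans (V.when-cong (colλ (lookup w (k ↑ʳ b)) ≡ᵇ j) (λ q →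
      Φ-vanish _ (Inj-∙ w-inj (Inj-tr _ _)) (subst (total (w ∙ tr (k ↑ʳ b) (i ↑ˡ s)) <_) (labelSum-embed s colλ w₀ u-inj)
        (weight-swap-< labelWeight colλ w {i ↑ˡ s} {k ↑ʳ b}
          (subst (_< colλ (lookup w (i ↑ˡ s))) (≡.sym (ℕₚ.≡ᵇ⇒≡ _ _ q)) j<col)
          (≡.subst₂ _<_ (≡.sym (labelWeight-unlab (unlab-right {k} s b))) (≡.sym (labelWeight-lab (lab-left s i))) (s≤s z≤n))))))
      (when-0 (colλ (lookup w (k ↑ʳ b)) ≡ᵇ j))
      where
      when-0 : ∀ p → [] V.when p V.≈ᴹ []
      when-0 true  = V.≈ᴹ-refl
      when-0 false = V.≈ᴹ-refl

  Ψ̂-exchangeable : Exchange.Exchangeable K k colμ colμ V Ψ̂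
  Ψ̂-exchangeable = record
    { alternating = λ u _ i i′ _ _ → antisymmetrized-alternating V Ψ u i i′
    ; exchanges   = λ u u-inj i _ → Ψ̂-exchanges u u-inj i
    }

  tabulate-F₀ : tabulate (λ i → Inverse.to F₀ (Inverse.from F₀ i)) ≡ identityW
  tabulate-F₀ = Vecₚ.tabulate-cong (Inverse.strictlyInverseˡ F₀)

  -- For T = F₀ the word T ∘ F₀⁻¹ is the identity, so the generator is c_μ applied to it.
  -- Multiplication by the identity word appends the other n - k positions, and transport along u
  -- gives the translate.
  young-in-ideal : ∀ u → Inj u → V.ev M.young (λ p → [ u ∙ embed s p ]) V.≈ᴹ []
  young-in-ideal u u-inj = ≋0 I isSubspace {z = z}
    (z , [] , transportI u (isBij-complete u-inj) (mulI (gen (tgen F₀)) identityW (isBij-complete {s} Inj-id)) , zeroI ,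
      λ f → 𝕂.sym (𝕂.+-identityʳ _))
    λ f → begin
      S.ev (V.ev M.young (λ p → [ u ∙ embed s p ])) f
        ≈⟨ ev-ev I isSubspace M.young _ f ⟩
      S.ev M.young (λ p → S.ev [ u ∙ embed s p ] f)
        ≈⟨ S.ev-cong M.young (λ p → ev-word I isSubspace (u ∙ embed s p) f) ⟩
      S.ev M.young (λ p → f (u ∙ embed s p))
        ≈⟨ S.ev-cong M.young (λ p → 𝕂.reflexive (cong (λ v → f (u ∙ embed s v)) (∙-idʳ p))) ⟨
      S.ev M.young (λ p → f (u ∙ embed s (p ∙ identityW)))
        ≈⟨ ev-tabElem mu F₀ F₀ tabulate-F₀ (λ p → f (u ∙ embed s p)) ⟨
      S.ev (tabElem mu F₀ F₀) (λ p → f (u ∙ embed s p))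
        ≈⟨ S.ev-mapped (embed s) (tabElem mu F₀ F₀) (λ w → f (u ∙ w)) ⟨
      S.ev (tabElem mu F₀ F₀ ⋆ identityW) (λ w → f (u ∙ w))
        ≈⟨ S.ev-mapped (u ∙_) (tabElem mu F₀ F₀ ⋆ identityW) f ⟨
      S.ev z f ∎
    where
    open SetoidReasoning 𝕂.setoid
    z = transportT u (tabElem mu F₀ F₀ ⋆ identityW {s})

  -- c_λ(T) acts from the left and c_μ from the right, so for each permutation p′ in c_λ(T) the sum
  -- over c_μ is a transported generator.
  Ψ-ideal : ∀ q → Inj q → V.ev M.young (λ p → Ψ (q ∙ p)) V.≈ᴹ []
  Ψ-ideal q q-inj = V.≈ᴹ-trans (V.ev-swap M.young Λ.young (λ p p′ → [ p′ ∙ (w₀ ∙ embed s (q ∙ p)) ]))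
    (V.ev-0 Λ.young (λ {_} {p′} p′∈ → V.≈ᴹ-trans
      (V.ev-cong M.young (λ p → V.≈ᴹ-reflexive (cong [_] (begin
        p′ ∙ (w₀ ∙ embed s (q ∙ p))             ≡⟨ cong (λ z → p′ ∙ (w₀ ∙ z)) (embed-∙ s q p) ⟩
        p′ ∙ (w₀ ∙ (embed s q ∙ embed s p))     ≡⟨ cong (p′ ∙_) (∙-assoc w₀ (embed s q) (embed s p)) ⟨
        p′ ∙ ((w₀ ∙ embed s q) ∙ embed s p)     ≡⟨ ∙-assoc p′ (w₀ ∙ embed s q) (embed s p) ⟨
        (p′ ∙ (w₀ ∙ embed s q)) ∙ embed s p     ∎))))
      (young-in-ideal _ (Inj-∙ (proj₂ (Λ.young-items p′∈)) (Inj-∙ w₀-inj (Inj-embed s q-inj))))))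
    where open ≡.≡-Reasoning

  Ψ̂-id : Ψ̂ identityW V.≈ᴹ []
  Ψ̂-id = V.cancel-scalar β≉0 (V.≈ᴹ-trans (V.≈ᴹ-sym (β-multiple V Ψ Ψ̂-exchangeable))
    (V.ev-0 (star M.young) (λ {_} {q} q∈ → Ψ-ideal q (star-items q∈))))

  -- At w₀ every column of μ sits inside a column of λ, so a column permutation of μ on the
  -- positions is a column permutation of λ on the letters, and φ turns it into its sign.
  Ψ-sign : ∀ {τ} → Inj τ → Preserves colμ τ → Ψ τ V.≈ᴹ sgn τ V.*ₗ φ w₀
  Ψ-sign {τ} τ-inj τ-pres = V.≈ᴹ-trans (sign-extension V colμ Ψ alternating τ τ-inj τ-pres)
    (V.*ₗ-congˡ (V.≈ᴹ-reflexive (cong φ (≡.trans (cong (w₀ ∙_) (embed-id s)) (∙-idʳ w₀)))))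
    where
    alternating : ∀ g → Inj g → Preserves colμ g → ∀ i j → i ≢ j → colμ i ≡ colμ j → Ψ (g ∙ tr i j) V.≈ᴹ V.-ᴹ Ψ g
    alternating g g-inj g-pres i j i≢j e = V.≈ᴹ-trans (V.≈ᴹ-reflexive (cong φ moved))
      (φ-col w (≡.trans (at i) (≡.trans e (≡.sym (at j))))
        (λ q → i≢j (Finₚ.↑ˡ-injective s i j (w-inj .injective _ _ q))))
      where
      w = w₀ ∙ embed s g
      w-inj : Inj w
      w-inj = Inj-∙ w₀-inj (Inj-embed s g-inj)
      at : ∀ a → colλ (lookup w (a ↑ˡ s)) ≡ colμ a
      at a = ≡.trans (col-w₀-embed g a) (g-pres .preserves a)
      moved : w₀ ∙ embed s (g ∙ tr i j) ≡ tr (lookup w (i ↑ˡ s)) (lookup w (j ↑ˡ s)) ∙ w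
      moved = ≡.trans (cong (w₀ ∙_) (≡.trans (embed-∙ s g (tr i j)) (cong (embed s g ∙_) (embed-tr s i j))))
        (≡.trans (≡.sym (∙-assoc w₀ (embed s g) (tr (i ↑ˡ s) (j ↑ˡ s)))) (tr-conj w-inj _ _))

  φ-w₀ : φ w₀ V.≈ᴹ []
  φ-w₀ = V.cancel-scalar length≉0 (begin
    nat (length M.colSum) V.*ₗ φ w₀
      ≈⟨ NonVanishing.colSum-sgn K Dμ V (φ w₀) ⟨
    V.ev M.colSum (λ τ → sgn τ V.*ₗ φ w₀)
      ≈⟨ V.ev-cong∈ M.colSum (λ q → let _ , τ-inj , τ-pres = M.colSum-items q in Ψ-sign τ-inj τ-pres) ⟨
    V.ev M.colSum Ψ
      ≈⟨ V.ev-cong M.colSum (λ τ → V.≈ᴹ-reflexive (cong Ψ (∙-idˡ τ))) ⟨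
    Ψ̂ identityW
      ≈⟨ Ψ̂-id ⟩
    [] ∎)
    where
    open SetoidReasoning V.≈ᴹ-setoid
    length≉0 : ¬ (nat (length M.colSum) ≈ 0#)
    length≉0 e = V.nat≉0 (proj₁ (NonVanishing.colSum-nonempty K Dμ))
      (𝕂.trans (𝕂.reflexive (cong nat (≡.sym (proj₂ (NonVanishing.colSum-nonempty K Dμ))))) e)

  coeff-ev : ∀ (x : Tm n) w → coeff x w ≈ S.ev x (λ v → indicator v w)
  coeff-ev []            w = 𝕂.refl
  coeff-ev ((a , v) ∷ x) w with does (v ≟ʷ w)
  ... | true  = 𝕂.+-cong (𝕂.sym (𝕂.*-identityʳ a)) (coeff-ev x w)
  ... | false = 𝕂.trans (coeff-ev x w) (𝕂.sym (𝕂.trans (𝕂.+-congʳ (𝕂.zeroʳ a)) (𝕂.+-identityˡ _)))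

  ev⇒≈T : ∀ {x y : Tm n} → (∀ f → S.ev x f ≈ S.ev y f) → x ≈T y
  ev⇒≈T {x} {y} e w = 𝕂.trans (coeff-ev x w) (𝕂.trans (e _) (𝕂.sym (coeff-ev y w)))

  tabElem-reduces : InSum (TabGen mu F₀) (GenCalG k la F) n (tabElem la F t)
  tabElem-reduces = conclude
    (λ f → 𝕂.trans (ev-tabElem la F t ≡.refl f) (𝕂.sym (ev-φ w₀ f))) φ-w₀
    where
    conclude : ∀ {x} → (∀ f → S.ev (tabElem la F t) f ≈ S.ev x f) → x V.≈ᴹ [] →
      InSum (TabGen mu F₀) (GenCalG k la F) n (tabElem la F t)
    conclude {x} same (modulo z (y , y′ , y∈ , y′∈ , e) e′) = y , y′ , y∈ , y′∈ , ev⇒≈T {tabElem la F t} {y ++ y′} λ f → begin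
      S.ev (tabElem la F t) f   ≈⟨ same f ⟩
      S.ev x f                  ≈⟨ e′ f ⟩
      0# + S.ev z f             ≈⟨ 𝕂.+-identityˡ _ ⟩
      S.ev z f                  ≈⟨ e f ⟩
      S.ev y f + S.ev y′ f      ≈⟨ S.ev-++ y y′ f ⟨
      S.ev (y ++ y′) f          ∎
      where open SetoidReasoning 𝕂.setoid


-- The restricted tabloids

restriction : ∀ {la δ : List ℕ} {k n} (G : Tableau la (Fin n)) → k ≤ n → δ ⊆sh la → IsPartition la → IsPartition δ →
  PreimageIsDiagram k G δ → ∃[ G₀ ] IsRestriction {δ} {la} {k} {n} G₀ G
restriction {la} {δ} {k} {n} G k≤n δ⊆la la-partition δ-partition pre =
  mk↔ₛ′ to from to-from from-to , λ i j p q →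
    ≡.trans (Finₚ.toℕ-fromℕ< _) (cong (toℕ ∘ Inverse.to G) (box-≡ la-partition ≡.refl))
  where
  enlarge : Box δ → Box la
  enlarge b = box (Box.pos b) (ℕₚ.<-≤-trans (Box.inD b) (δ⊆la (rowOf b)))
  to : Box δ → Fin k
  to b = fromℕ< (proj₂ (pre (enlarge b)) (Box.inD b))
  widen : Fin k → Fin n
  widen i = inject≤ i k≤n
  widen<k : ∀ i → toℕ (Inverse.to G (Inverse.from G (widen i))) < k
  widen<k i = subst (_< k) (≡.sym (≡.trans (cong toℕ (Inverse.strictlyInverseˡ G (widen i))) (Finₚ.toℕ-inject≤ i k≤n)))
    (Finₚ.toℕ<n i)
  from : Fin k → Box δ
  from i = box (Box.pos (Inverse.from G (widen i))) (proj₁ (pre (Inverse.from G (widen i))) (widen<k i))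
  to-from : ∀ i → to (from i) ≡ i
  to-from i = Finₚ.toℕ-injective (begin
    toℕ (to (from i))                                 ≡⟨ Finₚ.toℕ-fromℕ< _ ⟩
    toℕ (Inverse.to G (enlarge (from i)))             ≡⟨ cong (toℕ ∘ Inverse.to G) (box-≡ la-partition ≡.refl) ⟩
    toℕ (Inverse.to G (Inverse.from G (widen i)))     ≡⟨ cong toℕ (Inverse.strictlyInverseˡ G (widen i)) ⟩
    toℕ (widen i)                                     ≡⟨ Finₚ.toℕ-inject≤ i k≤n ⟩
    toℕ i                                             ∎)
    where open ≡.≡-Reasoning
  from-to : ∀ b → from (to b) ≡ b
  from-to b = box-≡ δ-partition (cong Box.pos (begin
    Inverse.from G (widen (to b))                  ≡⟨ cong (Inverse.from G) widen-to ⟩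
    Inverse.from G (Inverse.to G (enlarge b))      ≡⟨ Inverse.strictlyInverseʳ G (enlarge b) ⟩
    enlarge b                                      ∎))
    where
    open ≡.≡-Reasoning
    widen-to : widen (to b) ≡ Inverse.to G (enlarge b)
    widen-to = Finₚ.toℕ-injective (≡.trans (Finₚ.toℕ-inject≤ (to b) k≤n) (Finₚ.toℕ-fromℕ< _))

InCalG-trans : ∀ {la : List ℕ} {n k} {F G H : Tableau la (Fin n)} → InCalG k F G → InCalG k G H → InCalG k F H
InCalG-trans {F = F} {G} {H} (p , _) (q , (i , i<k , lt) , δ) =
  (λ i i<k → ℕₚ.≤-trans (q i i<k) (p i i<k)) , (i , i<k , ℕₚ.<-≤-trans lt (p i i<k)) , δ

module Restricted {c ℓ : Level} (K : Char0Field c ℓ) where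
  open WithField K
  module 𝕂 = Char0Field K

  ideal-mono : ∀ {P Q : Gens} → (∀ {m x} → P m x → InIdeal Q m x) → ∀ {m x} → InIdeal P m x → InIdeal Q m x
  ideal-mono h (gen p)            = h p
  ideal-mono h zeroI              = zeroI
  ideal-mono h (addI p q)         = addI (ideal-mono h p) (ideal-mono h q)
  ideal-mono h (scaleI a p)       = scaleI a (ideal-mono h p)
  ideal-mono h (respI e p)        = respI e (ideal-mono h p)
  ideal-mono h (transportI φ b p) = transportI φ b (ideal-mono h p)
  ideal-mono h (mulI p β b)       = mulI (ideal-mono h p) β b

  module _ {k n : ℕ} {la : List ℕ} (la-partition : IsPartition la) (k≤n : k ≤ n)
    (reduce : ∀ {mu} → IsPartition mu → mu ⊆sh la → ∀ (F : Tableau la (Fin n)) (F₀ : Tableau mu (Fin k)) →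
      IsRestriction F₀ F → TabloidIn la F (InSum (TabGen mu F₀) (GenCalG k la F))) where

    open Labels {n} k

    columns : Tableau la (Fin n) → ℕ
    columns F = ΣN.sum (λ i → labelWeight i ℕ.* colOf (Inverse.from F i))

    columns-decrease : ∀ {F G} → InCalG k F G → columns G < columns F
    columns-decrease {F} {G} (p , (i , i<k , lt) , _) =
      labelSum-< (colOf ∘ Inverse.from G) (colOf ∘ Inverse.from F) (λ i l → p i (ℕₚ.<ᵇ⇒< _ _ l)) i (ℕₚ.<⇒<ᵇ i<k) lt

    -- All μ are treated at once because the induction passes from F and μ to G and δ. For a
    -- generator of G, the first inclusion's analogue splits it into a part in the ideal of G₀,
    -- which is one of the allowed tabloids, and a part in the ideal for 𝒢(G).
    reduce-restricted : ∀ {mu} → IsPartition mu → mu ⊆sh la → ∀ (F : Tableau la (Fin n)) (F₀ : Tableau mu (Fin k)) →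
      IsRestriction F₀ F → TabloidIn la F (InSum (TabGen mu F₀) (GenCalG₀ k la F))
    reduce-restricted mu-partition mu⊆la F F₀ restricts =
      <-rec Goal induct (columns F) mu-partition mu⊆la F ≡.refl F₀ restricts
      where
      Goal : ℕ → Set _
      Goal x = ∀ {mu} → IsPartition mu → mu ⊆sh la → ∀ (F : Tableau la (Fin n)) → columns F ≡ x →
        ∀ (F₀ : Tableau mu (Fin k)) → IsRestriction F₀ F → TabloidIn la F (InSum (TabGen mu F₀) (GenCalG₀ k la F))
      induct : ∀ x → (∀ {y} → y < x → Goal y) → Goal x
      induct x rec mu-partition mu⊆la F ≡.refl F₀ restricts t =
        let y , z , y∈ , z∈ , e = reduce mu-partition mu⊆la F F₀ restricts t
        in y , z , y∈ , ideal-mono generator z∈ , e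
        where
        weaken : ∀ {G} → InCalG k F G → ∀ {m x} → GenCalG₀ k la G m x → GenCalG₀ k la F m x
        weaken {G} G∈ (H , H∈ , rest) = H , InCalG-trans {F = F} {G} {H} G∈ H∈ , rest
        generator : ∀ {m x} → GenCalG k la F m x → InIdeal (GenCalG₀ k la F) m x
        generator (G , G∈@(_ , _ , δ , δ-partition , δ⊆la , pre) , tgen t) =
          let G₀ , G-restricts = restriction G k≤n δ⊆la la-partition δ-partition pre
              y , z , y∈ , z∈ , e = rec (columns-decrease {F} {G} G∈) δ-partition δ⊆la G ≡.refl G₀ G-restricts t
          in respI (λ w → 𝕂.sym (e w)) (addI
            (ideal-mono (λ p → gen (G , G∈ , δ , pre , G₀ , G-restricts , p)) y∈)
            (ideal-mono (λ p → gen (weaken {G} G∈ p)) z∈))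

theorem3p2 : ∀ {c ℓ : Level} (K : Char0Field c ℓ) → let open WithField K in
    (k n : ℕ) → 0 < k → k ≤ n →
    (la mu : List ℕ) → IsPartitionOf n la → IsPartitionOf k mu → mu ⊆sh la →
    (F : Tableau la (Fin n)) → PreimageIsDiagram k F mu →
    (F₀ : Tableau mu (Fin k)) → IsRestriction F₀ F →
    TabloidIn la F (InSum (TabGen mu F₀) (GenCalG k la F))
    × TabloidIn la F (InSum (TabGen mu F₀) (GenCalG₀ k la F))
theorem3p2 K k n _ k≤n la mu (la-partition , _) (mu-partition , _) mu⊆la F _ F₀ restricts
  with ℕₚ.m≤n⇒∃[o]m+o≡n k≤n
-- Writing n as k + s makes the labels the left summand of the positions, along which permutations
-- of k points extend by `embed`.
... | s , ≡.refl = reduce mu-partition mu⊆la F F₀ restricts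
                 , Restricted.reduce-restricted K la-partition k≤n reduce mu-partition mu⊆la F F₀ restricts
  where
  open WithField K
  reduce : ∀ {mu} → IsPartition mu → mu ⊆sh la → ∀ (F : Tableau la (Fin (k ℕ.+ s))) (F₀ : Tableau mu (Fin k)) →
    IsRestriction F₀ F → TabloidIn la F (InSum (TabGen mu F₀) (GenCalG k la F))
  reduce mu-partition mu⊆la F F₀ restricts t = Core.tabElem-reduces K la-partition mu-partition mu⊆la F F₀ restricts t
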